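{- Let $q$ be a power of a prime $p$, let $0\le j\le q-2$, $n=j+2$, and put $k=2j+2+(n-1)(q-1)$ and $m\equiv j+1\pmod{q-1}$. Let $M,D,A,F,T$ be the $n\times n$ matrices over $\mathbb{C}_\infty$ defined in the context. Then all of the following hold: 1. $\mathrm{Ker}(MA)\cap\mathrm{Ker}(F+MD)=\mathrm{Ker}(MA)\cap F(\mathrm{Ker}(I+MA))=0$; 2. if $q$ is odd, $MD$ is diagonalizable; if $q$ is even, $MD$ is diagonalizable if and only if $\dim_{\mathbb{C}_\infty}S^{1,new}_{k,m}(\Gamma_0(t))\le1$; 3. $S^1_{k,m}(\Gamma_0(t))=S^{1,old}_{k,m}(\Gamma_0(t))\oplus S^{1,new}_{k,m}(\Gamma_0(t))=(\mathrm{Ker}(MA)\oplus\mathrm{Ker}(MD))\oplus(\mathrm{Ker}(T)\cap F\,\mathrm{Ker}(T))$, where $S^1_{k,m}(\Gamma_0(t))$ is identified with $\mathbb{C}_\infty^n$ via the basis described in the context.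
   Context: Modular forms. $K=\mathbb{F}_q(t)$, $K_\infty$ is its completion at $\infty=1/t$, $\mathbb{C}_\infty$ is the completion of an algebraic closure of $K_\infty$, and $\Omega=\mathbb{P}^1(\mathbb{C}_\infty)-\mathbb{P}^1(K_\infty)$ is the Drinfeld upper half plane. For $\gamma=\begin{pmatrix}a&b\\c&d\end{pmatrix}\in GL_2(K_\infty)$ and $\varphi:\Omega\to\mathbb{C}_\infty$ put $(\varphi|_{k,m}\gamma)(z)=\varphi(\gamma z)(\det\gamma)^m(cz+d)^{ -k}$. For $\Gamma=GL_2(\mathbb{F}_q[t])$ or $\Gamma=\Gamma_0(t)=\{\begin{pmatrix}a&b\\c&d\end{pmatrix}\in GL_2(\mathbb{F}_q[t]): c\equiv0 \bmod t\}$, $S^1_{k,m}(\Gamma)$ is the (finite dimensional) $\mathbb{C}_\infty$-space of cusp forms of weight $k$ and type $m$: rigid analytic $\varphi:\Omega\to\mathbb{C}_\infty$ with $\varphi|_{k,m}\gamma=\varphi$ for all $\gamma\in\Gamma$, holomorphic and vanishing at all cusps. It depends on $m$ only modulo $q-1$. The Atkin operator on $S^1_{k,m}(\Gamma_0(t))$ is $\mathbf{U}_t(\varphi)(z)=\sum_{b\in\mathbb{F}_q}\varphi\left(\frac{z+b}{t}\right)$; the Hecke operator on $S^1_{k,m}(GL_2(\mathbb{F}_q[t]))$ is $\mathbf{T}_t(\varphi)(z)=t^k\varphi(tz)+\sum_{b\in\mathbb{F}_q}\varphi\left(\frac{z+b}{t}\right)$ (item 1 is the matrix form of $\mathrm{Ker}(\mathbf{T}_t)=0$).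 Oldforms: let $\delta_1,\delta_t:S^1_{k,m}(GL_2(\mathbb{F}_q[t]))\to S^1_{k,m}(\Gamma_0(t))$ be $\delta_1(\varphi)=\varphi$, $\delta_t(\varphi)(z)=t^m\varphi(tz)$, and $\delta(\varphi,\psi)=\delta_1\varphi+\delta_t\psi$; then $S^{1,old}_{k,m}(\Gamma_0(t))=\mathrm{Im}(\delta)$. Newforms: let $\varphi^{Fr}=\varphi|_{k,m}\begin{pmatrix}0&-1\\t&0\end{pmatrix}$ (Fricke involution), $Tr(\varphi)=\sum_{\gamma\in R}\varphi|_{k,m}\gamma$ with $R=\{\mathrm{Id}\}\cup\{\begin{pmatrix}0&-1\\1&b\end{pmatrix}:b\in\mathbb{F}_q\}$, and $Tr'(\varphi)=Tr(\varphi^{Fr})$; then $S^{1,new}_{k,m}(\Gamma_0(t))=\mathrm{Ker}(Tr)\cap\mathrm{Ker}(Tr')$. Basis. Let $\Gamma_1(t)\subset\Gamma_0(t)$ be the subgroup with diagonal entries $\equiv1 \bmod t$. Teitelbaum's residue isomorphism identifies $S^1_{k,m}(\Gamma_1(t))$ with the harmonic cocycles of weight $k$ for $\Gamma_1(t)$: functions $\mathbf{c}$ from oriented edges of the Bruhat-Tits tree of $GL_2(K_\infty)$ (edges $=GL_2(K_\infty)/Z(K_\infty)\mathcal{I}(K_\infty)$, with $\mathcal{I}$ the Iwahori subgroup) to the dual of $V=\bigoplus_{i=0}^{k-2}\mathbb{C}_\infty X^iY^{k-2-i}$ which are harmonic, antisymmetric under edge reversal, and $\Gamma_1(t)$-equivariant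 for the action $(\gamma\omega)(X^iY^{k-2-i})=\det(\gamma)^{1-m}\omega((aX+bY)^i(cX+dY)^{k-2-i})$. Such a cocycle is determined by its value on the edge $\bar e$ represented by $\begin{pmatrix}0&1\\1&0\end{pmatrix}$, and a basis is $\mathbf{c}_0,\dots,\mathbf{c}_{k-2}$ where $\mathbf{c}_i(\bar e)(X^lY^{k-2-l})=1$ if $l=i$ and $0$ otherwise. For $k,j,n,m$ as in the claim, $S^1_{k,m}(\Gamma_0(t))$ has basis $\mathbf{c}_{j+(b-1)(q-1)}$, $1\le b\le n$. Matrices (size $n\times n$). $M=(m_{a,b})$ has entries in $\mathbb{F}_p$: $$m_{a,b}=-\left[\binom{j+(n-a)(q-1)}{j+(n-b)(q-1)}+(-1)^{j+1}\binom{j+(n-a)(q-1)}{j+(b-1)(q-1)}\right]\ (a\ne b),\qquad m_{a,a}=(-1)^j\binom{j+(n-a)(q-1)}{j+(a-1)(q-1)},$$ with $\binom{x}{y}=0$ if $y>x$. With $s_i=j+1+(i-1)(q-1)$: $D=\mathrm{diag}(t^{s_1},\dots,t^{s_n})$; $F$ is the antidiagonal matrix whose entry in row $n+1-b$, column $b$ is $(-t)^{s_b}$; $A$ is the antidiagonal matrix with all antidiagonal entries $(-1)^{j+1}$; $I$ is the identity; $T=I+MA$. In the basis $\mathbf{c}_{j+(b-1)(q-1)}$, $1\le b\le n$, of $S^1_{k,m}(\Gamma_0(t))$ (column convention), $\mathbf{U}_t$ has matrix $MD$, the Fricke involution has matrix $t^{m-k}F$, $Tr$ has matrix $T$, and $Tr'$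 has matrix $t^{m-k}(F+MD)$; moreover $\mathrm{Im}(\delta_1)=\mathrm{Ker}(MA)$, $\mathrm{Im}(\delta_t)=\mathrm{Ker}(MD)$ and newforms are $\mathrm{Ker}(T)\cap F(\mathrm{Ker}(T))$. -}

module Defs where

open import Algebra.Bundles using (CommutativeRing)
import Algebra.Morphism.Structures as Morphisms
import Algebra.Definitions.RawMonoid as RawMonoidDefs
import Algebra.Properties.Monoid.Sum as MonoidSum
import Algebra.Properties.Semiring.Exp as SemiringExp
import Algebra.Properties.Ring as RingProperties
open import Data.Bool.Base using (if_then_else_)
open import Data.Empty using (⊥-elim)
open import Data.Fin.Base using (Fin; toℕ; opposite)
open import Data.Fin.Properties using (_≟_)
open import Data.Integer.Base using (ℤ; +_; -[1+_]) renaming (-_ to -ᶻ_; _-_ to _-ᶻ_)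
open import Data.List.Base using (List; []; _∷_; _++_; foldr)
open import Data.List.Relation.Unary.All using (All)
open import Data.Nat.Base using (ℕ; zero; suc; _∸_; _≤_; NonZero)
  renaming (_+_ to _+ⁿ_; _*_ to _*ⁿ_)
open import Data.Nat.Combinatorics using () renaming (_C_ to _choose_)
open import Data.Product using (_×_; _,_; ∃; ∃₂; proj₁; proj₂)
open import Data.Rational.Base using (ℚ; 1ℚ; _/_) renaming (_≤_ to _≤ℚ_; _+_ to _+ℚ_; -_ to -ℚ_)
open import Function.Bundles using (Inverse)
open import Level using (0ℓ; suc)
open import Relation.Binary.Construct.Add.Supremum.NonStrict _≤ℚ_ using (_≤⁺_) public
open import Relation.Binary.PropositionalEquality.Core as ≡ using (_≡_)
import Relation.Binary.PropositionalEquality.Properties as ≡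
import Relation.Binary.Reasoning.Setoid as SetoidReasoning
open import Relation.Nullary using (¬_; Dec; yes; no; does)
open import Relation.Nullary.Construct.Add.Supremum using (_⁺; [_]; ⊤⁺)
open import Relation.Unary using (Pred; _∈_; _∩_; _≐_; U)

-- The value of _⁻¹ at 0 is irrelevant: it is only applied to nonzero
-- elements below.
record Field : Set₁ where
  infix 8 _⁻¹
  field
    commutativeRing : CommutativeRing 0ℓ 0ℓ
  open CommutativeRing commutativeRing public
  field
    1≉0        : 1# ≉ 0#
    _⁻¹        : Carrier → Carrier
    *-inverseʳ : ∀ {x} → x ≉ 0# → x * x ⁻¹ ≈ 1#

infixl 6 _+⁺_
_+⁺_ : ℚ ⁺ → ℚ ⁺ → ℚ ⁺
[ r ] +⁺ [ s ] = [ r +ℚ s ]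
[ r ] +⁺ ⊤⁺    = ⊤⁺
⊤⁺    +⁺ s     = ⊤⁺

-- Absolute values are written additively, |x| = q^(- v x); rational
-- exponents suffice because |ℂ∞ˣ| = q^ℚ.
record ValuedField : Set₁ where
  field
    field₀ : Field
  open Field field₀ public
  field
    v      : Carrier → ℚ ⁺
    v-cong : ∀ {x y} → x ≈ y → v x ≡ v y
    v-0    : v 0# ≡ ⊤⁺
    v-⊤    : ∀ {x} → v x ≡ ⊤⁺ → x ≈ 0#
    v-*    : ∀ x y → v (x * y) ≡ v x +⁺ v y
    v-+    : ∀ x y → v x ≤⁺ v y → v x ≤⁺ v (x + y)

-- A valued field containing 𝔽_q(t), with |t| = q.
record ValuedExtension (q : ℕ) : Set₁ where
  field
    valuedField : ValuedField
    𝔽           : Field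
  open ValuedField valuedField public
  module 𝔽 = Field 𝔽
  field
    enum  : Inverse (≡.setoid (Fin q)) 𝔽.setoid
    ι     : 𝔽.Carrier → Carrier
    ι-hom : Morphisms.IsRingHomomorphism 𝔽.rawRing rawRing ι
    t     : Carrier
    v-t   : v t ≡ [ -ℚ 1ℚ ]

module Extension {q : ℕ} (E : ValuedExtension q) where
  open ValuedExtension E public
  open SemiringExp semiring public using (_^_)
  open MonoidSum +-monoid public using (sum; sum-syntax)

  infix 4 _≤v_ _v≤_
  _≤v_ : ℤ → Carrier → Set
  N ≤v x = [ N / 1 ] ≤⁺ v x

  _v≤_ : Carrier → ℤ → Set
  x v≤ N = v x ≤⁺ [ N / 1 ]

  Cauchy : (ℕ → Carrier) → Set
  Cauchy s = ∀ N → ∃ λ i₀ → ∀ i j → i₀ ≤ i → i₀ ≤ j → N ≤v (s i - s j)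

  infix 4 _⟶_
  _⟶_ : (ℕ → Carrier) → Carrier → Set
  s ⟶ l = ∀ N → ∃ λ i₀ → ∀ i → i₀ ≤ i → N ≤v (s i - l)

  -- Coefficients are listed from the constant term upwards.
  eval : List Carrier → Carrier → Carrier
  eval as x = foldr (λ a r → a + x * r) 0# as

  𝔽q : Fin q → Carrier
  𝔽q i = ι (Inverse.to enum i)

  -- A = 𝔽_q[t], as the subring generated by 𝔽_q and t.
  infix 4 _∈A _∈K∞
  data _∈A : Carrier → Set where
    resp  : ∀ {x y} → x ≈ y → x ∈A → y ∈A
    const : ∀ b → ι b ∈A
    var   : t ∈A
    add   : ∀ {x y} → x ∈A → y ∈A → (x + y) ∈A
    mul   : ∀ {x y} → x ∈A → y ∈A → (x * y) ∈A

  -- The completion of 𝔽_q(t) at ∞ is its closure in a complete field,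
  -- that is, the closed subfield generated by 𝔽_q and t.
  data _∈K∞ : Carrier → Set where
    resp  : ∀ {x y} → x ≈ y → x ∈K∞ → y ∈K∞
    const : ∀ b → ι b ∈K∞
    var   : t ∈K∞
    add   : ∀ {x y} → x ∈K∞ → y ∈K∞ → (x + y) ∈K∞
    neg   : ∀ {x} → x ∈K∞ → (- x) ∈K∞
    mul   : ∀ {x y} → x ∈K∞ → y ∈K∞ → (x * y) ∈K∞
    inv   : ∀ {x} → x ≉ 0# → x ∈K∞ → (x ⁻¹) ∈K∞
    lim   : ∀ {x} → (∀ N → ∃ λ y → (y ∈K∞) × N ≤v (x - y)) → x ∈K∞

  Algebraic : Carrier → Set
  Algebraic x = ∃ λ as → All _∈K∞ as × eval (as ++ 1# ∷ []) x ≈ 0#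

-- ℂ∞ up to isomorphism: complete, algebraically closed, and with the
-- algebraic closure of K∞ dense in it.
record ℂ∞ (q : ℕ) : Set₁ where
  field
    extension : ValuedExtension q
  open Extension extension public
  field
    complete            : ∀ s → Cauchy s → ∃ λ l → s ⟶ l
    algebraicallyClosed : ∀ a as → ∃ λ x → eval (a ∷ as ++ 1# ∷ []) x ≈ 0#
    dense               : ∀ x N → ∃ λ y → Algebraic y × N ≤v (x - y)

module Drinfeld {q : ℕ} (C : ℂ∞ q) where
  open ℂ∞ C public
  open RingProperties ring using (-0#≈0#; -‿distribʳ-*; x∙y⁻¹≈ε⇒x≈y)

  infixr 8 _^ᶻ_
  _^ᶻ_ : Carrier → ℤ → Carrier
  x ^ᶻ (+ n)    = x ^ n
  x ^ᶻ -[1+ n ] = (x ^ ℕ.suc n) ⁻¹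

  -- Used both for X = Fin n (column vectors) and for X = Ω.
  module _ {X : Set} where
    infix 4 _≋_
    _≋_ : (f g : X → Carrier) → Set
    f ≋ g = ∀ x → f x ≈ g x

    0ᶠ : X → Carrier
    0ᶠ _ = 0#

    infixl 6 _⊕_ _+ˢ_
    _⊕_ : (f g : X → Carrier) → X → Carrier
    (f ⊕ g) x = f x + g x

    lincomb : ∀ {n} → (Fin n → Carrier) → (Fin n → X → Carrier) → X → Carrier
    lincomb {n} a c x = ∑[ i < n ] (a i * c i x)

    Zero : Pred (X → Carrier) 0ℓ
    Zero f = f ≋ 0ᶠ

    _+ˢ_ : (V W : Pred (X → Carrier) 0ℓ) → Pred (X → Carrier) 0ℓ
    (V +ˢ W) h = ∃₂ λ f g → V f × W g × h ≋ f ⊕ g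

    infix 3 _isDirectSumOf_and_
    _isDirectSumOf_and_ : (S V W : Pred (X → Carrier) 0ℓ) → Set
    S isDirectSumOf V and W = S ≐ V +ˢ W × (V ∩ W) ≐ Zero

    IsBasis : ∀ {n} → Pred (X → Carrier) 0ℓ → (Fin n → X → Carrier) → Set
    IsBasis V c = V ≐ (λ f → ∃ λ a → f ≋ lincomb a c)
                × (∀ a → lincomb a c ≋ 0ᶠ → ∀ i → a i ≈ 0#)

    HasDimension : Pred (X → Carrier) 0ℓ → ℕ → Set
    HasDimension V d = ∃ λ (c : Fin d → X → Carrier) → IsBasis V c

    -- The subspace with coordinates in W with respect to c.
    WithCoordinates : ∀ {n} → (Fin n → X → Carrier) →
                      Pred (Fin n → Carrier) 0ℓ → Pred (X → Carrier) 0ℓ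
    WithCoordinates c W f = ∃ λ a → W a × f ≋ lincomb a c

  Matrix : ℕ → Set
  Matrix n = Fin n → Fin n → Carrier

  module _ {n : ℕ} where
    infix  4 _≋ᴹ_
    infixl 6 _+ᴹ_
    infixl 7 _*ᴹ_ _*ᵥ_
    infixr 7 _·ᴹ_

    _≋ᴹ_ : (N P : Matrix n) → Set
    N ≋ᴹ P = ∀ a b → N a b ≈ P a b

    diag : (Fin n → Carrier) → Matrix n
    diag d a b = if does (a ≟ b) then d a else 0#

    antidiag : (Fin n → Carrier) → Matrix n
    antidiag d a b = if does (a ≟ opposite b) then d b else 0#

    1ᴹ : Matrix n
    1ᴹ = diag (λ _ → 1#)

    _+ᴹ_ _*ᴹ_ : Matrix n → Matrix n → Matrix n
    (N +ᴹ P) a b = N a b + P a b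
    (N *ᴹ P) a b = ∑[ i < n ] (N a i * P i b)

    _·ᴹ_ : Carrier → Matrix n → Matrix n
    (x ·ᴹ N) a b = x * N a b

    _*ᵥ_ : Matrix n → (Fin n → Carrier) → (Fin n → Carrier)
    (N *ᵥ x) a = ∑[ i < n ] (N a i * x i)

    Ker : Matrix n → Pred (Fin n → Carrier) 0ℓ
    Ker N x = N *ᵥ x ≋ 0ᶠ

    Image : Matrix n → Pred (Fin n → Carrier) 0ℓ → Pred (Fin n → Carrier) 0ℓ
    Image N W y = ∃ λ x → W x × y ≋ N *ᵥ x

    Diagonalizable : Matrix n → Set
    Diagonalizable N = ∃₂ λ P P⁻¹ → ∃ λ d →
      P *ᴹ P⁻¹ ≋ᴹ 1ᴹ × P⁻¹ *ᴹ P ≋ᴹ 1ᴹ × N *ᴹ P ≋ᴹ P *ᴹ diag d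

    HasMatrix : ∀ {X : Set} → ((X → Carrier) → X → Carrier) →
                (Fin n → X → Carrier) → Matrix n → Set
    HasMatrix L c N = ∀ b → L (c b) ≋ lincomb (λ a → N a b) c

  record Ω : Set where
    constructor mkΩ
    field
      pt    : Carrier
      pt∉K∞ : ¬ (pt ∈K∞)
  open Ω public

  record GL₂K∞ : Set where
    field
      a b c d : Carrier
      a∈ : a ∈K∞
      b∈ : b ∈K∞
      c∈ : c ∈K∞
      d∈ : d ∈K∞
    det : Carrier
    det = a * d - b * c
    field
      det≉0 : det ≉ 0#

  private
    open SetoidReasoning setoid

    0? : ∀ x → Dec (x ≈ 0#)
    0? x with v x in eq
    ... | ⊤⁺    = yes (v-⊤ eq)
    ... | [ _ ] = no λ x≈0 →
      case-absurd (≡.trans (≡.sym eq) (≡.trans (v-cong x≈0) v-0))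
      where
      case-absurd : ∀ {r} → ¬ ([ r ] ≡ ⊤⁺)
      case-absurd ()

    divide : ∀ {x y z} → y ≉ 0# → x * y ≈ z → x ≈ z * y ⁻¹
    divide {x} {y} {z} y≉0 xy≈z = begin
      x              ≈⟨ *-identityʳ x ⟨
      x * 1#         ≈⟨ *-congˡ (*-inverseʳ y≉0) ⟨
      x * (y * y ⁻¹) ≈⟨ *-assoc x y (y ⁻¹) ⟨
      x * y * y ⁻¹   ≈⟨ *-congʳ xy≈z ⟩
      z * y ⁻¹       ∎

    undivide : ∀ {x y} → y ≉ 0# → (x * y ⁻¹) * y ≈ x
    undivide {x} {y} y≉0 = begin
      x * y ⁻¹ * y   ≈⟨ *-assoc x (y ⁻¹) y ⟩
      x * (y ⁻¹ * y) ≈⟨ *-congˡ (trans (*-comm (y ⁻¹) y) (*-inverseʳ y≉0)) ⟩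
      x * 1#         ≈⟨ *-identityʳ x ⟩
      x              ∎

    move : ∀ {x y z} → x + y ≈ z → x ≈ z - y
    move {x} {y} {z} e = begin
      x           ≈⟨ +-identityʳ x ⟨
      x + 0#      ≈⟨ +-congˡ (-‿inverseʳ y) ⟨
      x + (y - y) ≈⟨ +-assoc x y (- y) ⟨
      x + y - y   ≈⟨ +-congʳ e ⟩
      z - y       ∎

    equal⇒0 : ∀ {x y} → x ≈ y → x - y ≈ 0#
    equal⇒0 {x} {y} x≈y = trans (+-congʳ x≈y) (-‿inverseʳ y)

  module _ (γ : GL₂K∞) where
    open GL₂K∞ γ

    automorphy : Ω → Carrier
    automorphy z = c * pt z + d

    automorphy≉0 : ∀ z → automorphy z ≉ 0#
    automorphy≉0 z e with 0? c
    ... | yes c≈0 = det≉0 (equal⇒0 (begin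
      a * d  ≈⟨ *-congˡ d≈0 ⟩
      a * 0# ≈⟨ zeroʳ a ⟩
      0#     ≈⟨ zeroʳ b ⟨
      b * 0# ≈⟨ *-congˡ c≈0 ⟨
      b * c  ∎))
      where
      d≈0 : d ≈ 0#
      d≈0 = begin
        d             ≈⟨ +-identityˡ d ⟨
        0# + d        ≈⟨ +-congʳ (trans (*-congʳ c≈0) (zeroˡ (pt z))) ⟨
        c * pt z + d  ≈⟨ e ⟩
        0#            ∎
    ... | no c≉0 = pt∉K∞ z (resp (sym (divide c≉0 (begin
      pt z * c ≈⟨ *-comm (pt z) c ⟩
      c * pt z ≈⟨ move e ⟩
      0# - d   ≈⟨ +-identityˡ (- d) ⟩
      - d      ∎))) (mul (neg d∈) (inv c≉0 c∈)))

    moebius : Ω → Carrier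
    moebius z = (a * pt z + b) * automorphy z ⁻¹

    moebius∉K∞ : ∀ z → ¬ (moebius z ∈K∞)
    moebius∉K∞ z w∈ = contradict
      where
      w x : Carrier
      w = moebius z
      x = pt z

      ax+b : w * c * x + w * d ≈ a * x + b
      ax+b = begin
        w * c * x + w * d   ≈⟨ +-congʳ (*-assoc w c x) ⟩
        w * (c * x) + w * d ≈⟨ distribˡ w (c * x) d ⟨
        w * (c * x + d)     ≈⟨ undivide (automorphy≉0 z) ⟩
        a * x + b           ∎

      contradict : _
      contradict with 0? (w * c - a)
      ... | yes e = det≉0 (equal⇒0 (begin
        a * d       ≈⟨ *-congʳ wc≈a ⟨
        w * c * d   ≈⟨ *-assoc w c d ⟩
        w * (c * d) ≈⟨ *-congˡ (*-comm c d) ⟩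
        w * (d * c) ≈⟨ *-assoc w d c ⟨
        w * d * c   ≈⟨ *-congʳ wd≈b ⟩
        b * c       ∎))
        where
        wc≈a : w * c ≈ a
        wc≈a = x∙y⁻¹≈ε⇒x≈y (w * c) a e
        wd≈b : w * d ≈ b
        wd≈b = begin
          w * d                 ≈⟨ move (trans (+-comm (w * d) (w * c * x)) ax+b) ⟩
          a * x + b - w * c * x ≈⟨ +-congˡ (-‿cong (*-congʳ wc≈a)) ⟩
          a * x + b - a * x     ≈⟨ move (+-comm b (a * x)) ⟨
          b                     ∎
      ... | no e≉0 = pt∉K∞ z (resp (sym (divide e≉0 (begin
        x * (w * c - a)          ≈⟨ distribˡ x (w * c) (- a) ⟩
        x * (w * c) + x * (- a)  ≈⟨ +-cong (*-comm x (w * c)) (trans (sym (-‿distribʳ-* x a)) (-‿cong (*-comm x a))) ⟩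
        w * c * x - a * x        ≈⟨ +-congʳ (move ax+b) ⟩
        a * x + b - w * d - a * x   ≈⟨ move (begin
          b - w * d + a * x      ≈⟨ +-comm (b - w * d) (a * x) ⟩
          a * x + (b - w * d)    ≈⟨ +-assoc (a * x) b (- (w * d)) ⟨
          a * x + b - w * d      ∎) ⟨
        b - w * d                ∎)))
        (mul (add b∈ (neg (mul w∈ d∈))) (inv e≉0 (add (mul w∈ c∈) (neg a∈)))))

    infixr 7 _∙_
    _∙_ : Ω → Ω
    _∙_ z = mkΩ (moebius z) (moebius∉K∞ z)

  _∣[_,_]_ : (Ω → Carrier) → ℕ → ℤ → GL₂K∞ → Ω → Carrier
  (φ ∣[ k , m ] γ) z =
    φ (γ ∙ z) * (GL₂K∞.det γ ^ᶻ m) * (automorphy γ z ^ᶻ (-ᶻ (+ k)))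

  private
    0∈ : 0# ∈K∞
    0∈ = resp (Morphisms.IsRingHomomorphism.0#-homo ι-hom) (const 𝔽.0#)

    1∈ : 1# ∈K∞
    1∈ = resp (Morphisms.IsRingHomomorphism.1#-homo ι-hom) (const 𝔽.1#)

    t≉0 : t ≉ 0#
    t≉0 t≈0 with ≡.trans (≡.sym v-t) (≡.trans (v-cong t≈0) v-0)
    ... | ()

    x-y0≈x : ∀ x y → x - y * 0# ≈ x
    x-y0≈x x y = trans (+-congˡ (trans (-‿cong (zeroʳ y)) -0#≈0#)) (+-identityʳ x)

    0x+1y≈y : ∀ x y → 0# * x - (- 1#) * y ≈ y
    0x+1y≈y x y = begin
      0# * x - (- 1#) * y   ≈⟨ +-cong (zeroˡ x) (-‿cong (sym (-‿distribˡ-* 1# y))) ⟩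
      0# - - (1# * y)       ≈⟨ +-identityˡ (- - (1# * y)) ⟩
      - - (1# * y)          ≈⟨ -‿involutive (1# * y) ⟩
      1# * y                ≈⟨ *-identityˡ y ⟩
      y                     ∎
      where open RingProperties ring using (-‿distribˡ-*; -‿involutive)

  atkin : Fin q → GL₂K∞
  atkin i = record
    { a = 1# ; b = 𝔽q i ; c = 0# ; d = t
    ; a∈ = 1∈ ; b∈ = const _ ; c∈ = 0∈ ; d∈ = var
    ; det≉0 = λ e → t≉0 (trans (sym (trans (x-y0≈x (1# * t) (𝔽q i)) (*-identityˡ t))) e) }

  scale : GL₂K∞
  scale = record
    { a = t ; b = 0# ; c = 0# ; d = 1#
    ; a∈ = var ; b∈ = 0∈ ; c∈ = 0∈ ; d∈ = 1∈
    ; det≉0 = λ e → t≉0 (trans (sym (trans (x-y0≈x (t * 1#) 0#) (*-identityʳ t))) e) }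

  fricke : GL₂K∞
  fricke = record
    { a = 0# ; b = - 1# ; c = t ; d = 0#
    ; a∈ = 0∈ ; b∈ = neg 1∈ ; c∈ = var ; d∈ = 0∈
    ; det≉0 = λ e → t≉0 (trans (sym (0x+1y≈y 0# t)) e) }

  coset : Fin q → GL₂K∞
  coset i = record
    { a = 0# ; b = - 1# ; c = 1# ; d = 𝔽q i
    ; a∈ = 0∈ ; b∈ = neg 1∈ ; c∈ = 1∈ ; d∈ = const _
    ; det≉0 = λ e → 1≉0 (trans (sym (0x+1y≈y (𝔽q i) 1#)) e) }

  -- The affinoids |z| ≤ q^n, |z - x| ≥ q^(-n) for all x ∈ K∞, exhausting Ω.
  Affinoid : ℕ → Pred Ω 0ℓ
  Affinoid n z = (-ᶻ (+ n)) ≤v pt z × (∀ x → x ∈K∞ → (pt z - x) v≤ (+ n))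

  RigidAnalytic : (Ω → Carrier) → Set
  RigidAnalytic φ = ∀ n N → ∃₂ λ P Q → ∀ z → z ∈ Affinoid n →
    eval Q (pt z) ≉ 0# × N ≤v (φ z - eval P (pt z) * eval Q (pt z) ⁻¹)

  -- Sum of f over the polynomials in t of degree < d.
  Σdeg< : ℕ → (Carrier → Carrier) → Carrier
  Σdeg< zero    f = f 0#
  Σdeg< (suc d) f = ∑[ i < q ] Σdeg< d (λ x → f (𝔽q i + t * x))

  -- u = Σ_{λ ∈ tA} 1/(z - λ), which is 1/e_{tA}(z) since e_{tA}′ = 1: the
  -- parameter at ∞ for the translations z ↦ z + λ, which lie in every
  -- GL₂(A)-conjugate of Γ₀(t).
  IsUniformizer : Ω → Carrier → Set
  IsUniformizer z u = (λ d → Σdeg< d (λ x → (pt z - t * x) ⁻¹)) ⟶ u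

  -- φ is a power series in u without constant term on some
  -- {z : inf_{x ∈ K∞} |z - x| ≥ q^R}.
  VanishesAt∞ : (Ω → Carrier) → Set
  VanishesAt∞ φ = ∃₂ λ (coeff : ℕ → Carrier) (R : ℕ) →
    ∀ z → (∀ x → x ∈K∞ → (pt z - x) v≤ (-ᶻ (+ R))) →
    ∀ u → IsUniformizer z u →
    (λ N → ∑[ i < N ] (coeff (toℕ i) * u ^ ℕ.suc (toℕ i))) ⟶ φ z

  GL₂A : Pred GL₂K∞ 0ℓ
  GL₂A γ = (a ∈A) × (b ∈A) × (c ∈A) × (d ∈A) × (det ⁻¹ ∈A)
    where open GL₂K∞ γ

  Γ₀t : Pred GL₂K∞ 0ℓ
  Γ₀t γ = GL₂A γ × (∃ λ x → (x ∈A) × GL₂K∞.c γ ≈ t * x)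

  -- GL₂(A) permutes the cusps transitively, so all of them are reached.
  record S¹ (k : ℕ) (m : ℤ) (Γ : Pred GL₂K∞ 0ℓ) (φ : Ω → Carrier) : Set where
    field
      cong     : ∀ {z w} → pt z ≈ pt w → φ z ≈ φ w
      analytic : RigidAnalytic φ
      modular  : ∀ γ → γ ∈ Γ → φ ∣[ k , m ] γ ≋ φ
      cuspidal : ∀ γ → γ ∈ GL₂A → VanishesAt∞ (φ ∣[ k , m ] γ)

  module Operators (k : ℕ) (m : ℤ) where

    𝐔ₜ Fr Tr Tr′ δ₁ δₜ : (Ω → Carrier) → Ω → Carrier
    𝐔ₜ φ z  = ∑[ i < q ] φ (atkin i ∙ z)
    Fr φ    = φ ∣[ k , m ] fricke
    Tr φ z  = φ z + ∑[ i < q ] ((φ ∣[ k , m ] coset i) z)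
    Tr′ φ   = Tr (Fr φ)
    δ₁ φ    = φ
    δₜ φ z  = (t ^ᶻ m) * φ (scale ∙ z)

    Old New : Pred (Ω → Carrier) 0ℓ
    Old χ = ∃₂ λ φ ψ → S¹ k m GL₂A φ × S¹ k m GL₂A ψ × χ ≋ δ₁ φ ⊕ δₜ ψ
    New χ = S¹ k m Γ₀t χ × Tr χ ≋ 0ᶠ × Tr′ χ ≋ 0ᶠ

    Imδ₁ Imδₜ : Pred (Ω → Carrier) 0ℓ
    Imδ₁ χ = ∃ λ φ → S¹ k m GL₂A φ × χ ≋ δ₁ φ
    Imδₜ χ = ∃ λ φ → S¹ k m GL₂A φ × χ ≋ δₜ φ

  -- Fin n is 0-based: a stands for the row or column α = toℕ a + 1, so
  -- that α - 1 = toℕ a and n - α = toℕ (opposite a).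

  module Matrices (j n : ℕ) where

    sgn : ℕ → Carrier
    sgn i = (- 1#) ^ i

    idx : Fin n → ℕ
    idx a = j +ⁿ toℕ a *ⁿ (q ∸ 1)

    binom : ℕ → ℕ → Carrier
    binom x y = (x choose y) · 1#
      where open RawMonoidDefs +-rawMonoid renaming (_×_ to _·_)

    s : Fin n → ℕ
    s a = ℕ.suc (idx a)

    M D F A T : Matrix n
    M a b = if does (a ≟ b)
      then sgn j * binom (idx (opposite a)) (idx a)
      else - (binom (idx (opposite a)) (idx (opposite b))
              + sgn (ℕ.suc j) * binom (idx (opposite a)) (idx b))
    D = diag (λ a → t ^ s a)
    F = antidiag (λ b → (- t) ^ s b)
    A = antidiag (λ _ → sgn (ℕ.suc j))
    T = 1ᴹ +ᴹ M *ᴹ A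

  -- The properties of the basis c_{j+(b-1)(q-1)}, 1 ≤ b ≤ n, of
  -- S¹_{k,m}(Γ₀(t)) coming from the residue isomorphism.
  record IsCocycleBasis (j n k : ℕ) (m : ℤ) (c : Fin n → Ω → Carrier) : Set where
    open Operators k m
    open Matrices j n
    t^m-k : Carrier
    t^m-k = t ^ᶻ (m -ᶻ (+ k))
    field
      basis       : IsBasis (S¹ k m Γ₀t) c
      matrix-𝐔ₜ   : HasMatrix 𝐔ₜ c (M *ᴹ D)
      matrix-Fr   : HasMatrix Fr c (t^m-k ·ᴹ F)
      matrix-Tr   : HasMatrix Tr c T
      matrix-Tr′  : HasMatrix Tr′ c (t^m-k ·ᴹ (F +ᴹ M *ᴹ D))
      image-δ₁    : Imδ₁ ≐ WithCoordinates c (Ker (M *ᴹ A))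
      image-δₜ    : Imδₜ ≐ WithCoordinates c (Ker (M *ᴹ D))

{-# OPTIONS --safe #-}
module Submission where

-- Put N = j + 1, ε = (-1)^j and w_b = (-1)^b C(N,b).  Since j < q - 1, Lucas'
-- theorem in base q shows that modulo p every entry of M below the first row
-- vanishes off the antidiagonal, and that M = ε J + e₀ wᵗ with J the exchange
-- matrix.  With φ(x) = w·x and ψ(x) = w·Dx this gives T x = φ(x) e₀,
-- F = A D, M D x = - F x + ψ(x) e₀, φ(F x) = ψ(x) and F² = t^k, so that
-- Ker(MA) = ⟨e₀⟩, Ker(MD) = ⟨e_N⟩ and the newforms are {φ = ψ = 0}.
--
-- The functional χ = ψ - t^{s_N} φ is an eigenfunctional of MD, and φ vanishes on
-- the image of MD.  Replacing the first and last coordinates by χ and φ therefore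
-- conjugates MD to a matrix which is diagonal at the two ends and swaps a with
-- N - a in between.  The pairs {a, N - a} with a ≠ N - a contribute blocks with
-- square t^k: diagonalizable when 2 ≠ 0, not diagonalizable when 2 = 0, and they
-- occur exactly when the space of newforms, of dimension j, is not at most a line.

open import Algebra.Bundles using (CommutativeRing)
import Algebra.Morphism.Structures as Morphisms
import Algebra.Properties.CommutativeMonoid.Sum
import Algebra.Properties.CommutativeSemigroup
import Algebra.Properties.CommutativeSemiring.Exp
import Algebra.Properties.Group
import Algebra.Properties.Ring
import Algebra.Properties.Semiring.Exp
import Algebra.Properties.Semiring.Mult
import Algebra.Properties.Semiring.Mult.TCOptimised
import Algebra.Properties.Semiring.Sum
import Algebra.Solver.Ring
open import Algebra.Solver.Ring.AlmostCommutativeRing using (fromCommutativeRing; _-Raw-AlmostCommutative⟶_)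
open import Data.Bool.Base using (if_then_else_; true; false)
open import Data.Fin.Base using (Fin; zero; suc; toℕ; opposite; punchIn; fromℕ; inject₁)
import Data.Fin.Permutation as Permutation
open import Data.Fin.Permutation using (Permutation; permutation)
open import Data.Fin.Properties
  using (_≟_; opposite-involutive; opposite-prop; opposite-suc; punchInᵢ≢i; toℕ-fromℕ;
         toℕ-injective; toℕ≤pred[n]; fromℕ≢inject₁; inject₁-injective; suc-injective)
open import Data.Fin.Relation.Unary.Top using (view; ‵fromℕ; ‵inject₁)
open import Data.Integer.Base using (ℤ; +_; -[1+_]) renaming (_-_ to _-ᶻ_)
import Data.Integer.Base as ℤ
open import Data.Integer.Divisibility using () renaming (_∣_ to _∣ᶻ_)
import Data.Integer.Properties as ℤ
open import Data.List.Base using ([]; _∷_)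
open import Data.Maybe.Base using (Maybe; just; nothing)
open import Data.Nat.Base as ℕ using (ℕ; zero; suc; _≤_; _<_; z≤n; s≤s; s<s; z<s; NonZero)
open import Data.Nat.Combinatorics using (_C_; nCk+nC[k+1]≡[n+1]C[k+1]; nCn≡1; k>n⇒nCk≡0; nCk≡nC[n∸k])
open import Data.Nat.Divisibility using (_∣_; _∣?_; divides; ∣-trans; *-monoʳ-∣; *-cancelˡ-∣; ∣⇒≤; >⇒∤; m∣m*n; m%n≡0⇒n∣m)
import Data.Nat.DivMod as ℕ
open import Data.Nat.Primality using (Prime; euclidsLemma; prime[2]; prime⇒nonZero; prime⇒irreducible; ¬prime[0]; ¬prime[1])
import Data.Nat.Properties as ℕ
open import Data.Nat.Solver using (module +-*-Solver)
open import Data.Product using (_×_; _,_; ∃; ∃₂; proj₁; proj₂)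
open import Data.Rational.Base as ℚ using (0ℚ; 1ℚ)
import Data.Rational.Properties as ℚ
open import Data.Sum using (_⊎_; inj₁; inj₂)
open import Data.Unit using (tt)
import Data.Vec.Functional.Relation.Binary.Equality.Setoid as VecEquality
open import Function.Base using (_∘_; id)
open import Function.Bundles using (Equivalence; Inverse; _⇔_; mk⇔)
open import Level using (0ℓ)
open import Relation.Binary.Bundles using (Setoid)
open import Relation.Binary.Definitions using (tri<; tri≈; tri>)
open import Relation.Binary.PropositionalEquality as ≡ using (_≡_; _≢_)
import Relation.Binary.Reasoning.Setoid
open import Relation.Nullary using (¬_; yes; no; contradiction; Dec; does; ¬?)
open import Relation.Nullary.Construct.Add.Supremum using ([_]; ⊤⁺; []-injective)
open import Relation.Nullary.Decidable using (dec-true; dec-false; from-yes; map′; _×-dec_)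
open import Relation.Unary using (Pred; _∩_; _≐_; U; _⊆_)
open import Defs

-- The subspace where φ and ψ both vanish is stable under F, because φ(F x) = ψ(x) and ψ(F x) = t^k
-- φ(x), and MD restricts to -F on it; all that separates MD from -F is a plane of functionals.
-- Passing from ψ to χ does two things at once. On the span of φ and ψ the action of MD is
-- triangular with eigenvalues 0 and t^{s_0}, and χ diagonalizes it; moreover χ does not involve the
-- last coordinate, so φ and χ can be substituted for the two end coordinates one after the other.
-- The pivots are (-1)^N for φ and t^{s_0} - t^{s_N} for χ, and the second is nonzero since t has
-- nonzero valuation and so is not a root of unity. Two further points need an argument. The
-- definition of ℂ∞ does not mention its characteristic, which is recovered from the field 𝔽 with q
-- elements. And a dimension is given as the length of some basis, so short bases of the space of
-- newforms have to be ruled out by exhibiting two independent newforms.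

-- Ring solver with integer coefficients over any commutative ring

module IntegerSolver {c ℓ} (R : CommutativeRing c ℓ) where
  open CommutativeRing R
  open Algebra.Properties.Ring ring
  open Algebra.Properties.Semiring.Mult.TCOptimised semiring using (×-homo-+; ×1-homo-*; 1+×) renaming (_×_ to _·_)
  open import Relation.Binary.Reasoning.Setoid setoid

  private
    fromℤ : ℤ → Carrier
    fromℤ (+ n)    = n · 1#
    fromℤ -[1+ n ] = - (suc n · 1#)

    fromℤ-neg : ∀ i → fromℤ (ℤ.- i) ≈ - fromℤ i
    fromℤ-neg (+ zero)  = sym -0#≈0#
    fromℤ-neg (+ suc n) = refl
    fromℤ-neg -[1+ n ]  = sym (-‿involutive _)

    fromℤ-⊖ : ∀ m n → fromℤ (m ℤ.⊖ n) ≈ m · 1# - n · 1#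
    fromℤ-⊖ m zero = sym (trans (+-congˡ -0#≈0#) (+-identityʳ _))
    fromℤ-⊖ zero (suc n) = sym (+-identityˡ _)
    fromℤ-⊖ (suc m) (suc n) = begin
      fromℤ (suc m ℤ.⊖ suc n)            ≡⟨ ≡.cong fromℤ (ℤ.[1+m]⊖[1+n]≡m⊖n m n) ⟩
      fromℤ (m ℤ.⊖ n)                    ≈⟨ fromℤ-⊖ m n ⟩
      x - y                              ≈⟨ +-congʳ (xyx⁻¹≈y 1# x) ⟨
      1# + x - 1# - y                    ≈⟨ +-assoc (1# + x) (- 1#) (- y) ⟩
      1# + x + (- 1# - y)                ≈⟨ +-congˡ (-‿+-comm 1# y) ⟩
      1# + x - (1# + y)                  ≈⟨ +-cong (1+× m 1#) (-‿cong (1+× n 1#)) ⟨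
      suc m · 1# - suc n · 1#            ∎
      where
      x = m · 1#
      y = n · 1#

    fromℤ-+ : ∀ i j → fromℤ (i ℤ.+ j) ≈ fromℤ i + fromℤ j
    fromℤ-+ (+ m) (+ n)       = ×-homo-+ 1# m n
    fromℤ-+ (+ m) -[1+ n ]    = fromℤ-⊖ m (suc n)
    fromℤ-+ -[1+ m ] (+ n)    = trans (fromℤ-⊖ n (suc m)) (+-comm _ _)
    fromℤ-+ -[1+ m ] -[1+ n ] = begin
      - (suc (suc (m ℕ.+ n)) · 1#)       ≡⟨ ≡.cong (λ k → - (suc k · 1#)) (ℕ-+-suc m n) ⟨
      - ((suc m ℕ.+ suc n) · 1#)         ≈⟨ -‿cong (×-homo-+ 1# (suc m) (suc n)) ⟩
      - (suc m · 1# + suc n · 1#)        ≈⟨ -‿+-comm _ _ ⟨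
      - (suc m · 1#) - suc n · 1#        ∎
      where open import Data.Nat.Properties using () renaming (+-suc to ℕ-+-suc)

    fromℤ-+* : ∀ m j → fromℤ (+ m ℤ.* j) ≈ m · 1# * fromℤ j
    fromℤ-+* m (+ n) = trans (reflexive (≡.cong fromℤ (≡.sym (ℤ.pos-* m n)))) (×1-homo-* m n)
    fromℤ-+* m -[1+ n ] = begin
      fromℤ (+ m ℤ.* ℤ.- (+ suc n))       ≡⟨ ≡.cong fromℤ (ℤ.neg-distribʳ-* (+ m) (+ suc n)) ⟨
      fromℤ (ℤ.- (+ m ℤ.* + suc n))       ≈⟨ fromℤ-neg (+ m ℤ.* + suc n) ⟩
      - fromℤ (+ m ℤ.* + suc n)           ≈⟨ -‿cong (fromℤ-+* m (+ suc n)) ⟩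
      - (m · 1# * suc n · 1#)             ≈⟨ -‿distribʳ-* _ _ ⟩
      m · 1# * - (suc n · 1#)             ∎

    fromℤ-* : ∀ i j → fromℤ (i ℤ.* j) ≈ fromℤ i * fromℤ j
    fromℤ-* (+ m) j = fromℤ-+* m j
    fromℤ-* -[1+ m ] j = begin
      fromℤ (ℤ.- (+ suc m) ℤ.* j)         ≡⟨ ≡.cong fromℤ (ℤ.neg-distribˡ-* (+ suc m) j) ⟨
      fromℤ (ℤ.- (+ suc m ℤ.* j))         ≈⟨ fromℤ-neg (+ suc m ℤ.* j) ⟩
      - fromℤ (+ suc m ℤ.* j)             ≈⟨ -‿cong (fromℤ-+* (suc m) j) ⟩
      - (suc m · 1# * fromℤ j)            ≈⟨ -‿distribˡ-* _ _ ⟩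
      - (suc m · 1#) * fromℤ j            ∎

    homomorphism : ℤ.+-*-rawRing -Raw-AlmostCommutative⟶ fromCommutativeRing R
    homomorphism = record
      { ⟦_⟧    = fromℤ
      ; +-homo = fromℤ-+
      ; *-homo = fromℤ-*
      ; -‿homo = fromℤ-neg
      ; 0-homo = refl
      ; 1-homo = refl
      }

    -- Coefficients are compared in ℤ, where equality is decidable. The solver therefore proves
    -- identities valid in every commutative ring, and facts about the characteristic enter as
    -- separate rewriting steps.
    dec : ∀ i j → Maybe (fromℤ i ≈ fromℤ j)
    dec i j with i ℤ.≟ j
    ... | yes ≡.refl = just refl
    ... | no  _      = nothing

  open Algebra.Solver.Ring ℤ.+-*-rawRing (fromCommutativeRing R) homomorphism dec public
    using (solve; _:=_; con; _:+_; _:*_; _:-_; :-_)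

-- Binomial coefficients modulo p

nC0≡1 : ∀ n → n C 0 ≡ 1
nC0≡1 n = ≡.trans (nCk≡nC[n∸k] {0} {n} z≤n) (nCn≡1 n)

-- The absorption identity, by induction on `n`: Pascal's rule splits the left side, and the
-- identity one row higher applies to both parts.
[1+k]*[1+n]C[1+k]≡[1+n]*nCk : ∀ n k → suc k ℕ.* (suc n C suc k) ≡ suc n ℕ.* (n C k)
[1+k]*[1+n]C[1+k]≡[1+n]*nCk zero zero = ≡.refl
[1+k]*[1+n]C[1+k]≡[1+n]*nCk zero (suc k) = ≡.trans
  (≡.cong (suc (suc k) ℕ.*_) (k>n⇒nCk≡0 {1} {suc (suc k)} (s<s z<s))) (ℕ.*-zeroʳ (suc (suc k)))
[1+k]*[1+n]C[1+k]≡[1+n]*nCk n@(suc m) zero = begin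
  1 ℕ.* (suc n C 1)         ≡⟨ ≡.cong (1 ℕ.*_) (nCk+nC[k+1]≡[n+1]C[k+1] n 0) ⟨
  1 ℕ.* (n C 0 ℕ.+ n C 1)   ≡⟨ ≡.cong (λ x → 1 ℕ.* (x ℕ.+ n C 1)) (nC0≡1 n) ⟩
  suc (n C 1) ℕ.+ 0         ≡⟨ ≡.cong suc ([1+k]*[1+n]C[1+k]≡[1+n]*nCk m 0) ⟩
  suc (n ℕ.* (m C 0))       ≡⟨ ≡.cong (λ x → suc (n ℕ.* x)) (nC0≡1 m) ⟩
  suc (n ℕ.* 1)             ≡⟨⟩
  1 ℕ.+ n ℕ.* 1             ≡⟨⟩
  suc n ℕ.* 1               ≡⟨ ≡.cong (suc n ℕ.*_) (nC0≡1 n) ⟨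
  suc n ℕ.* (n C 0)         ∎
  where open ≡.≡-Reasoning
[1+k]*[1+n]C[1+k]≡[1+n]*nCk n@(suc m) k@(suc l) = begin
  suc k ℕ.* (suc n C suc k)             ≡⟨ ≡.cong (suc k ℕ.*_) (nCk+nC[k+1]≡[n+1]C[k+1] n k) ⟨
  suc k ℕ.* (n C k ℕ.+ n C suc k)       ≡⟨ ℕ.*-distribˡ-+ (suc k) (n C k) (n C suc k) ⟩
  n C k ℕ.+ k ℕ.* (n C k) ℕ.+ suc k ℕ.* (n C suc k)
    ≡⟨ ≡.cong₂ (λ x y → n C k ℕ.+ x ℕ.+ y) ([1+k]*[1+n]C[1+k]≡[1+n]*nCk m l) ([1+k]*[1+n]C[1+k]≡[1+n]*nCk m k) ⟩
  n C k ℕ.+ n ℕ.* (m C l) ℕ.+ n ℕ.* (m C k)  ≡⟨ ℕ.+-assoc (n C k) _ _ ⟩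
  n C k ℕ.+ (n ℕ.* (m C l) ℕ.+ n ℕ.* (m C k)) ≡⟨ ≡.cong (n C k ℕ.+_) (ℕ.*-distribˡ-+ n (m C l) (m C k)) ⟨
  n C k ℕ.+ n ℕ.* (m C l ℕ.+ m C k)   ≡⟨ ≡.cong (λ x → n C k ℕ.+ n ℕ.* x) (nCk+nC[k+1]≡[n+1]C[k+1] m l) ⟩
  suc n ℕ.* (n C k)                     ∎
  where open ≡.≡-Reasoning

-- By Euclid's lemma each factor p has to come from `m`; it is cancelled on both sides and the
-- argument repeats.
p^r∣m*n⇒p^r∣m : ∀ {p} → Prime p → ∀ r m n → ¬ (p ∣ n) → p ℕ.^ r ∣ m ℕ.* n → p ℕ.^ r ∣ m
p^r∣m*n⇒p^r∣m pp zero m n p∤n _ = divides m (≡.sym (ℕ.*-identityʳ m))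
p^r∣m*n⇒p^r∣m {p} pp (suc r) m n p∤n h
  with euclidsLemma m n pp (∣-trans (m∣m*n (p ℕ.^ r)) h)
... | inj₂ p∣n = contradiction p∣n p∤n
... | inj₁ (divides m′ ≡.refl) =
  ≡.subst (p ℕ.* p ℕ.^ r ∣_) (ℕ.*-comm p m′) (*-monoʳ-∣ p (p^r∣m*n⇒p^r∣m pp r m′ n p∤n
    (*-cancelˡ-∣ p (≡.subst (p ℕ.* p ℕ.^ r ∣_) eq h))))
  where
  instance _ = prime⇒nonZero pp
  eq : m′ ℕ.* p ℕ.* n ≡ p ℕ.* (m′ ℕ.* n)
  eq = ≡.trans (≡.cong (ℕ._* n) (ℕ.*-comm m′ p)) (ℕ.*-assoc p m′ n)

-- Absorption gives k C(p^r, k) = p^r C(p^r - 1, k - 1). If p did not divide C(p^r, k), then p^r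
-- would divide k, which is too small.
p∣p^rCk : ∀ {p} → Prime p → ∀ r k → 0 < k → k < p ℕ.^ r → p ∣ p ℕ.^ r C k
p∣p^rCk {p} pp r (suc k) _ k<q with p ∣? (p ℕ.^ r C suc k)
... | yes d = d
... | no ∤ with p ℕ.^ r in eq
...   | suc q = contradiction
  (≡.subst (_∣ suc k) eq (p^r∣m*n⇒p^r∣m pp r (suc k) _ ∤
    (≡.subst₂ _∣_ (≡.sym eq) (≡.sym ([1+k]*[1+n]C[1+k]≡[1+n]*nCk q k)) (m∣m*n (q C k)))))
  (>⇒∤ k<q)

module Binomials (R : CommutativeRing 0ℓ 0ℓ) (q-1 : ℕ) where
  open CommutativeRing R hiding (zero)
  open Algebra.Properties.Ring ring
  open Algebra.Properties.Semiring.Mult semiring using (×-congˡ; ×-homo-+; ×-homo-1) renaming (_×_ to _·_)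
  open Algebra.Properties.Semiring.Exp semiring using (_^_)
  open import Relation.Binary.Reasoning.Setoid setoid

  private
    q = suc q-1

  B : ℕ → ℕ → Carrier
  B x y = (x C y) · 1#

  sign : ℕ → Carrier
  sign i = (- 1#) ^ i

  B-pascal : ∀ x y → B (suc x) (suc y) ≈ B x y + B x (suc y)
  B-pascal x y = trans (×-congˡ (≡.sym (nCk+nC[k+1]≡[n+1]C[k+1] x y))) (×-homo-+ 1# (x C y) (x C suc y))

  B-zero : ∀ x → B x 0 ≈ 1#
  B-zero x = trans (×-congˡ (nC0≡1 x)) (×-homo-1 1#)

  B-diagonal : ∀ x → B x x ≈ 1#
  B-diagonal x = trans (×-congˡ (nCn≡1 x)) (×-homo-1 1#)

  B-above : ∀ {x y} → x < y → B x y ≈ 0#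
  B-above x<y = ×-congˡ (k>n⇒nCk≡0 x<y)

  module Lucas (B-q : ∀ k → 0 < k → k < q → B q k ≈ 0#) where

    -- The hypothesis `B-q` amounts to (1 + X)^q = 1 + X^q over R. This lemma and `B-shift` compare
    -- coefficients in (1 + X)^(x + q) = (1 + X)^x (1 + X^q), in degrees below q and from q on.
    B-shift-low : ∀ x y → y < q → B (x ℕ.+ q) y ≈ B x y
    B-shift-low x zero _ = trans (B-zero (x ℕ.+ q)) (sym (B-zero x))
    B-shift-low zero (suc y) y<q = B-q (suc y) z<s y<q
    B-shift-low (suc x) (suc y) y<q = begin
      B (suc x ℕ.+ q) (suc y)             ≈⟨ B-pascal (x ℕ.+ q) y ⟩
      B (x ℕ.+ q) y + B (x ℕ.+ q) (suc y)
        ≈⟨ +-cong (B-shift-low x y (ℕ.<-trans (ℕ.n<1+n y) y<q)) (B-shift-low x (suc y) y<q) ⟩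
      B x y + B x (suc y)                 ≈⟨ B-pascal x y ⟨
      B (suc x) (suc y)                   ∎

    B-shift : ∀ x y → B (x ℕ.+ q) (y ℕ.+ q) ≈ B x y + B x (y ℕ.+ q)
    B-shift zero zero = trans (B-diagonal q) (sym (trans (+-cong (B-zero 0) (B-above {0} {q} z<s)) (+-identityʳ 1#)))
    B-shift zero (suc y) = trans (B-above {q} {suc y ℕ.+ q} (s<s (ℕ.m≤n+m q y)))
      (sym (trans (+-cong (B-above {0} {suc y} z<s) (B-above {0} {suc y ℕ.+ q} z<s)) (+-identityʳ 0#)))
    B-shift (suc x) zero = begin
      B (suc x ℕ.+ q) q                    ≈⟨ B-pascal (x ℕ.+ q) q-1 ⟩
      B (x ℕ.+ q) q-1 + B (x ℕ.+ q) q      ≈⟨ +-cong (B-shift-low x q-1 (ℕ.n<1+n q-1)) (B-shift x 0) ⟩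
      B x q-1 + (B x 0 + B x q)            ≈⟨ +-assoc _ _ _ ⟨
      B x q-1 + B x 0 + B x q              ≈⟨ +-congʳ (+-comm _ _) ⟩
      B x 0 + B x q-1 + B x q              ≈⟨ +-assoc _ _ _ ⟩
      B x 0 + (B x q-1 + B x q)            ≈⟨ +-cong (trans (B-zero (suc x)) (sym (B-zero x))) (B-pascal x q-1) ⟨
      B (suc x) 0 + B (suc x) q            ∎
    B-shift (suc x) (suc y) = begin
      B (suc x ℕ.+ q) (suc y ℕ.+ q)                                   ≈⟨ B-pascal (x ℕ.+ q) (y ℕ.+ q) ⟩
      B (x ℕ.+ q) (y ℕ.+ q) + B (x ℕ.+ q) (suc y ℕ.+ q)               ≈⟨ +-cong (B-shift x y) (B-shift x (suc y)) ⟩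
      B x y + B x (y ℕ.+ q) + (B x (suc y) + B x (suc y ℕ.+ q))       ≈⟨ interchange _ _ _ _ ⟩
      B x y + B x (suc y) + (B x (y ℕ.+ q) + B x (suc y ℕ.+ q))       ≈⟨ +-cong (B-pascal x y) (B-pascal x (y ℕ.+ q)) ⟨
      B (suc x) (suc y) + B (suc x) (suc y ℕ.+ q)                     ∎
      where
      open import Algebra.Properties.CommutativeSemigroup +-commutativeSemigroup using (interchange)

    -- One digit in base q is split off, while `x₁` and `y₁` may be of any size. Raising `x₁` by one
    -- shifts the upper index by q, and `B-shift` turns this into Pascal's rule for the leading
    -- parts.
    lucas : ∀ x₁ y₁ x₀ y₀ → x₀ < q → y₀ < q →
            B (x₁ ℕ.* q ℕ.+ x₀) (y₁ ℕ.* q ℕ.+ y₀) ≈ B x₁ y₁ * B x₀ y₀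
    lucas zero zero _ _ _ _ = sym (trans (*-congʳ (B-zero 0)) (*-identityˡ _))
    lucas zero (suc y₁) x₀ y₀ x₀<q _ = trans
      (B-above (ℕ.≤-trans x₀<q (ℕ.≤-trans (ℕ.m≤m+n q (y₁ ℕ.* q)) (ℕ.m≤m+n _ y₀))))
      (sym (trans (*-congʳ (B-above {0} {suc y₁} z<s)) (zeroˡ _)))
    lucas (suc x₁) zero x₀ y₀ x₀<q y₀<q = begin
      B (suc x₁ ℕ.* q ℕ.+ x₀) y₀      ≡⟨ ≡.cong (λ x → B x y₀) (digits-suc x₁ x₀) ⟩
      B (x₁ ℕ.* q ℕ.+ x₀ ℕ.+ q) y₀    ≈⟨ B-shift-low _ y₀ y₀<q ⟩
      B (x₁ ℕ.* q ℕ.+ x₀) y₀          ≈⟨ lucas x₁ zero x₀ y₀ x₀<q y₀<q ⟩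
      B x₁ 0 * B x₀ y₀                ≈⟨ *-congʳ (trans (B-zero x₁) (sym (B-zero (suc x₁)))) ⟩
      B (suc x₁) 0 * B x₀ y₀          ∎
      where
      digits-suc : ∀ x₁ x₀ → suc x₁ ℕ.* q ℕ.+ x₀ ≡ x₁ ℕ.* q ℕ.+ x₀ ℕ.+ q
      digits-suc x₁ x₀ = ≡.trans (ℕ.+-assoc q (x₁ ℕ.* q) x₀) (ℕ.+-comm q _)
    lucas (suc x₁) (suc y₁) x₀ y₀ x₀<q y₀<q = begin
      B (suc x₁ ℕ.* q ℕ.+ x₀) (suc y₁ ℕ.* q ℕ.+ y₀)     ≡⟨ ≡.cong₂ B (digits-suc x₁ x₀) (digits-suc y₁ y₀) ⟩
      B (X ℕ.+ q) (Y ℕ.+ q)                             ≈⟨ B-shift X Y ⟩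
      B X Y + B X (Y ℕ.+ q)                             ≡⟨ ≡.cong (λ y → B X Y + B X y) (digits-suc y₁ y₀) ⟨
      B X Y + B X (suc y₁ ℕ.* q ℕ.+ y₀)
        ≈⟨ +-cong (lucas x₁ y₁ x₀ y₀ x₀<q y₀<q) (lucas x₁ (suc y₁) x₀ y₀ x₀<q y₀<q) ⟩
      B x₁ y₁ * B x₀ y₀ + B x₁ (suc y₁) * B x₀ y₀       ≈⟨ distribʳ _ _ _ ⟨
      (B x₁ y₁ + B x₁ (suc y₁)) * B x₀ y₀               ≈⟨ *-congʳ (B-pascal x₁ y₁) ⟨
      B (suc x₁) (suc y₁) * B x₀ y₀                     ∎
      where
      X = x₁ ℕ.* q ℕ.+ x₀
      Y = y₁ ℕ.* q ℕ.+ y₀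
      digits-suc : ∀ x₁ x₀ → suc x₁ ℕ.* q ℕ.+ x₀ ≡ x₁ ℕ.* q ℕ.+ x₀ ℕ.+ q
      digits-suc x₁ x₀ = ≡.trans (ℕ.+-assoc q (x₁ ℕ.* q) x₀) (ℕ.+-comm q _)

    -- Neighbouring entries of row q - 1 add up to an inner entry of row q, which vanishes; so the
    -- row alternates, starting from 1.
    B-[q-1] : ∀ k → k < q → B q-1 k ≈ sign k
    B-[q-1] zero _ = B-zero q-1
    B-[q-1] (suc k) k<q = begin
      B q-1 (suc k)
        ≈⟨ +-inverseʳ-unique (B q-1 k) (B q-1 (suc k)) (trans (sym (B-pascal q-1 k)) (B-q (suc k) z<s k<q)) ⟩
      - B q-1 k               ≈⟨ -‿cong (B-[q-1] k (ℕ.<-trans (ℕ.n<1+n k) k<q)) ⟩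
      - sign k                ≈⟨ -1*x≈-x (sign k) ⟨
      sign (suc k)            ∎

    -- The indices j + i′(q - 1) with i′ ≤ j have the base q digits i′ and j - i′.
    digits : ∀ i i′ {j} → i ℕ.+ i′ ≡ j → j ℕ.+ i′ ℕ.* q-1 ≡ i′ ℕ.* q ℕ.+ i
    digits i i′ ≡.refl = solve 3 (λ i i′ q-1 →
      (i :+ i′) :+ i′ :* q-1 := i′ :* (con 1 :+ q-1) :+ i) ≡.refl i i′ q-1
      where open +-*-Solver

    -- For i′ = j + 1 the low digit j - i′ would be -1; borrowing from the leading digit gives j and
    -- q - 1. This is why the first row and the last column behave differently.
    digits-top : ∀ j → j ℕ.+ suc j ℕ.* q-1 ≡ j ℕ.* q ℕ.+ q-1
    digits-top j = solve 2 (λ j q-1 →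
      j :+ (con 1 :+ j) :* q-1 := j :* (con 1 :+ q-1) :+ q-1) ≡.refl j q-1
      where open +-*-Solver

    module _ {j} (j<q-1 : j < q-1) where
      private
        summand<q : ∀ i i′ → i ℕ.+ i′ ≡ j → i < q
        summand<q i i′ ≡.refl = ℕ.<-trans (ℕ.≤-<-trans (ℕ.m≤m+n i i′) j<q-1) (ℕ.n<1+n q-1)

      module _ (i i′ : ℕ) (i+i′≡j : i ℕ.+ i′ ≡ j) where

        B-inner : ∀ b b′ → b ℕ.+ b′ ≡ j →
                  B (j ℕ.+ i′ ℕ.* q-1) (j ℕ.+ b ℕ.* q-1) ≈ B i′ b * B i b′
        B-inner b b′ b+b′≡j = trans
          (reflexive (≡.cong₂ B (digits i i′ i+i′≡j) (digits b′ b b′+b≡j)))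
          (lucas i′ b i b′ (summand<q i i′ i+i′≡j) (summand<q b′ b b′+b≡j))
          where
          b′+b≡j = ≡.trans (ℕ.+-comm b′ b) b+b′≡j

        -- Both digit pairs have sum j, so if one digit of the lower index is smaller than that of
        -- the upper index, the other is larger, and one Lucas factor vanishes.
        B-inner-≢ : ∀ b b′ → b ℕ.+ b′ ≡ j → b ≢ i′ →
                    B (j ℕ.+ i′ ℕ.* q-1) (j ℕ.+ b ℕ.* q-1) ≈ 0#
        B-inner-≢ b b′ b+b′≡j b≢i′ with ℕ.<-cmp b i′
        ... | tri≈ _ b≡i′ _ = contradiction b≡i′ b≢i′
        ... | tri> _ _ b>i′ = trans (B-inner b b′ b+b′≡j) (trans (*-congʳ (B-above {i′} {b} b>i′)) (zeroˡ _))
        ... | tri< b<i′ _ _ = trans (B-inner b b′ b+b′≡j) (trans (*-congˡ (B-above {i} {b′} i<b′)) (zeroʳ _))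
          where
          i<b′ : i < b′
          i<b′ = ℕ.+-cancelˡ-< b i b′ (ℕ.<-≤-trans (ℕ.+-monoˡ-< i b<i′)
            (ℕ.≤-reflexive (≡.trans (ℕ.+-comm i′ i) (≡.trans i+i′≡j (≡.sym b+b′≡j)))))

        -- The low digit q - 1 of the lower index exceeds the low digit i ≤ j < q - 1 of the upper
        -- one.
        B-last-column : B (j ℕ.+ i′ ℕ.* q-1) (j ℕ.+ suc j ℕ.* q-1) ≈ 0#
        B-last-column = begin
          B (j ℕ.+ i′ ℕ.* q-1) (j ℕ.+ suc j ℕ.* q-1)  ≡⟨ ≡.cong₂ B (digits i i′ i+i′≡j) (digits-top j) ⟩
          B (i′ ℕ.* q ℕ.+ i) (j ℕ.* q ℕ.+ q-1)        ≈⟨ lucas i′ j i q-1 (summand<q i i′ i+i′≡j) (ℕ.n<1+n q-1) ⟩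
          B i′ j * B i q-1                            ≈⟨ *-congˡ (B-above {i} {q-1} (ℕ.≤-<-trans i≤j j<q-1)) ⟩
          B i′ j * 0#                                 ≈⟨ zeroʳ _ ⟩
          0#                                          ∎
          where
          i≤j : i ≤ j
          i≤j = ≡.subst (i ≤_) i+i′≡j (ℕ.m≤m+n i i′)

      -- The upper index has low digit q - 1, and row q - 1 alternates in sign modulo p. The signs
      -- in `w` originate here.
      B-first-row : ∀ b b′ → b ℕ.+ b′ ≡ j →
                    B (j ℕ.+ suc j ℕ.* q-1) (j ℕ.+ b ℕ.* q-1) ≈ B j b * sign b′
      B-first-row b b′ b+b′≡j = begin
        B (j ℕ.+ suc j ℕ.* q-1) (j ℕ.+ b ℕ.* q-1)  ≡⟨ ≡.cong₂ B (digits-top j) (digits b′ b b′+b≡j) ⟩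
        B (j ℕ.* q ℕ.+ q-1) (b ℕ.* q ℕ.+ b′)       ≈⟨ lucas j b q-1 b′ (ℕ.n<1+n q-1) (summand<q b′ b b′+b≡j) ⟩
        B j b * B q-1 b′                           ≈⟨ *-congˡ (B-[q-1] b′ (summand<q b′ b b′+b≡j)) ⟩
        B j b * sign b′                            ∎
        where
        b′+b≡j = ≡.trans (ℕ.+-comm b′ b) b+b′≡j

-- The characteristic of a field with q elements

module FiniteField (F : Field) {q} (enum : Inverse (≡.setoid (Fin q)) (Field.setoid F)) where
  open Field F hiding (zero)
  open Inverse enum
  open Algebra.Properties.Ring ring using (+-identityʳ-unique)
  open Algebra.Properties.Semiring.Mult semiring using (×1-homo-*; ×-homo-1) renaming (_×_ to _·_)
  open Algebra.Properties.CommutativeMonoid.Sum +-commutativeMonoid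
  open import Relation.Binary.Reasoning.Setoid setoid

  0? : ∀ x → Dec (x ≈ 0#)
  0? x = map′ (λ e → trans (sym (strictlyInverseˡ x)) (trans (to-cong e) (strictlyInverseˡ 0#))) from-cong
              (from x ≟ from 0#)

  private
    translation : Permutation q q
    translation = permutation (λ i → from (to i + 1#)) (λ i → from (to i - 1#))
      (λ i → trans′ (from-cong (trans (+-congʳ (strictlyInverseˡ (to i - 1#))) (cancel (- 1#) 1# (-‿inverseˡ 1#)))) (strictlyInverseʳ i))
      (λ i → trans′ (from-cong (trans (+-congʳ (strictlyInverseˡ (to i + 1#))) (cancel 1# (- 1#) (-‿inverseʳ 1#)))) (strictlyInverseʳ i))
      where
      trans′ = ≡.trans
      cancel : ∀ {x} y z → y + z ≈ 0# → x + y + z ≈ x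
      cancel {x} y z e = trans (+-assoc x y z) (trans (+-congˡ e) (+-identityʳ x))

  -- The sum of all elements is invariant under x ↦ x + 1.
  q·1≈0 : q · 1# ≈ 0#
  q·1≈0 = +-identityʳ-unique (sum to) (q · 1#) (begin
    sum to + q · 1#                            ≈⟨ +-congˡ (sum-replicate q) ⟨
    sum to + ∑[ i < q ] 1#                     ≈⟨ ∑-distrib-+ to (λ _ → 1#) ⟨
    ∑[ i < q ] (to i + 1#)                     ≈⟨ sum-cong-≋ (λ i → strictlyInverseˡ (to i + 1#)) ⟨
    ∑[ i < q ] to (from (to i + 1#))           ≈⟨ ∑-permute to translation ⟨
    sum to                                     ∎)

  -- In the field, q is the r-th power of p. A nonzero p would be invertible, and cancelling its
  -- factors one by one would turn q = 0 into 1 = 0.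
  characteristic : ∀ p r → q ≡ p ℕ.^ r → p · 1# ≈ 0#
  characteristic p r q≡p^r with 0? (p · 1#)
  ... | yes e = e
  ... | no ≉0 = contradiction (≡.subst (λ n → n · 1# ≈ 0#) q≡p^r q·1≈0) (power≉0 r)
    where
    power≉0 : ∀ r → (p ℕ.^ r) · 1# ≉ 0#
    power≉0 zero e = 1≉0 (trans (sym (×-homo-1 1#)) e)
    power≉0 (suc r) e = power≉0 r (begin
      x                                    ≈⟨ *-identityˡ x ⟨
      1# * x                               ≈⟨ *-congʳ (*-inverseʳ ≉0) ⟨
      p · 1# * (p · 1#) ⁻¹ * x             ≈⟨ *-congʳ (*-comm _ _) ⟩
      (p · 1#) ⁻¹ * p · 1# * x             ≈⟨ *-assoc _ _ _ ⟩
      (p · 1#) ⁻¹ * (p · 1# * x)           ≈⟨ *-congˡ (trans (sym (×1-homo-* p (p ℕ.^ r))) e) ⟩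
      (p · 1#) ⁻¹ * 0#                     ≈⟨ zeroʳ _ ⟩
      0#                                   ∎)
      where x = (p ℕ.^ r) · 1#

-- Linear algebra over ℂ∞

if-yes : ∀ {a p} {A : Set a} {P : Set p} (P? : Dec P) {x y : A} → P → (if does P? then x else y) ≡ x
if-yes P? {x} {y} p = ≡.cong (if_then x else y) (dec-true P? p)

if-no : ∀ {a p} {A : Set a} {P : Set p} (P? : Dec P) {x y : A} → ¬ P → (if does P? then x else y) ≡ y
if-no P? {x} {y} ¬p = ≡.cong (if_then x else y) (dec-false P? ¬p)

module LinearAlgebra {q : ℕ} (C : ℂ∞ q) where
  open Drinfeld C hiding (zero)
  open Algebra.Properties.Ring ring
  open Algebra.Properties.Semiring.Sum semiring
    using (sum-cong-≋; sum-remove; sum-replicate-zero; ∑-distrib-+; ∑-comm; ∑-permute; *-distribˡ-sum; *-distribʳ-sum)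
  open IntegerSolver commutativeRing
  open Relation.Binary.Reasoning.Setoid setoid

  -- Only zero has infinite valuation, so the constructor of `v x` decides.
  0? : ∀ x → Dec (x ≈ 0#)
  0? x with v x in eq
  ... | ⊤⁺    = yes (v-⊤ eq)
  ... | [ _ ] = no λ x≈0 → finite≢⊤ (≡.trans (≡.sym eq) (≡.trans (v-cong x≈0) v-0))
    where
    finite≢⊤ : ∀ {r} → [ r ] ≢ ⊤⁺
    finite≢⊤ ()

  cancel-≉0 : ∀ {x y} → x ≉ 0# → x * y ≈ 0# → y ≈ 0#
  cancel-≉0 {x} {y} x≉0 xy≈0 = begin
    y                ≈⟨ *-identityˡ y ⟨
    1# * y           ≈⟨ *-congʳ (*-inverseʳ x≉0) ⟨
    x * x ⁻¹ * y     ≈⟨ solve 3 (λ x z y → x :* z :* y := z :* (x :* y)) refl x (x ⁻¹) y ⟩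
    x ⁻¹ * (x * y)   ≈⟨ *-congˡ xy≈0 ⟩
    x ⁻¹ * 0#        ≈⟨ zeroʳ _ ⟩
    0#               ∎

  *-≉0 : ∀ {x y} → x ≉ 0# → y ≉ 0# → x * y ≉ 0#
  *-≉0 x≉0 y≉0 xy≈0 = y≉0 (cancel-≉0 x≉0 xy≈0)

  sum-zero : ∀ {n} (f : Fin n → Carrier) → f ≋ 0ᶠ → sum f ≈ 0#
  sum-zero {n} f f≈0 = trans (sum-cong-≋ f≈0) (sum-replicate-zero n)

  sum-single : ∀ {n} (f : Fin n → Carrier) a → (∀ i → i ≢ a → f i ≈ 0#) → sum f ≈ f a
  sum-single {suc n} f a f≈0 = begin
    sum f                              ≈⟨ sum-remove f ⟩
    f a + ∑[ i < n ] f (punchIn a i)   ≈⟨ +-congˡ (sum-zero _ (λ i → f≈0 _ (punchInᵢ≢i a i))) ⟩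
    f a + 0#                           ≈⟨ +-identityʳ _ ⟩
    f a                                ∎

  scaled : ∀ {X : Set} → Carrier → (X → Carrier) → X → Carrier
  scaled c x i = c * x i

  module _ {n : ℕ} where

    Vec : Set
    Vec = Fin n → Carrier

    open VecEquality setoid public using () renaming (≋-setoid to vecSetoid)
    module ≋ = Setoid (vecSetoid n)
    module ≋-Reasoning = Relation.Binary.Reasoning.Setoid (vecSetoid n)

    dot : Vec → Vec → Carrier
    dot w x = ∑[ i < n ] (w i * x i)

    unit : Fin n → Vec
    unit a i = if does (i ≟ a) then 1# else 0#

    unit-≡ : ∀ a → unit a a ≈ 1#
    unit-≡ a = reflexive (if-yes (a ≟ a) ≡.refl)

    unit-≢ : ∀ {a i} → i ≢ a → unit a i ≈ 0#
    unit-≢ {a} {i} i≢a = reflexive (if-no (i ≟ a) i≢a)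

    dot-cong : ∀ {w w′ x x′} → w ≋ w′ → x ≋ x′ → dot w x ≈ dot w′ x′
    dot-cong w≋w′ x≋x′ = sum-cong-≋ (λ i → *-cong (w≋w′ i) (x≋x′ i))

    dot-congˡ : ∀ w {x x′} → x ≋ x′ → dot w x ≈ dot w x′
    dot-congˡ w = dot-cong (λ _ → refl)

    dot-zeroʳ : ∀ w {x} → x ≋ 0ᶠ → dot w x ≈ 0#
    dot-zeroʳ w x≈0 = sum-zero _ (λ i → trans (*-congˡ (x≈0 i)) (zeroʳ (w i)))

    dot-⊕ʳ : ∀ w x y → dot w (x ⊕ y) ≈ dot w x + dot w y
    dot-⊕ʳ w x y = trans (sum-cong-≋ (λ i → distribˡ (w i) (x i) (y i))) (∑-distrib-+ (λ i → w i * x i) (λ i → w i * y i))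

    dot-⊕ˡ : ∀ w v x → dot (w ⊕ v) x ≈ dot w x + dot v x
    dot-⊕ˡ w v x = trans (sum-cong-≋ (λ i → distribʳ (x i) (w i) (v i))) (∑-distrib-+ (λ i → w i * x i) (λ i → v i * x i))

    dot-scaledʳ : ∀ w c x → dot w (scaled c x) ≈ c * dot w x
    dot-scaledʳ w c x = trans
      (sum-cong-≋ (λ i → solve 3 (λ w c x → w :* (c :* x) := c :* (w :* x)) refl (w i) c (x i)))
      (sym (*-distribˡ-sum c (λ i → w i * x i)))

    dot-scaledˡ : ∀ w c x → dot (scaled c w) x ≈ c * dot w x
    dot-scaledˡ w c x = trans (sum-cong-≋ (λ i → *-assoc c (w i) (x i)))
      (sym (*-distribˡ-sum c (λ i → w i * x i)))

    dot-supported : ∀ w {x} a → (∀ i → i ≢ a → x i ≈ 0#) → dot w x ≈ w a * x a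
    dot-supported w a x≈0 = sum-single _ a (λ i i≢a → trans (*-congˡ (x≈0 i i≢a)) (zeroʳ (w i)))

    dot-unitʳ : ∀ w a → dot w (unit a) ≈ w a
    dot-unitʳ w a = trans (dot-supported w a (λ i → unit-≢)) (trans (*-congˡ (unit-≡ a)) (*-identityʳ (w a)))

    dot-unitˡ : ∀ a x → dot (unit a) x ≈ x a
    dot-unitˡ a x = trans (sum-cong-≋ (λ i → *-comm (unit a i) (x i))) (dot-unitʳ x a)

    dot-opposite : ∀ w x → dot w x ≈ dot (w ∘ opposite) (x ∘ opposite)
    dot-opposite w x = ∑-permute (λ i → w i * x i) Permutation.reverse

    -- Evaluates a functional after one coordinate has been replaced; in particular nothing changes
    -- when its coefficient there is zero.
    dot-update : ∀ w {x y} a → (∀ i → i ≢ a → y i ≈ x i) → dot w y ≈ dot w x + w a * (y a - x a)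
    dot-update w {x} {y} a y≈x = begin
      dot w y                                      ≈⟨ dot-congˡ w y≋ ⟩
      dot w (x ⊕ scaled (y a - x a) (unit a))      ≈⟨ dot-⊕ʳ w x _ ⟩
      dot w x + dot w (scaled (y a - x a) (unit a)) ≈⟨ +-congˡ (trans (dot-scaledʳ w _ _) (*-congˡ (dot-unitʳ w a))) ⟩
      dot w x + (y a - x a) * w a                  ≈⟨ +-congˡ (*-comm _ _) ⟩
      dot w x + w a * (y a - x a)                  ∎
      where
      y≋ : y ≋ x ⊕ scaled (y a - x a) (unit a)
      y≋ i with i ≟ a
      ... | yes ≡.refl = solve 2 (λ x y → y := x :+ (y :- x) :* con ℤ.1ℤ) refl (x i) (y i)
      ... | no i≢a     = trans (y≈x i i≢a) (solve 2 (λ x z → x := x :+ z :* con ℤ.0ℤ) refl (x i) (y a - x a))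

    *ᵥ-cong : ∀ N {x y} → x ≋ y → N *ᵥ x ≋ N *ᵥ y
    *ᵥ-cong N x≋y a = dot-congˡ (N a) x≋y

    *ᵥ-congˡ : ∀ {N P} → N ≋ᴹ P → ∀ x → N *ᵥ x ≋ P *ᵥ x
    *ᵥ-congˡ N≋P x a = dot-cong (N≋P a) (λ _ → refl)

    *ᵥ-zero : ∀ N {x} → x ≋ 0ᶠ → N *ᵥ x ≋ 0ᶠ
    *ᵥ-zero N x≋0 a = dot-zeroʳ (N a) x≋0

    *ᵥ-scaled : ∀ N c x → N *ᵥ scaled c x ≋ scaled c (N *ᵥ x)
    *ᵥ-scaled N c x a = dot-scaledʳ (N a) c x

    *ᵥ-⊕ : ∀ N x y → N *ᵥ (x ⊕ y) ≋ (N *ᵥ x) ⊕ (N *ᵥ y)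
    *ᵥ-⊕ N x y a = dot-⊕ʳ (N a) x y

    +ᴹ-*ᵥ : ∀ N P x → (N +ᴹ P) *ᵥ x ≋ (N *ᵥ x) ⊕ (P *ᵥ x)
    +ᴹ-*ᵥ N P x a = dot-⊕ˡ (N a) (P a) x

    *ᴹ-*ᵥ : ∀ N P x → (N *ᴹ P) *ᵥ x ≋ N *ᵥ (P *ᵥ x)
    *ᴹ-*ᵥ N P x a = begin
      ∑[ b < n ] ((N *ᴹ P) a b * x b)                  ≈⟨ sum-cong-≋ (λ b → *-distribʳ-sum (x b) (λ i → N a i * P i b)) ⟩
      ∑[ b < n ] ∑[ i < n ] (N a i * P i b * x b)      ≈⟨ ∑-comm (λ b i → N a i * P i b * x b) ⟩
      ∑[ i < n ] ∑[ b < n ] (N a i * P i b * x b)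
        ≈⟨ sum-cong-≋ (λ i → trans (sum-cong-≋ (λ b → *-assoc (N a i) (P i b) (x b)))
                                                            (sym (*-distribˡ-sum (N a i) (λ b → P i b * x b)))) ⟩
      ∑[ i < n ] (N a i * (P *ᵥ x) i)                  ∎

    diag-*ᵥ : ∀ (d x : Vec) a → (diag d *ᵥ x) a ≈ d a * x a
    diag-*ᵥ d x a = trans
      (sum-single _ a (λ i i≢a → trans (*-congʳ (reflexive (if-no (a ≟ i) {x = d a} (i≢a ∘ ≡.sym)))) (zeroˡ (x i))))
      (*-congʳ (reflexive (if-yes (a ≟ a) ≡.refl)))

    antidiag-*ᵥ : ∀ (d x : Vec) a → (antidiag d *ᵥ x) a ≈ d (opposite a) * x (opposite a)
    antidiag-*ᵥ d x a = trans
      (sum-single _ (opposite a) (λ i i≢a′ → trans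
        (*-congʳ (reflexive (if-no (a ≟ opposite i) {x = d i} (λ a≡i′ → i≢a′ (≡.trans (≡.sym (opposite-involutive i)) (≡.cong opposite (≡.sym a≡i′)))))))
        (zeroˡ (x i))))
      (*-congʳ (reflexive (if-yes (a ≟ opposite (opposite a)) (≡.sym (opposite-involutive a)))))

    1ᴹ-*ᵥ : ∀ x → 1ᴹ *ᵥ x ≋ x
    1ᴹ-*ᵥ x a = trans (diag-*ᵥ (λ _ → 1#) x a) (*-identityˡ (x a))

    *ᵥ-unit : ∀ N b → N *ᵥ unit b ≋ λ a → N a b
    *ᵥ-unit N b a = dot-unitʳ (N a) b

    ≋ᴹ-from-*ᵥ : ∀ N P → (∀ x → N *ᵥ x ≋ P *ᵥ x) → N ≋ᴹ P
    ≋ᴹ-from-*ᵥ N P h a b = trans (sym (*ᵥ-unit N b a)) (trans (h (unit b) a) (*ᵥ-unit P b a))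

    -- Inverses are stated through the action on vectors, as is `Eigenbasis` below, so that
    -- compositions become chains of rewriting. The translation to matrix products is made once, in
    -- `diagonalizable⇔eigenbasis`.
    record _InverseOf_ (K⁻¹ K : Matrix n) : Set where
      field
        inverseˡ : ∀ x → K⁻¹ *ᵥ (K *ᵥ x) ≋ x
        inverseʳ : ∀ x → K *ᵥ (K⁻¹ *ᵥ x) ≋ x
    open _InverseOf_ public

    inverse-sym : ∀ {K K⁻¹} → K⁻¹ InverseOf K → K InverseOf K⁻¹
    inverse-sym i = record { inverseˡ = inverseʳ i ; inverseʳ = inverseˡ i }

    inverse-*ᴹ : ∀ {K K⁻¹ L L⁻¹} → K⁻¹ InverseOf K → L⁻¹ InverseOf L → (L⁻¹ *ᴹ K⁻¹) InverseOf (K *ᴹ L)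
    inverse-*ᴹ {K} {K⁻¹} {L} {L⁻¹} i i′ = record
      { inverseˡ = go L⁻¹ K⁻¹ K L (inverseˡ i) (inverseˡ i′)
      ; inverseʳ = go K L L⁻¹ K⁻¹ (inverseʳ i′) (inverseʳ i)
      }
      where
      go : ∀ K₁ K₂ K₃ K₄ → (∀ x → K₂ *ᵥ (K₃ *ᵥ x) ≋ x) → (∀ x → K₁ *ᵥ (K₄ *ᵥ x) ≋ x) →
           ∀ x → (K₁ *ᴹ K₂) *ᵥ ((K₃ *ᴹ K₄) *ᵥ x) ≋ x
      go K₁ K₂ K₃ K₄ i₁ i₂ x = Q.begin
        (K₁ *ᴹ K₂) *ᵥ ((K₃ *ᴹ K₄) *ᵥ x)     Q.≈⟨ *ᴹ-*ᵥ K₁ K₂ _ ⟩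
        K₁ *ᵥ (K₂ *ᵥ ((K₃ *ᴹ K₄) *ᵥ x))     Q.≈⟨ *ᵥ-cong K₁ (*ᵥ-cong K₂ (*ᴹ-*ᵥ K₃ K₄ x)) ⟩
        K₁ *ᵥ (K₂ *ᵥ (K₃ *ᵥ (K₄ *ᵥ x)))     Q.≈⟨ *ᵥ-cong K₁ (i₁ _) ⟩
        K₁ *ᵥ (K₄ *ᵥ x)                     Q.≈⟨ i₂ x ⟩
        x                                   Q.∎
        where module Q = ≋-Reasoning

    Eigenbasis : Matrix n → Set
    Eigenbasis N = ∃₂ λ (P P⁻¹ : Matrix n) → ∃ λ (d : Vec) →
      P⁻¹ InverseOf P × (∀ x → N *ᵥ (P *ᵥ x) ≋ P *ᵥ (λ i → d i * x i))

    diagonalizable⇔eigenbasis : ∀ {N} → Diagonalizable N ⇔ Eigenbasis N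
    diagonalizable⇔eigenbasis {N} = mk⇔
      (λ (P , P⁻¹ , d , PP⁻¹ , P⁻¹P , NP) → P , P⁻¹ , d
        , record { inverseˡ = inverse P⁻¹ P P⁻¹P ; inverseʳ = inverse P P⁻¹ PP⁻¹ }
        , λ x → ≋.trans (≋.sym (*ᴹ-*ᵥ N P x)) (≋.trans (*ᵥ-congˡ NP x)
            (≋.trans (*ᴹ-*ᵥ P (diag d) x) (*ᵥ-cong P (diag-*ᵥ d x)))))
      (λ (P , P⁻¹ , d , i , NP) → P , P⁻¹ , d
        , product P P⁻¹ (inverseʳ i) , product P⁻¹ P (inverseˡ i)
        , ≋ᴹ-from-*ᵥ (N *ᴹ P) (P *ᴹ diag d) (λ x → ≋.trans (*ᴹ-*ᵥ N P x)
            (≋.trans (NP x) (≋.sym (≋.trans (*ᴹ-*ᵥ P (diag d) x) (*ᵥ-cong P (diag-*ᵥ d x)))))))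
      where
      inverse : ∀ K L → K *ᴹ L ≋ᴹ 1ᴹ → ∀ x → K *ᵥ (L *ᵥ x) ≋ x
      inverse K L KL x = ≋.trans (≋.sym (*ᴹ-*ᵥ K L x)) (≋.trans (*ᵥ-congˡ KL x) (1ᴹ-*ᵥ x))
      product : ∀ K L → (∀ x → K *ᵥ (L *ᵥ x) ≋ x) → K *ᴹ L ≋ᴹ 1ᴹ
      product K L i = ≋ᴹ-from-*ᵥ (K *ᴹ L) 1ᴹ (λ x → ≋.trans (*ᴹ-*ᵥ K L x) (≋.trans (i x) (≋.sym (1ᴹ-*ᵥ x))))

    intertwined : ∀ {K K⁻¹ N N′} → K⁻¹ InverseOf K → (∀ x → K *ᵥ (N *ᵥ x) ≋ N′ *ᵥ (K *ᵥ x)) →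
                  ∀ x → K⁻¹ *ᵥ (N′ *ᵥ x) ≋ N *ᵥ (K⁻¹ *ᵥ x)
    intertwined {K} {K⁻¹} {N} {N′} i KN x = Q.begin
      K⁻¹ *ᵥ (N′ *ᵥ x)                 Q.≈⟨ *ᵥ-cong K⁻¹ (*ᵥ-cong N′ (inverseʳ i x)) ⟨
      K⁻¹ *ᵥ (N′ *ᵥ (K *ᵥ (K⁻¹ *ᵥ x)))  Q.≈⟨ *ᵥ-cong K⁻¹ (KN _) ⟨
      K⁻¹ *ᵥ (K *ᵥ (N *ᵥ (K⁻¹ *ᵥ x)))   Q.≈⟨ inverseˡ i _ ⟩
      N *ᵥ (K⁻¹ *ᵥ x)                  Q.∎
      where module Q = ≋-Reasoning

    eigenbasis-similar : ∀ {K K⁻¹ N N′} → K⁻¹ InverseOf K → (∀ x → K *ᵥ (N *ᵥ x) ≋ N′ *ᵥ (K *ᵥ x)) →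
                         Eigenbasis N → Eigenbasis N′
    eigenbasis-similar {K} {K⁻¹} {N} {N′} i KN (P , P⁻¹ , d , iP , NP) =
      K *ᴹ P , P⁻¹ *ᴹ K⁻¹ , d , inverse-*ᴹ i iP , λ x → Q.begin
        N′ *ᵥ ((K *ᴹ P) *ᵥ x)                Q.≈⟨ *ᵥ-cong N′ (*ᴹ-*ᵥ K P x) ⟩
        N′ *ᵥ (K *ᵥ (P *ᵥ x))                Q.≈⟨ KN _ ⟨
        K *ᵥ (N *ᵥ (P *ᵥ x))                 Q.≈⟨ *ᵥ-cong K (NP x) ⟩
        K *ᵥ (P *ᵥ (λ i → d i * x i))        Q.≈⟨ *ᴹ-*ᵥ K P _ ⟨
        (K *ᴹ P) *ᵥ (λ i → d i * x i)        Q.∎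
      where module Q = ≋-Reasoning

    -- As a change of coordinates: the functional `f` becomes the coordinate at `a`, and all others
    -- are kept.
    replaceRow : Fin n → Vec → Matrix n
    replaceRow a f i = if does (i ≟ a) then f else unit i

    replaceRow-≡ : ∀ a f x → (replaceRow a f *ᵥ x) a ≈ dot f x
    replaceRow-≡ a f x = reflexive (≡.cong (λ w → dot w x) (if-yes (a ≟ a) ≡.refl))

    replaceRow-≢ : ∀ a f x i → i ≢ a → (replaceRow a f *ᵥ x) i ≈ x i
    replaceRow-≢ a f x i i≢a = trans
      (reflexive (≡.cong (λ w → dot w x) (if-no (i ≟ a) {x = f} {y = unit i} i≢a))) (dot-unitˡ i x)

    replaceRow-inverse : ∀ a f → f a ≉ 0# → ∃ λ g → replaceRow a g InverseOf replaceRow a f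
    replaceRow-inverse a f fa≉0 = g , record { inverseˡ = invˡ ; inverseʳ = invʳ }
      where
      c = f a ⁻¹
      -- Solving f·x = yₐ for xₐ gives the row with entries -c fᵢ off `a` and c at `a`. The formula
      -- produces both, since -c fₐ + 1 + c = c.
      g : Vec
      g = scaled (- c) f ⊕ scaled (1# + c) (unit a)
      dot-g : ∀ x → dot g x ≈ - c * dot f x + (1# + c) * x a
      dot-g x = trans (dot-⊕ˡ _ _ x) (+-cong (dot-scaledˡ f (- c) x)
        (trans (dot-scaledˡ (unit a) (1# + c) x) (*-congˡ (dot-unitˡ a x))))
      invˡ : ∀ x → replaceRow a g *ᵥ (replaceRow a f *ᵥ x) ≋ x
      invˡ x i with i ≟ a
      ... | no i≢a = trans (dot-unitˡ i _) (replaceRow-≢ a f x i i≢a)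
      ... | yes ≡.refl = begin
        dot g y                                           ≈⟨ dot-g y ⟩
        - c * dot f y + (1# + c) * y a
          ≈⟨ +-cong (*-congˡ (trans (dot-update f a (replaceRow-≢ a f x)) (+-congˡ (*-congˡ (+-congʳ ya))))) (*-congˡ ya) ⟩
        - c * (f·x + f a * (f·x - x a)) + (1# + c) * f·x
          ≈⟨ solve 4 (λ c fx fa xa → :- c :* (fx :+ fa :* (fx :- xa)) :+ (con ℤ.1ℤ :+ c) :* fx
                                                                := fx :- (fa :* c) :* (fx :- xa)) refl c f·x (f a) (x a) ⟩
        f·x - (f a * c) * (f·x - x a)                     ≈⟨ +-congˡ (-‿cong (*-congʳ (*-inverseʳ fa≉0))) ⟩
        f·x - 1# * (f·x - x a)
          ≈⟨ solve 2 (λ fx xa → fx :- con ℤ.1ℤ :* (fx :- xa) := xa) refl f·x (x a) ⟩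
        x a                                               ∎
        where
        y = replaceRow a f *ᵥ x
        f·x = dot f x
        ya = replaceRow-≡ a f x
      invʳ : ∀ x → replaceRow a f *ᵥ (replaceRow a g *ᵥ x) ≋ x
      invʳ x i with i ≟ a
      ... | no i≢a = trans (dot-unitˡ i _) (replaceRow-≢ a g x i i≢a)
      ... | yes ≡.refl = begin
        dot f y                                           ≈⟨ dot-update f a (replaceRow-≢ a g x) ⟩
        f·x + f a * (y a - x a)
          ≈⟨ +-congˡ (*-congˡ (+-congʳ (trans (replaceRow-≡ a g x) (dot-g x)))) ⟩
        f·x + f a * (- c * f·x + (1# + c) * x a - x a)
          ≈⟨ solve 4 (λ c fx fa xa → fx :+ fa :* (:- c :* fx :+ (con ℤ.1ℤ :+ c) :* xa :- xa)
                                                                := fx :+ (fa :* c) :* (xa :- fx)) refl c f·x (f a) (x a) ⟩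
        f·x + (f a * c) * (x a - f·x)                     ≈⟨ +-congˡ (*-congʳ (*-inverseʳ fa≉0)) ⟩
        f·x + 1# * (x a - f·x)
          ≈⟨ solve 2 (λ fx xa → fx :+ con ℤ.1ℤ :* (xa :- fx) := xa) refl f·x (x a) ⟩
        x a                                               ∎
        where
        y = replaceRow a g *ᵥ x
        f·x = dot f x

-- Matrices made of 2 × 2 blocks on pairs of opposite indices

module PairedBlocks {q : ℕ} (C : ℂ∞ q) where
  open Drinfeld C hiding (zero)
  open LinearAlgebra C
  open Algebra.Properties.Ring ring
  open IntegerSolver commutativeRing
  open Relation.Binary.Reasoning.Setoid setoid

  module _ {n : ℕ} where

    module _ {Paired : Fin n → Set} (paired? : ∀ a → Dec (Paired a))
             (paired-opposite : ∀ {a} → Paired a → Paired (opposite a)) where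

      onPaired : Vec → Vec → Vec
      onPaired x y a = if does (paired? a) then x a else y a

      onPaired-yes : ∀ x y {a} → Paired a → onPaired x y a ≈ x a
      onPaired-yes x y {a} h = reflexive (if-yes (paired? a) {x = x a} h)

      onPaired-no : ∀ x y {a} → ¬ Paired a → onPaired x y a ≈ y a
      onPaired-no x y {a} h = reflexive (if-no (paired? a) {x = x a} h)

      -- On a paired index `a` the row reads αₐ xₐ + βₐ x_{a′} with a′ = opposite a; elsewhere the
      -- matrix is diagonal with entries ν. Since `antidiag` takes its entries by column, β is
      -- composed with `opposite` to be indexed by row.
      blocks : (α β ν : Vec) → Matrix n
      blocks α β ν = diag (onPaired α ν) +ᴹ antidiag (onPaired β 0ᶠ ∘ opposite)

      private
        blocks-*ᵥ : ∀ α β ν x a → (blocks α β ν *ᵥ x) a ≈ onPaired α ν a * x a + onPaired β 0ᶠ a * x (opposite a)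
        blocks-*ᵥ α β ν x a = trans (+ᴹ-*ᵥ (diag (onPaired α ν)) (antidiag (onPaired β 0ᶠ ∘ opposite)) x a)
          (+-cong (diag-*ᵥ (onPaired α ν) x a) (trans (antidiag-*ᵥ (onPaired β 0ᶠ ∘ opposite) x a)
            (*-congʳ (reflexive (≡.cong (onPaired β 0ᶠ) (opposite-involutive a))))))

      blocks-paired : ∀ α β ν x a → Paired a → (blocks α β ν *ᵥ x) a ≈ α a * x a + β a * x (opposite a)
      blocks-paired α β ν x a h = trans (blocks-*ᵥ α β ν x a)
        (+-cong (*-congʳ (onPaired-yes α ν h)) (*-congʳ (onPaired-yes β 0ᶠ h)))

      blocks-unpaired : ∀ α β ν x a → ¬ Paired a → (blocks α β ν *ᵥ x) a ≈ ν a * x a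
      blocks-unpaired α β ν x a h = trans (blocks-*ᵥ α β ν x a) (trans
        (+-cong (*-congʳ (onPaired-no α ν h)) (*-congʳ (onPaired-no β 0ᶠ h)))
        (trans (+-congˡ (zeroˡ _)) (+-identityʳ _)))

      blocks-blocks-paired : ∀ α β ν γ δ ν′ x a → Paired a → (blocks α β ν *ᵥ (blocks γ δ ν′ *ᵥ x)) a ≈
        (α a * γ a + β a * δ (opposite a)) * x a + (α a * δ a + β a * γ (opposite a)) * x (opposite a)
      blocks-blocks-paired α β ν γ δ ν′ x a h = begin
        (blocks α β ν *ᵥ y) a
          ≈⟨ blocks-paired α β ν y a h ⟩
        α a * y a + β a * y a′
          ≈⟨ +-cong (*-congˡ (blocks-paired γ δ ν′ x a h)) (*-congˡ (trans (blocks-paired γ δ ν′ x a′ (paired-opposite h))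
               (+-congˡ (*-congˡ (reflexive (≡.cong x (opposite-involutive a))))))) ⟩
        α a * (γ a * x a + δ a * x a′) + β a * (γ a′ * x a′ + δ a′ * x a)
          ≈⟨ solve 8 (λ α β γ δ γ′ δ′ x x′ →
               α :* (γ :* x :+ δ :* x′) :+ β :* (γ′ :* x′ :+ δ′ :* x)
               := (α :* γ :+ β :* δ′) :* x :+ (α :* δ :+ β :* γ′) :* x′) refl
               (α a) (β a) (γ a) (δ a) (γ a′) (δ a′) (x a) (x a′) ⟩
        (α a * γ a + β a * δ a′) * x a + (α a * δ a + β a * γ a′) * x a′ ∎
        where
        a′ = opposite a
        y  = blocks γ δ ν′ *ᵥ x

      module _ (ν κ : Vec) (μ : Carrier) (κκ : ∀ a → Paired a → κ a * κ (opposite a) ≈ μ) where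

        -- On a pair {a, a′} the vectors ρₐ eₐ + κ_{a′} e_{a′} and ρ_{a′} e_{a′} + κₐ eₐ
        -- are eigenvectors for ρₐ and ρ_{a′} = - ρₐ; the matrix they form squares to 2μ.
        blocks-eigenbasis : (ρ : Vec) → (∀ a → Paired a → ρ a * ρ a ≈ μ) →
          (∀ a → Paired a → ρ (opposite a) ≈ - ρ a) →
          (∀ a → Paired a → μ + μ ≉ 0#) → Eigenbasis (blocks 0ᶠ κ ν)
        blocks-eigenbasis ρ ρρ ρ-opposite 2μ≉0 = P , P⁻¹ , d ,
          record { inverseˡ = invˡ ; inverseʳ = invʳ } , eigen
          where
          1ᶠ = λ _ → 1#
          c = (μ + μ) ⁻¹
          P P⁻¹ : Matrix n
          P   = blocks ρ κ 1ᶠ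
          P⁻¹ = blocks (scaled c ρ) (scaled c κ) 1ᶠ
          d : Vec
          d = onPaired ρ ν

          P-unpaired : ∀ x a → ¬ Paired a → (P *ᵥ x) a ≈ x a
          P-unpaired x a h = trans (blocks-unpaired ρ κ 1ᶠ x a h) (*-identityˡ (x a))

          P⁻¹-unpaired : ∀ x a → ¬ Paired a → (P⁻¹ *ᵥ x) a ≈ x a
          P⁻¹-unpaired x a h = trans (blocks-unpaired (scaled c ρ) (scaled c κ) 1ᶠ x a h) (*-identityˡ (x a))

          -- Both orders of multiplication lead to this expression. The coefficient of xₐ is c(μ +
          -- μ) = 1, and the cross term dies because ρ changes sign within a pair.
          collapse : ∀ x a → Paired a → let a′ = opposite a in
            c * (ρ a * ρ a + κ a * κ a′) * x a + c * κ a * (ρ a + ρ a′) * x a′ ≈ x a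
          collapse x a h = begin
            c * (ρ a * ρ a + κ a * κ a′) * x a + c * κ a * (ρ a + ρ a′) * x a′
              ≈⟨ +-cong (*-congʳ (*-congˡ (+-cong (ρρ a h) (κκ a h)))) (*-congʳ (*-congˡ (+-congˡ (ρ-opposite a h)))) ⟩
            c * (μ + μ) * x a + c * κ a * (ρ a - ρ a) * x a′
              ≈⟨ solve 6 (λ c m k r x x′ → c :* (m :+ m) :* x :+ c :* k :* (r :- r) :* x′ := (m :+ m) :* c :* x) refl
                   c μ (κ a) (ρ a) (x a) (x a′) ⟩
            (μ + μ) * c * x a
              ≈⟨ *-congʳ (*-inverseʳ (2μ≉0 a h)) ⟩
            1# * x a
              ≈⟨ *-identityˡ (x a) ⟩
            x a ∎
            where a′ = opposite a

          invˡ : ∀ x → P⁻¹ *ᵥ (P *ᵥ x) ≋ x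
          invˡ x a = by (paired? a)
            where
            a′ = opposite a
            by : Dec (Paired a) → (P⁻¹ *ᵥ (P *ᵥ x)) a ≈ x a
            by (no h) = trans (P⁻¹-unpaired _ a h) (P-unpaired x a h)
            by (yes h) = begin
              (P⁻¹ *ᵥ (P *ᵥ x)) a
                ≈⟨ blocks-blocks-paired (scaled c ρ) (scaled c κ) 1ᶠ ρ κ 1ᶠ x a h ⟩
              (c * ρ a * ρ a + c * κ a * κ a′) * x a + (c * ρ a * κ a + c * κ a * ρ a′) * x a′
                ≈⟨ solve 7 (λ c r r′ k k′ x x′ →
                     (c :* r :* r :+ c :* k :* k′) :* x :+ (c :* r :* k :+ c :* k :* r′) :* x′
                     := c :* (r :* r :+ k :* k′) :* x :+ c :* k :* (r :+ r′) :* x′) refl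
                     c (ρ a) (ρ a′) (κ a) (κ a′) (x a) (x a′) ⟩
              c * (ρ a * ρ a + κ a * κ a′) * x a + c * κ a * (ρ a + ρ a′) * x a′
                ≈⟨ collapse x a h ⟩
              x a ∎

          invʳ : ∀ x → P *ᵥ (P⁻¹ *ᵥ x) ≋ x
          invʳ x a = by (paired? a)
            where
            a′ = opposite a
            by : Dec (Paired a) → (P *ᵥ (P⁻¹ *ᵥ x)) a ≈ x a
            by (no h) = trans (P-unpaired _ a h) (P⁻¹-unpaired x a h)
            by (yes h) = begin
              (P *ᵥ (P⁻¹ *ᵥ x)) a
                ≈⟨ blocks-blocks-paired ρ κ 1ᶠ (scaled c ρ) (scaled c κ) 1ᶠ x a h ⟩
              (ρ a * (c * ρ a) + κ a * (c * κ a′)) * x a + (ρ a * (c * κ a) + κ a * (c * ρ a′)) * x a′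
                ≈⟨ solve 7 (λ c r r′ k k′ x x′ →
                     (r :* (c :* r) :+ k :* (c :* k′)) :* x :+ (r :* (c :* k) :+ k :* (c :* r′)) :* x′
                     := c :* (r :* r :+ k :* k′) :* x :+ c :* k :* (r :+ r′) :* x′) refl
                     c (ρ a) (ρ a′) (κ a) (κ a′) (x a) (x a′) ⟩
              c * (ρ a * ρ a + κ a * κ a′) * x a + c * κ a * (ρ a + ρ a′) * x a′
                ≈⟨ collapse x a h ⟩
              x a ∎

          eigen : ∀ x → blocks 0ᶠ κ ν *ᵥ (P *ᵥ x) ≋ P *ᵥ (λ i → d i * x i)
          eigen x a = by (paired? a)
            where
            a′ = opposite a
            by : Dec (Paired a) → (blocks 0ᶠ κ ν *ᵥ (P *ᵥ x)) a ≈ (P *ᵥ (λ i → d i * x i)) a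
            by (no h) = begin
              (blocks 0ᶠ κ ν *ᵥ (P *ᵥ x)) a      ≈⟨ blocks-unpaired 0ᶠ κ ν _ a h ⟩
              ν a * (P *ᵥ x) a                   ≈⟨ *-cong (onPaired-no ρ ν h) (sym (P-unpaired x a h)) ⟨
              d a * x a                          ≈⟨ P-unpaired _ a h ⟨
              (P *ᵥ (λ i → d i * x i)) a         ∎
            by (yes h) = begin
              (blocks 0ᶠ κ ν *ᵥ (P *ᵥ x)) a
                ≈⟨ blocks-blocks-paired 0ᶠ κ ν ρ κ 1ᶠ x a h ⟩
              (0# * ρ a + κ a * κ a′) * x a + (0# * κ a + κ a * ρ a′) * x a′
                ≈⟨ +-cong (*-congʳ (trans (+-congʳ (zeroˡ _)) (trans (+-identityˡ _) (trans (κκ a h) (sym (ρρ a h))))))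
                          (*-congʳ (trans (+-congʳ (zeroˡ _)) (+-identityˡ _))) ⟩
              ρ a * ρ a * x a + κ a * ρ a′ * x a′
                ≈⟨ +-cong (*-assoc _ _ _) (*-assoc _ _ _) ⟩
              ρ a * (ρ a * x a) + κ a * (ρ a′ * x a′)
                ≈⟨ +-cong (*-congˡ (*-congʳ (onPaired-yes ρ ν h))) (*-congˡ (*-congʳ (onPaired-yes ρ ν (paired-opposite h)))) ⟨
              ρ a * (d a * x a) + κ a * (d a′ * x a′)
                ≈⟨ blocks-paired ρ κ 1ᶠ _ a h ⟨
              (P *ᵥ (λ i → d i * x i)) a ∎

        -- In characteristic 2, N² eₐ = λ² eₐ would force (N - λ) eₐ = 0 for a
        -- diagonalizable N, but N eₐ is a multiple of e_{a′}.
        blocks-¬eigenbasis : 1# + 1# ≈ 0# → μ ≉ 0# → (ρ : Carrier) → ρ * ρ ≈ μ →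
          ∀ a → Paired a → a ≢ opposite a → ¬ Eigenbasis (blocks 0ᶠ κ ν)
        blocks-¬eigenbasis 2≈0 μ≉0 ρ ρρ a h a≢a′ (P , P⁻¹ , d , i , NP) = μ≉0 (begin
          μ                     ≈⟨ κκ a h ⟨
          κ a * κ a′            ≈⟨ *-congˡ κa′≈0 ⟩
          κ a * 0#              ≈⟨ zeroʳ _ ⟩
          0#                    ∎)
          where
          a′ = opposite a
          N = blocks 0ᶠ κ ν
          e = unit a
          y = P⁻¹ *ᵥ e

          dd : Vec → Vec
          dd x b = d b * x b

          module Q = ≋-Reasoning

          N-paired : ∀ x b → Paired b → (N *ᵥ x) b ≈ κ b * x (opposite b)
          N-paired x b h = trans (blocks-paired 0ᶠ κ ν x b h) (trans (+-congʳ (zeroˡ (x b))) (+-identityˡ _))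

          NNe : N *ᵥ (N *ᵥ e) ≋ scaled μ e
          NNe b = by (paired? b)
            where
            by : Dec (Paired b) → (N *ᵥ (N *ᵥ e)) b ≈ μ * e b
            by (yes hb) = trans (blocks-blocks-paired 0ᶠ κ ν 0ᶠ κ ν e b hb) (trans
              (+-cong (*-congʳ (trans (+-cong (zeroˡ _) (κκ b hb)) (+-identityˡ μ)))
                      (trans (*-congʳ (trans (+-cong (zeroˡ _) (zeroʳ _)) (+-identityʳ 0#))) (zeroˡ _)))
              (+-identityʳ _))
            by (no hb) = begin
              (N *ᵥ (N *ᵥ e)) b     ≈⟨ blocks-unpaired 0ᶠ κ ν _ b hb ⟩
              ν b * (N *ᵥ e) b      ≈⟨ *-congˡ (blocks-unpaired 0ᶠ κ ν e b hb) ⟩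
              ν b * (ν b * e b)     ≈⟨ *-congˡ (*-congˡ eb≈0) ⟩
              ν b * (ν b * 0#)      ≈⟨ solve 2 (λ n m → n :* (n :* con ℤ.0ℤ) := m :* con ℤ.0ℤ) refl (ν b) μ ⟩
              μ * 0#                ≈⟨ *-congˡ eb≈0 ⟨
              μ * e b               ∎
              where
              eb≈0 : e b ≈ 0#
              eb≈0 = unit-≢ (λ b≡a → hb (≡.subst Paired (≡.sym b≡a) h))

          ddy : dd (dd y) ≋ scaled μ y
          ddy = Q.begin
            dd (dd y)                        Q.≈⟨ inverseˡ i _ ⟨
            P⁻¹ *ᵥ (P *ᵥ dd (dd y))          Q.≈⟨ *ᵥ-cong P⁻¹ (NP (dd y)) ⟨
            P⁻¹ *ᵥ (N *ᵥ (P *ᵥ dd y))        Q.≈⟨ *ᵥ-cong P⁻¹ (*ᵥ-cong N (NP y)) ⟨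
            P⁻¹ *ᵥ (N *ᵥ (N *ᵥ (P *ᵥ y)))    Q.≈⟨ *ᵥ-cong P⁻¹ (*ᵥ-cong N (*ᵥ-cong N (inverseʳ i e))) ⟩
            P⁻¹ *ᵥ (N *ᵥ (N *ᵥ e))           Q.≈⟨ *ᵥ-cong P⁻¹ NNe ⟩
            P⁻¹ *ᵥ scaled μ e                Q.≈⟨ *ᵥ-scaled P⁻¹ μ e ⟩
            scaled μ y                       Q.∎

          -- Where y does not vanish, d² = μ = ρ²; in characteristic 2 this reads (d - ρ)² = 0,
          -- hence d = ρ.
          dy : dd y ≋ scaled ρ y
          dy b with 0? (d b - ρ)
          ... | yes e = *-congʳ (x∙y⁻¹≈ε⇒x≈y (d b) ρ e)
          ... | no ≉0 = trans (*-congˡ y≈0) (trans (trans (zeroʳ _) (sym (zeroʳ _))) (*-congˡ (sym y≈0)))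
            where
            y≈0 : y b ≈ 0#
            y≈0 = cancel-≉0 ≉0 (cancel-≉0 ≉0 (begin
              (d b - ρ) * ((d b - ρ) * y b)
                ≈⟨ solve 3 (λ d r y → (d :- r) :* ((d :- r) :* y)
                     := d :* (d :* y) :- r :* r :* y :+ (con ℤ.1ℤ :+ con ℤ.1ℤ) :* (r :* r :* y :- r :* d :* y)) refl (d b) ρ (y b) ⟩
              dd (dd y) b - ρ * ρ * y b + (1# + 1#) * (ρ * ρ * y b - ρ * d b * y b)
                ≈⟨ +-cong (+-cong (ddy b) (-‿cong (*-congʳ ρρ))) (trans (*-congʳ 2≈0) (zeroˡ _)) ⟩
              μ * y b - μ * y b + 0#
                ≈⟨ solve 1 (λ x → x :- x :+ con ℤ.0ℤ := con ℤ.0ℤ) refl (μ * y b) ⟩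
              0# ∎))

          -- Compare the coordinates at a′ in N e = ρ e: the left one is κ_{a′}, the right one is 0
          -- because a ≠ a′.
          κa′≈0 : κ a′ ≈ 0#
          κa′≈0 = begin
            κ a′                               ≈⟨ *-identityʳ _ ⟨
            κ a′ * 1#                          ≈⟨ *-congˡ (unit-≡ a) ⟨
            κ a′ * e a                         ≈⟨ *-congˡ (reflexive (≡.cong e (opposite-involutive a))) ⟨
            κ a′ * e (opposite a′)             ≈⟨ N-paired e a′ (paired-opposite h) ⟨
            (N *ᵥ e) a′                        ≈⟨ *ᵥ-cong N (inverseʳ i e) a′ ⟨
            (N *ᵥ (P *ᵥ y)) a′                 ≈⟨ NP y a′ ⟩
            (P *ᵥ dd y) a′                     ≈⟨ *ᵥ-cong P dy a′ ⟩
            (P *ᵥ scaled ρ y) a′               ≈⟨ *ᵥ-scaled P ρ y a′ ⟩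
            ρ * (P *ᵥ y) a′                    ≈⟨ *-congˡ (inverseʳ i e a′) ⟩
            ρ * e a′                           ≈⟨ *-congˡ (unit-≢ (a≢a′ ∘ ≡.sym)) ⟩
            ρ * 0#                             ≈⟨ zeroʳ ρ ⟩
            0#                                 ∎

toℕ+toℕ-opposite : ∀ {n} (i : Fin (suc n)) → toℕ i ℕ.+ toℕ (opposite i) ≡ n
toℕ+toℕ-opposite {n} i = ≡.trans (≡.cong (toℕ i ℕ.+_) (opposite-prop i)) (ℕ.m+[n∸m]≡n (toℕ≤pred[n] i))

opposite-flip : ∀ {n} {a b : Fin n} → a ≡ opposite b → b ≡ opposite a
opposite-flip {b = b} ≡.refl = ≡.sym (opposite-involutive b)

-- Powers of t are nonzero and pairwise distinct

module PowersOft {q : ℕ} (C : ℂ∞ q) where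
  open Drinfeld C hiding (zero)
  open LinearAlgebra C
  open Algebra.Properties.Ring ring
  open Algebra.Properties.Semiring.Exp semiring using (^-homo-*)

  t≉0 : t ≉ 0#
  t≉0 t≈0 with ≡.trans (≡.sym v-t) (≡.trans (v-cong t≈0) v-0)
  ... | ()

  ^-≉0 : ∀ {x} → x ≉ 0# → ∀ d → x ^ d ≉ 0#
  ^-≉0 x≉0 zero    = 1≉0
  ^-≉0 x≉0 (suc d) = *-≉0 x≉0 (^-≉0 x≉0 d)

  v-1 : v 1# ≡ [ 0ℚ ]
  v-1 with v 1# in eq
  ... | ⊤⁺    = contradiction (v-⊤ eq) 1≉0
  ... | [ x ] = ≡.cong [_] (Algebra.Properties.Group.identityʳ-unique ℚ.+-0-group x x ([]-injective (begin
    [ x ] +⁺ [ x ]     ≡⟨ ≡.cong₂ _+⁺_ eq eq ⟨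
    v 1# +⁺ v 1#       ≡⟨ v-* 1# 1# ⟨
    v (1# * 1#)        ≡⟨ v-cong (*-identityˡ 1#) ⟩
    v 1#               ≡⟨ eq ⟩
    [ x ]              ∎)))
    where open ≡.≡-Reasoning

  -- Only the sign of the valuation is followed. Strictness holds for positive exponents alone,
  -- hence the two mutually recursive statements.
  v-t^ : ∀ d → ∃ λ x → v (t ^ d) ≡ [ x ] × x ℚ.≤ 0ℚ
  v-t^[1+_] : ∀ d → ∃ λ x → v (t ^ suc d) ≡ [ x ] × x ℚ.< 0ℚ
  v-t^ zero    = 0ℚ , v-1 , ℚ.≤-refl
  v-t^ (suc d) with v-t^[1+ d ]
  ... | x , eq , x<0 = x , eq , ℚ.<⇒≤ x<0
  v-t^[1+ d ] with v-t^ d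
  ... | x , eq , x≤0 = ℚ.- 1ℚ ℚ.+ x , ≡.trans (v-* t (t ^ d)) (≡.cong₂ _+⁺_ v-t eq)
                     , ℚ.+-mono-<-≤ (from-yes (ℚ.- 1ℚ ℚ.<? 0ℚ)) x≤0

  t^[1+_]≉1 : ∀ d → t ^ suc d ≉ 1#
  t^[1+ d ]≉1 e with v-t^[1+ d ]
  ... | x , eq , x<0 = ℚ.<-irrefl ([]-injective (≡.trans (≡.sym eq) (≡.trans (v-cong e) v-1))) x<0

  -- Factor out t^m; the other factor is nonzero because a positive power of t has negative
  -- valuation and so differs from 1.
  t^-distinct : ∀ m d → t ^ m - t ^ (m ℕ.+ suc d) ≉ 0#
  t^-distinct m d e = *-≉0 (^-≉0 t≉0 m)
    (λ h → t^[1+ d ]≉1 (sym (x∙y⁻¹≈ε⇒x≈y 1# (t ^ suc d) h)))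
    (trans (distribˡ _ _ _) (trans (+-cong (*-identityʳ _) (trans (sym (-‿distribʳ-* _ _)) (-‿cong (sym (^-homo-* t m (suc d)))))) e))

2∣m^n⇒2∣m : ∀ m n → 2 ∣ m ℕ.^ n → 2 ∣ m
2∣m^n⇒2∣m m zero 2∣1 = contradiction (∣⇒≤ 2∣1) λ { (s≤s ()) }
2∣m^n⇒2∣m m (suc n) h with euclidsLemma m (m ℕ.^ n) prime[2] h
... | inj₁ d = d
... | inj₂ d = 2∣m^n⇒2∣m m n d

-- Linear operators on functions, their matrices, and dimensions

module LinearMaps {q : ℕ} (C : ℂ∞ q) where
  open Drinfeld C hiding (zero)
  open LinearAlgebra C
  open Algebra.Properties.Semiring.Sum semiring using (sum-cong-≋; ∑-distrib-+; ∑-comm; *-distribˡ-sum; *-distribʳ-sum)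
  open IntegerSolver commutativeRing
  open Relation.Binary.Reasoning.Setoid setoid

  lincomb-cong : ∀ {X : Set} {n} a b (c e : Fin n → X → Carrier) → a ≋ b → (∀ i → c i ≋ e i) → lincomb a c ≋ lincomb b e
  lincomb-cong a b c e a≋b c≋e z = sum-cong-≋ (λ i → *-cong (a≋b i) (c≋e i z))

  lincomb-congˡ : ∀ {X : Set} {n} a b (c : Fin n → X → Carrier) → a ≋ b → lincomb a c ≋ lincomb b c
  lincomb-congˡ a b c a≋b = lincomb-cong a b c c a≋b (λ _ _ → refl)

  lincomb-⊕ : ∀ {X : Set} {n} a b (c : Fin n → X → Carrier) → lincomb (a ⊕ b) c ≋ lincomb a c ⊕ lincomb b c
  lincomb-⊕ a b c z = dot-⊕ˡ a b (λ i → c i z)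

  lincomb-scaled : ∀ {X : Set} {n} x a (c : Fin n → X → Carrier) → lincomb (scaled x a) c ≋ scaled x (lincomb a c)
  lincomb-scaled x a c z = dot-scaledˡ a x (λ i → c i z)

  lincomb-zero : ∀ {X : Set} {n} a (c : Fin n → X → Carrier) → a ≋ 0ᶠ → lincomb a c ≋ 0ᶠ
  lincomb-zero a c a≋0 z = sum-zero _ (λ i → trans (*-congʳ (a≋0 i)) (zeroˡ _))

  dot-lincomb : ∀ {n d} w α (b : Fin d → Fin n → Carrier) → dot w (lincomb α b) ≈ ∑[ i < d ] (α i * dot w (b i))
  dot-lincomb {n} {d} w α b = begin
    ∑[ k < n ] (w k * ∑[ i < d ] (α i * b i k))     ≈⟨ sum-cong-≋ (λ k → *-distribˡ-sum (w k) (λ i → α i * b i k)) ⟩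
    ∑[ k < n ] ∑[ i < d ] (w k * (α i * b i k))     ≈⟨ ∑-comm (λ k i → w k * (α i * b i k)) ⟩
    ∑[ i < d ] ∑[ k < n ] (w k * (α i * b i k))     ≈⟨ sum-cong-≋ (λ i → trans
      (sum-cong-≋ (λ k → solve 3 (λ w a b → w :* (a :* b) := a :* (w :* b)) refl (w k) (α i) (b i k)))
      (sym (*-distribˡ-sum (α i) (λ k → w k * b i k)))) ⟩
    ∑[ i < d ] (α i * dot w (b i))                   ∎

  lincomb-lincomb : ∀ {X : Set} {n d} α (b : Fin d → Fin n → Carrier) (c : Fin n → X → Carrier) →
                    lincomb (lincomb α b) c ≋ lincomb α (λ i → lincomb (b i) c)
  lincomb-lincomb α b c z = begin
    lincomb (lincomb α b) c z              ≈⟨ sum-cong-≋ (λ k → *-comm (lincomb α b k) (c k z)) ⟩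
    dot (λ k → c k z) (lincomb α b)        ≈⟨ dot-lincomb (λ k → c k z) α b ⟩
    _                                      ≈⟨ sum-cong-≋ (λ i → *-congˡ (sum-cong-≋ (λ k → *-comm (c k z) (b i k)))) ⟩
    lincomb α (λ i → lincomb (b i) c) z    ∎

  -- Combinations of every length are allowed, so a single law covers sums, scalar multiples and
  -- expansions in a basis.
  record Linear {X Y : Set} (L : (X → Carrier) → Y → Carrier) : Set where
    field
      L-cong    : ∀ f g → f ≋ g → L f ≋ L g
      L-lincomb : ∀ {n} a (c : Fin n → X → Carrier) → L (lincomb a c) ≋ lincomb a (L ∘ c)
  open Linear public

  linear-id : ∀ {X : Set} → Linear {X} id
  linear-id = record { L-cong = λ _ _ e → e ; L-lincomb = λ _ _ _ → refl }

  linear-∘ : ∀ {X Y Z : Set} {L : (Y → Carrier) → Z → Carrier} {L′ : (X → Carrier) → Y → Carrier} →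
             Linear L → Linear L′ → Linear (L ∘ L′)
  linear-∘ {L = L} {L′} l l′ = record
    { L-cong = λ f g e → L-cong l (L′ f) (L′ g) (L-cong l′ f g e)
    ; L-lincomb = λ a c z → trans (L-cong l (L′ (lincomb a c)) (lincomb a (L′ ∘ c)) (L-lincomb l′ a c) z) (L-lincomb l a (L′ ∘ c) z)
    }

  linear-⊕ : ∀ {X Y : Set} {L L′ : (X → Carrier) → Y → Carrier} → Linear L → Linear L′ → Linear (λ f → L f ⊕ L′ f)
  linear-⊕ {L = L} {L′} l l′ = record
    { L-cong = λ f g e z → +-cong (L-cong l f g e z) (L-cong l′ f g e z)
    ; L-lincomb = λ a c z → trans (+-cong (L-lincomb l a c z) (L-lincomb l′ a c z))
        (sym (trans (sum-cong-≋ (λ i → distribˡ (a i) (L (c i) z) (L′ (c i) z))) (∑-distrib-+ (λ i → a i * L (c i) z) (λ i → a i * L′ (c i) z))))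
    }

  linear-∑ : ∀ {X Y : Set} {n} {L : Fin n → (X → Carrier) → Y → Carrier} → (∀ i → Linear (L i)) →
             Linear (λ f z → ∑[ i < n ] L i f z)
  linear-∑ {L = L} l = record
    { L-cong = λ f g e z → sum-cong-≋ (λ i → L-cong (l i) f g e z)
    ; L-lincomb = λ a c z → trans (sum-cong-≋ (λ i → L-lincomb (l i) a c z))
        (trans (∑-comm (λ i b → a b * L i (c b) z)) (sum-cong-≋ (λ b → sym (*-distribˡ-sum (a b) (λ i → L i (c b) z)))))
    }

  linear-slash : ∀ k m γ → Linear (_∣[ k , m ] γ)
  linear-slash k m γ = record
    { L-cong = λ f g e z → *-congʳ (*-congʳ (e (γ ∙ z)))
    ; L-lincomb = λ a c z → trans
        (trans (*-congʳ (*-distribʳ-sum _ (λ i → a i * c i (γ ∙ z)))) (*-distribʳ-sum _ (λ i → a i * c i (γ ∙ z) * _)))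
        (sum-cong-≋ (λ i → trans (*-congʳ (*-assoc (a i) _ _)) (*-assoc (a i) _ _)))
    }

  module _ (k : ℕ) (m : ℤ) where
    open Operators k m

    linear-Tr : Linear Tr
    linear-Tr = linear-⊕ {L = id} linear-id (linear-∑ {L = λ i → _∣[ k , m ] coset i} (λ i → linear-slash k m (coset i)))

    linear-Tr′ : Linear Tr′
    linear-Tr′ = linear-∘ {L = Tr} {L′ = Fr} linear-Tr (linear-slash k m fricke)

  -- `HasMatrix` prescribes the operator on the family `c` only; linearity extends this to its span.
  matrix-lincomb : ∀ {X : Set} {n} {L : (X → Carrier) → X → Carrier} (c : Fin n → X → Carrier) (N : Matrix n) →
                   Linear L → HasMatrix L c N → ∀ a → L (lincomb a c) ≋ lincomb (N *ᵥ a) c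
  matrix-lincomb {L = L} c N l h a z = begin
    L (lincomb a c) z                                      ≈⟨ L-lincomb l a c z ⟩
    lincomb a (L ∘ c) z
      ≈⟨ lincomb-cong a a (L ∘ c) (λ b → lincomb (λ i → N i b) c) (λ _ → refl) h z ⟩
    lincomb a (λ b → lincomb (λ i → N i b) c) z            ≈⟨ lincomb-lincomb a (λ b i → N i b) c z ⟨
    lincomb (lincomb a (λ b i → N i b)) c z                ≈⟨ lincomb-congˡ (lincomb a (λ b i → N i b)) (N *ᵥ a) c
                                                                (λ i → sum-cong-≋ (λ b → *-comm (a b) (N i b))) z ⟩
    lincomb (N *ᵥ a) c z                                   ∎

  hasDimension-≐ : ∀ {X : Set} {V W : Pred (X → Carrier) _} {d} → V ≐ W → HasDimension V d → HasDimension W d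
  hasDimension-≐ (V⊆W , W⊆V) (b , (to , from) , independent) = b , (to ∘ W⊆V , V⊆W ∘ from) , independent

  withCoordinates-mono : ∀ {X : Set} {n} (c : Fin n → X → Carrier) {V W : Pred (Fin n → Carrier) _} → V ⊆ W →
                         WithCoordinates c V ⊆ WithCoordinates c W
  withCoordinates-mono c V⊆W (a , Va , e) = a , V⊆W Va , e

  hasDimension-withCoordinates : ∀ {X : Set} {n} (c : Fin n → X → Carrier) → (∀ a → lincomb a c ≋ 0ᶠ → a ≋ 0ᶠ) →
    ∀ W d → HasDimension W d → HasDimension (WithCoordinates c W) d
  hasDimension-withCoordinates c c-independent W d (b , (to , from) , independent) =
    (λ i → lincomb (b i) c)
    , ( (λ (a , Wa , f≋) → let α , a≋ = to Wa in α , λ z → trans (f≋ z)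
            (trans (lincomb-congˡ a (lincomb α b) c a≋ z) (lincomb-lincomb α b c z)))
      , (λ (α , f≋) → lincomb α b , from (α , λ _ → refl) , λ z → trans (f≋ z) (sym (lincomb-lincomb α b c z))))
    , λ α h → independent α (c-independent (lincomb α b) (λ z → trans (lincomb-lincomb α b c z) (h z)))

  -- α and β are the coefficients of f and g on the only basis vector. The clause about α excludes
  -- the trivial relation; when the basis is empty, f is zero anyway.
  dimension≤1-dependent : ∀ {X : Set} {V : Pred (X → Carrier) _} d → HasDimension V d → d ≤ 1 →
    ∀ f g → V f → V g → ∃₂ λ α β → scaled β f ≋ scaled α g × (α ≈ 0# → f ≋ 0ᶠ)
  dimension≤1-dependent zero (b , (to , _) , _) _ f g Vf Vg =
    0# , 0# , (λ z → trans (zeroˡ (f z)) (sym (zeroˡ (g z)))) , λ _ → proj₂ (to Vf)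
  dimension≤1-dependent (suc zero) (b , (to , _) , _) _ f g Vf Vg with to Vf | to Vg
  ... | α , f≋ | β , g≋ = α zero , β zero
    , (λ z → begin
        β zero * f z                   ≈⟨ *-congˡ (trans (f≋ z) (+-identityʳ _)) ⟩
        β zero * (α zero * b zero z)
          ≈⟨ solve 3 (λ a b c → b :* (a :* c) := a :* (b :* c)) refl (α zero) (β zero) (b zero z) ⟩
        α zero * (β zero * b zero z)  ≈⟨ *-congˡ (trans (g≋ z) (+-identityʳ _)) ⟨
        α zero * g z                   ∎)
    , λ α≈0 z → trans (f≋ z) (trans (+-identityʳ _) (trans (*-congʳ α≈0) (zeroˡ _)))
  dimension≤1-dependent (suc (suc d)) _ (s≤s ())

-- The matrices M, D, F, A, T and the spaces of cusp forms

module OverPrimePower (p r : ℕ) (pp : Prime p) (q-1 : ℕ) (q≡p^r : suc q-1 ≡ p ℕ.^ r) (C : ℂ∞ (suc q-1))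
                      (j : ℕ) (j<q-1 : j < q-1) where
  q = suc q-1
  open Drinfeld C hiding (zero)
  open LinearAlgebra C
  open LinearMaps C
  open PairedBlocks C
  open PowersOft C
  open Matrices j (suc (suc j))
  open Algebra.Properties.Ring ring
  open Algebra.Properties.Semiring.Exp semiring using (^-homo-*; ^-congˡ; ^-congʳ)
  open Algebra.Properties.CommutativeSemiring.Exp commutativeSemiring using (^-distrib-*)
  open Algebra.Properties.Semiring.Mult semiring using (×-congˡ; ×1-homo-*) renaming (_×_ to _·_)
  open Algebra.Properties.Semiring.Sum semiring using (sum-cong-≋)
  open IntegerSolver commutativeRing
  open Relation.Binary.Reasoning.Setoid setoid
  open Binomials commutativeRing q-1

  -- Characteristic p and signs

  private
    module 𝔽Mult = Algebra.Properties.Semiring.Mult 𝔽.semiring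
    module ι = Morphisms.IsRingHomomorphism ι-hom

  ι-× : ∀ k → ι (k 𝔽Mult.× 𝔽.1#) ≈ k · 1#
  ι-× zero    = ι.0#-homo
  ι-× (suc k) = trans (ι.+-homo _ _) (+-cong ι.1#-homo (ι-× k))

  -- The relation holds in 𝔽 by counting and is carried over by ι.
  p·1≈0 : p · 1# ≈ 0#
  p·1≈0 = trans (sym (ι-× p)) (trans (ι.⟦⟧-cong (FiniteField.characteristic 𝔽 enum p r q≡p^r)) ι.0#-homo)

  B-q : ∀ k → 0 < k → k < q → B q k ≈ 0#
  B-q k 0<k k<q with p∣p^rCk pp r k 0<k (≡.subst (k <_) q≡p^r k<q)
  ... | divides c eq = begin
    B q k                  ≡⟨ ≡.cong (λ x → B x k) q≡p^r ⟩
    B (p ℕ.^ r) k          ≈⟨ ×-congˡ eq ⟩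
    (c ℕ.* p) · 1#         ≈⟨ ×1-homo-* c p ⟩
    c · 1# * p · 1#        ≈⟨ *-congˡ p·1≈0 ⟩
    c · 1# * 0#            ≈⟨ zeroʳ _ ⟩
    0#                     ∎

  open Lucas B-q

  sign-+ : ∀ m k → sign (m ℕ.+ k) ≈ sign m * sign k
  sign-+ = ^-homo-* (- 1#)

  sign-suc : ∀ m → sign (suc m) ≈ - sign m
  sign-suc m = -1*x≈-x (sign m)

  sign*sign : ∀ m → sign m * sign m ≈ 1#
  sign*sign zero = *-identityˡ 1#
  sign*sign (suc m) = trans (solve 2 (λ o s → (:- o :* s) :* (:- o :* s) := (o :* o) :* (s :* s)) refl 1# (sign m))
    (trans (*-cong (*-identityˡ 1#) (sign*sign m)) (*-identityˡ 1#))

  -- The last entry of row q - 1 of Pascal's triangle is both 1 and (-1)^(q-1), which treats even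
  -- and odd q together.
  sign-*[q-1] : ∀ k → sign (k ℕ.* q-1) ≈ 1#
  sign-*[q-1] zero    = refl
  sign-*[q-1] (suc k) = begin
    sign (q-1 ℕ.+ k ℕ.* q-1)      ≈⟨ sign-+ q-1 (k ℕ.* q-1) ⟩
    sign q-1 * sign (k ℕ.* q-1)   ≈⟨ *-cong (trans (sym (B-[q-1] q-1 (ℕ.n<1+n q-1))) (B-diagonal q-1)) (sign-*[q-1] k) ⟩
    1# * 1#                       ≈⟨ *-identityˡ 1# ⟩
    1#                            ∎

  B-symmetric : ∀ k k′ {m} → k ℕ.+ k′ ≡ m → B m k ≈ B m k′
  B-symmetric k k′ ≡.refl = ×-congˡ (≡.trans (nCk≡nC[n∸k] (ℕ.m≤m+n k k′)) (≡.cong ((k ℕ.+ k′) C_) (ℕ.m+n∸m≡n k k′)))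

  -- The entries of M

  last : Fin (suc (suc j))
  last = fromℕ (suc j)

  ε η : Carrier
  ε = sgn j
  η = sgn (suc j)

  η≈-ε : η ≈ - ε
  η≈-ε = sign-suc j

  w : Fin (suc (suc j)) → Carrier
  w b = sgn (toℕ b) * binom (suc j) (toℕ b)

  w-first : w zero ≈ 1#
  w-first = trans (*-identityˡ (binom (suc j) 0)) (B-zero (suc j))

  w-last : w last ≈ η
  w-last = trans (reflexive (≡.cong (λ k → sgn k * binom (suc j) k) (toℕ-fromℕ (suc j))))
    (trans (*-congˡ (B-diagonal (suc j))) (*-identityʳ η))

  -- Symmetry of the binomials, together with b + b′ = j + 1 for the signs. This makes φ invariant
  -- under A.
  w-opposite : ∀ b → w (opposite b) ≈ η * w b
  w-opposite b = begin
    sgn b′ * binom (suc j) b′          ≈⟨ *-cong sgn-b′ (sym (B-symmetric b₀ b′ {suc j} b+b′)) ⟩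
    η * sgn b₀ * binom (suc j) b₀      ≈⟨ *-assoc η (sgn b₀) (binom (suc j) b₀) ⟩
    η * w b                            ∎
    where
    b₀ = toℕ b
    b′ = toℕ (opposite b)
    b+b′ = toℕ+toℕ-opposite b
    sgn-b′ : sgn b′ ≈ η * sgn b₀
    sgn-b′ = begin
      sgn b′                         ≈⟨ *-identityʳ _ ⟨
      sgn b′ * 1#                    ≈⟨ *-congˡ (sign*sign b₀) ⟨
      sgn b′ * (sgn b₀ * sgn b₀)     ≈⟨ solve 2 (λ x y → x :* (y :* y) := y :* x :* y) refl (sgn b′) (sgn b₀) ⟩
      sgn b₀ * sgn b′ * sgn b₀       ≈⟨ *-congʳ (sign-+ b₀ b′) ⟨
      sgn (b₀ ℕ.+ b′) * sgn b₀       ≡⟨ ≡.cong (λ k → sgn k * sgn b₀) b+b′ ⟩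
      η * sgn b₀                     ∎

  -- The building block of M: off the diagonal M a b is -(G a b′ + η G a b) with b′ = opposite b,
  -- and M a a is ε G a a.
  G : Fin (suc (suc j)) → Fin (suc (suc j)) → Carrier
  G a b = binom (idx (opposite a)) (idx b)

  G≡B : ∀ {a b x y} → toℕ (opposite a) ≡ x → toℕ b ≡ y → G a b ≡ B (j ℕ.+ x ℕ.* q-1) (j ℕ.+ y ℕ.* q-1)
  G≡B ≡.refl ≡.refl = ≡.refl

  G-first : ∀ b b′ → toℕ b ℕ.+ b′ ≡ j → G zero b ≈ B j (toℕ b) * sgn b′
  G-first b b′ e = trans (reflexive (G≡B {zero} {b} (toℕ-fromℕ (suc j)) ≡.refl)) (B-first-row j<q-1 (toℕ b) b′ e)

  G-suc-≡ : ∀ i → G (suc i) (opposite (suc i)) ≈ 1#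
  G-suc-≡ i = B-diagonal (idx (opposite (suc i)))

  -- Below the first row the upper index has an ordinary digit expansion. The columns b ≤ j are the
  -- inner case of Lucas' theorem, and b = j + 1 is the last column.
  G-suc-≢ : ∀ i b → b ≢ opposite (suc i) → G (suc i) b ≈ 0#
  G-suc-≢ i b b≢ with toℕ b ℕ.≤? j
  ... | yes b≤j = trans (reflexive (G≡B {suc i} {b} (opposite-suc i) ≡.refl))
    (B-inner-≢ j<q-1 (toℕ i) (toℕ (opposite i)) (toℕ+toℕ-opposite i) (toℕ b) (j ℕ.∸ toℕ b) (ℕ.m+[n∸m]≡n b≤j)
      (λ e → b≢ (toℕ-injective (≡.trans e (≡.sym (opposite-suc i))))))
  ... | no b≰j = trans (reflexive (G≡B {suc i} {b} (opposite-suc i) (ℕ.≤-antisym (toℕ≤pred[n] b) (ℕ.≰⇒> b≰j))))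
    (B-last-column j<q-1 (toℕ i) (toℕ (opposite i)) (toℕ+toℕ-opposite i))

  -- The sign ε is included here: this is ε times the exchange matrix.
  J : Matrix (suc (suc j))
  J = antidiag (λ _ → ε)

  -- In the last column both sides are ε - ε. In the other columns symmetry aligns the two
  -- binomials, and Pascal's rule merges C(j, b) and C(j, b + 1); this is how the upper index j + 1
  -- of `w` arises.
  M-entry-first : ∀ b → M zero (suc b) ≈ J zero (suc b) + w (suc b)
  M-entry-first b with toℕ (opposite b) in b′≡
  ... | zero = begin
    - (G zero (opposite (suc b)) + η * G zero (suc b))
      ≈⟨ -‿cong (+-cong (G-first (opposite (suc b)) j (≡.cong (ℕ._+ j) opposite≡0)) (*-congˡ (trans
           (reflexive (G≡B {zero} {suc b} (toℕ-fromℕ (suc j)) (≡.cong suc b≡j))) (B-diagonal (j ℕ.+ suc j ℕ.* q-1))))) ⟩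
    - (B j (toℕ (opposite (suc b))) * sgn j + η * 1#)
      ≈⟨ -‿cong (+-cong (*-congʳ (trans (reflexive (≡.cong (B j) opposite≡0)) (B-zero j))) (*-congʳ η≈-ε)) ⟩
    - (1# * ε + - ε * 1#)
      ≈⟨ solve 2 (λ o e → :- (o :* e :+ :- e :* o) := e :- e) refl 1# ε ⟩
    ε - ε
      ≈⟨ +-cong (reflexive (≡.sym (if-yes (zero ≟ opposite (suc b)) (≡.sym (toℕ-injective opposite≡0))))) (sym (trans w≈η η≈-ε)) ⟩
    J zero (suc b) + w (suc b) ∎
    where
    opposite≡0 : toℕ (opposite (suc b)) ≡ 0
    opposite≡0 = ≡.trans (opposite-suc b) b′≡
    b≡j : toℕ b ≡ j
    b≡j = ≡.trans (≡.sym (ℕ.+-identityʳ _)) (≡.trans (≡.cong (toℕ b ℕ.+_) (≡.sym b′≡)) (toℕ+toℕ-opposite b))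
    w≈η : w (suc b) ≈ η
    w≈η = trans (reflexive (≡.cong (λ k → sgn (suc k) * binom (suc j) (suc k)) b≡j))
      (trans (*-congˡ (B-diagonal (suc j))) (*-identityʳ η))
  ... | suc c = begin
    - (G zero (opposite (suc b)) + η * G zero (suc b))
      ≈⟨ -‿cong (+-cong (trans (G-first (opposite (suc b)) b₀ (≡.trans (ℕ.+-comm _ b₀) (≡.trans (≡.cong (b₀ ℕ.+_) (opposite-suc b)) (toℕ+toℕ-opposite b))))
                               (*-congʳ (sym (B-symmetric b₀ _ (≡.trans (≡.cong (b₀ ℕ.+_) (opposite-suc b)) (toℕ+toℕ-opposite b))))))
                        (*-congˡ (G-first (suc b) c b+c))) ⟩
    - (B j b₀ * sgn b₀ + η * (B j (suc b₀) * sgn c))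
      ≈⟨ -‿cong (+-congˡ (*-congʳ η≈)) ⟩
    - (B j b₀ * sgn b₀ + sgn b₀ * sgn c * (B j (suc b₀) * sgn c))
      ≈⟨ solve 4 (λ x y s z → :- (x :* s :+ s :* z :* (y :* z)) := :- s :* (x :+ z :* z :* y)) refl (B j b₀) (B j (suc b₀)) (sgn b₀) (sgn c) ⟩
    - sgn b₀ * (B j b₀ + sgn c * sgn c * B j (suc b₀))
      ≈⟨ *-cong (sym (sign-suc b₀)) (trans (+-congˡ (trans (*-congʳ (sign*sign c)) (*-identityˡ _))) (sym (B-pascal j b₀))) ⟩
    w (suc b)
      ≈⟨ +-identityˡ (w (suc b)) ⟨
    0# + w (suc b)
      ≈⟨ +-congʳ (reflexive (≡.sym (if-no (zero ≟ opposite (suc b)) 0≢opposite))) ⟩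
    J zero (suc b) + w (suc b) ∎
    where
    b₀ = toℕ b
    b+c : suc b₀ ℕ.+ c ≡ j
    b+c = ≡.trans (≡.sym (ℕ.+-suc b₀ c)) (≡.trans (≡.cong (b₀ ℕ.+_) (≡.sym b′≡)) (toℕ+toℕ-opposite b))
    0≢opposite : zero ≢ opposite (suc b)
    0≢opposite e with ≡.trans (≡.cong toℕ e) (≡.trans (opposite-suc b) b′≡)
    ... | ()
    η≈ : η ≈ sgn b₀ * sgn c
    η≈ = begin
      sgn (suc j)                  ≡⟨ ≡.cong (λ k → sgn (suc k)) b+c ⟨
      sgn (suc (suc (b₀ ℕ.+ c)))   ≈⟨ sign-suc (suc (b₀ ℕ.+ c)) ⟩
      - sgn (suc (b₀ ℕ.+ c))       ≈⟨ -‿cong (sign-suc (b₀ ℕ.+ c)) ⟩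
      - - sgn (b₀ ℕ.+ c)           ≈⟨ -‿involutive _ ⟩
      sgn (b₀ ℕ.+ c)               ≈⟨ sign-+ b₀ c ⟩
      sgn b₀ * sgn c               ∎

  -- Below the first row, G a b′ vanishes for a ≠ b. What remains is -η G a b = ε G a b, the same
  -- expression as in the definition on the diagonal.
  M-entry : ∀ a b → M a b ≈ J a b + unit zero a * w b
  M-entry zero zero = begin
    ε * G zero zero                   ≈⟨ *-congˡ (G-first zero j ≡.refl) ⟩
    ε * (B j 0 * ε)                   ≈⟨ *-congˡ (trans (*-congʳ (B-zero j)) (*-identityˡ ε)) ⟩
    ε * ε                             ≈⟨ sign*sign j ⟩
    1#                                ≈⟨ w-first ⟨
    w zero                            ≈⟨ *-identityˡ (w zero) ⟨
    1# * w zero                       ≈⟨ +-identityˡ (1# * w zero) ⟨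
    J zero zero + 1# * w zero         ∎
  M-entry zero (suc b) = trans (M-entry-first b) (+-congˡ (sym (*-identityˡ (w (suc b)))))
  M-entry (suc i) b = trans (row (suc i ≟ b)) (sym (trans (+-congˡ (zeroˡ (w b))) (+-identityʳ (J (suc i) b))))
    where
    row : Dec (suc i ≡ b) → M (suc i) b ≈ J (suc i) b
    row (yes ≡.refl) = trans (reflexive (if-yes (suc i ≟ suc i) ≡.refl)) (diagonal (suc i ≟ opposite (suc i)))
      where
      diagonal : Dec (suc i ≡ opposite (suc i)) → ε * G (suc i) (suc i) ≈ J (suc i) (suc i)
      diagonal (yes e) = trans (*-congˡ (trans (reflexive (≡.cong (G (suc i)) e)) (G-suc-≡ i)))
        (trans (*-identityʳ ε) (reflexive (≡.sym (if-yes (suc i ≟ opposite (suc i)) e))))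
      diagonal (no ne) = trans (*-congˡ (G-suc-≢ i (suc i) ne))
        (trans (zeroʳ ε) (reflexive (≡.sym (if-no (suc i ≟ opposite (suc i)) ne))))
    row (no a≢b) = begin
      M (suc i) b
        ≡⟨ if-no (suc i ≟ b) a≢b ⟩
      - (G (suc i) (opposite b) + η * G (suc i) b)
        ≈⟨ -‿cong (+-cong (G-suc-≢ i (opposite b) (λ e → a≢b (≡.trans (opposite-flip {b = suc i} e) (opposite-involutive b)))) (*-congʳ η≈-ε)) ⟩
      - (0# + - ε * G (suc i) b)
        ≈⟨ solve 2 (λ e g → :- (con ℤ.0ℤ :+ :- e :* g) := e :* g) refl ε (G (suc i) b) ⟩
      ε * G (suc i) b
        ≈⟨ offDiagonal (suc i ≟ opposite b) ⟩
      J (suc i) b ∎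
      where
      offDiagonal : Dec (suc i ≡ opposite b) → ε * G (suc i) b ≈ J (suc i) b
      offDiagonal (yes e) = trans (*-congˡ (trans (reflexive (≡.cong (G (suc i)) (opposite-flip {a = suc i} {b = b} e))) (G-suc-≡ i)))
        (trans (*-identityʳ ε) (reflexive (≡.sym (if-yes (suc i ≟ opposite b) e))))
      offDiagonal (no ne) = trans (*-congˡ (G-suc-≢ i b (ne ∘ opposite-flip)))
        (trans (zeroʳ ε) (reflexive (≡.sym (if-no (suc i ≟ opposite b) ne))))

  -- M, T, F and MD as operators on coordinate vectors

  Vector : Set
  Vector = Fin (suc (suc j)) → Carrier

  e₀ : Vector
  e₀ = unit zero

  Dx : Vector → Vector
  Dx x a = t ^ s a * x a

  φ ψ : Vector → Carrier
  φ x = dot w x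
  ψ x = φ (Dx x)

  φ-cong : ∀ x y → x ≋ y → φ x ≈ φ y
  φ-cong x y = dot-congˡ w {x} {y}

  Dx-cong : ∀ x y → x ≋ y → Dx x ≋ Dx y
  Dx-cong x y x≋y a = *-congˡ (x≋y a)

  η*η : η * η ≈ 1#
  η*η = sign*sign (suc j)

  ε≈-η : ε ≈ - η
  ε≈-η = sym (trans (-‿cong η≈-ε) (-‿involutive ε))

  ε*η : ∀ x → ε * (η * x) ≈ - x
  ε*η x = begin
    ε * (η * x)       ≈⟨ *-congʳ ε≈-η ⟩
    - η * (η * x)     ≈⟨ solve 2 (λ h x → :- h :* (h :* x) := :- (h :* h) :* x) refl η x ⟩
    - (η * η) * x     ≈⟨ *-congʳ (-‿cong η*η) ⟩
    - 1# * x          ≈⟨ -1*x≈-x x ⟩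
    - x               ∎

  η≉0 : η ≉ 0#
  η≉0 η≈0 = 1≉0 (trans (sym η*η) (trans (*-congʳ η≈0) (zeroˡ η)))

  A-*ᵥ : ∀ x a → (A *ᵥ x) a ≈ η * x (opposite a)
  A-*ᵥ x a = antidiag-*ᵥ (λ _ → η) x a

  D-*ᵥ : ∀ x → D *ᵥ x ≋ Dx x
  D-*ᵥ x a = diag-*ᵥ (λ a → t ^ s a) x a

  M-*ᵥ : ∀ x a → (M *ᵥ x) a ≈ ε * x (opposite a) + e₀ a * φ x
  M-*ᵥ x a = begin
    (M *ᵥ x) a
      ≈⟨ dot-cong {w = M a} {w′ = J a ⊕ scaled (e₀ a) w} {x = x} (M-entry a) (λ _ → refl) ⟩
    dot (J a ⊕ scaled (e₀ a) w) x                  ≈⟨ dot-⊕ˡ (J a) (scaled (e₀ a) w) x ⟩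
    (J *ᵥ x) a + dot (scaled (e₀ a) w) x           ≈⟨ +-cong (antidiag-*ᵥ (λ _ → ε) x a) (dot-scaledˡ w (e₀ a) x) ⟩
    ε * x (opposite a) + e₀ a * φ x                ∎

  φ-A : ∀ x → φ (A *ᵥ x) ≈ φ x
  φ-A x = begin
    φ (A *ᵥ x)                                         ≈⟨ dot-opposite w (A *ᵥ x) ⟩
    dot (w ∘ opposite) ((A *ᵥ x) ∘ opposite)
      ≈⟨ dot-cong {w = w ∘ opposite} {w′ = scaled η w} w-opposite (λ a → trans (A-*ᵥ x (opposite a)) (*-congˡ (reflexive (≡.cong x (opposite-involutive a))))) ⟩
    dot (scaled η w) (scaled η x)
      ≈⟨ trans (dot-scaledˡ w η (scaled η x)) (*-congˡ (dot-scaledʳ w η x)) ⟩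
    η * (η * φ x)                                      ≈⟨ *-assoc _ _ _ ⟨
    η * η * φ x                                        ≈⟨ trans (*-congʳ η*η) (*-identityˡ _) ⟩
    φ x                                                ∎

  MA-*ᵥ : ∀ x a → ((M *ᴹ A) *ᵥ x) a ≈ - x a + e₀ a * φ x
  MA-*ᵥ x a = begin
    ((M *ᴹ A) *ᵥ x) a                                   ≈⟨ *ᴹ-*ᵥ M A x a ⟩
    (M *ᵥ (A *ᵥ x)) a                                   ≈⟨ M-*ᵥ (A *ᵥ x) a ⟩
    ε * (A *ᵥ x) (opposite a) + e₀ a * φ (A *ᵥ x)
      ≈⟨ +-cong (*-congˡ (trans (A-*ᵥ x (opposite a)) (*-congˡ (reflexive (≡.cong x (opposite-involutive a)))))) (*-congˡ (φ-A x)) ⟩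
    ε * (η * x a) + e₀ a * φ x                          ≈⟨ +-congʳ (ε*η (x a)) ⟩
    - x a + e₀ a * φ x                                  ∎

  T-*ᵥ : ∀ x a → (T *ᵥ x) a ≈ e₀ a * φ x
  T-*ᵥ x a = begin
    (T *ᵥ x) a                            ≈⟨ +ᴹ-*ᵥ 1ᴹ (M *ᴹ A) x a ⟩
    (1ᴹ *ᵥ x) a + ((M *ᴹ A) *ᵥ x) a       ≈⟨ +-cong (1ᴹ-*ᵥ x a) (MA-*ᵥ x a) ⟩
    x a + (- x a + e₀ a * φ x)            ≈⟨ solve 2 (λ x y → x :+ (:- x :+ y) := y) refl (x a) (e₀ a * φ x) ⟩
    e₀ a * φ x                            ∎

  MD-*ᵥ : ∀ x a → ((M *ᴹ D) *ᵥ x) a ≈ ε * Dx x (opposite a) + e₀ a * ψ x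
  MD-*ᵥ x a = begin
    ((M *ᴹ D) *ᵥ x) a                        ≈⟨ *ᴹ-*ᵥ M D x a ⟩
    (M *ᵥ (D *ᵥ x)) a                        ≈⟨ *ᵥ-cong M {D *ᵥ x} (D-*ᵥ x) a ⟩
    (M *ᵥ Dx x) a                            ≈⟨ M-*ᵥ (Dx x) a ⟩
    ε * Dx x (opposite a) + e₀ a * ψ x       ∎

  -- All exponents are j + 1 modulo q - 1, so the sign does not depend on `b`.
  [-t]^s : ∀ b → (- t) ^ s b ≈ η * t ^ s b
  [-t]^s b = begin
    (- t) ^ s b                                      ≈⟨ ^-congˡ (s b) (-1*x≈-x t) ⟨
    (- 1# * t) ^ s b                                 ≈⟨ ^-distrib-* (- 1#) t (s b) ⟩
    sgn (suc j ℕ.+ toℕ b ℕ.* q-1) * t ^ s b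
      ≈⟨ *-congʳ (trans (sign-+ (suc j) (toℕ b ℕ.* q-1)) (trans (*-congˡ (sign-*[q-1] (toℕ b))) (*-identityʳ η))) ⟩
    η * t ^ s b                                      ∎

  F-*ᵥ : ∀ x a → (F *ᵥ x) a ≈ η * Dx x (opposite a)
  F-*ᵥ x a = begin
    (F *ᵥ x) a                                       ≈⟨ antidiag-*ᵥ (λ b → (- t) ^ s b) x a ⟩
    (- t) ^ s (opposite a) * x (opposite a)          ≈⟨ *-congʳ ([-t]^s (opposite a)) ⟩
    η * t ^ s (opposite a) * x (opposite a)          ≈⟨ *-assoc _ _ _ ⟩
    η * Dx x (opposite a)                            ∎

  φ-F : ∀ x → φ (F *ᵥ x) ≈ ψ x
  φ-F x = trans (φ-cong (F *ᵥ x) (A *ᵥ Dx x) (λ a → trans (F-*ᵥ x a) (sym (A-*ᵥ (Dx x) a)))) (φ-A (Dx x))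

  MD≋ : ∀ x → (M *ᴹ D) *ᵥ x ≋ scaled (- 1#) (F *ᵥ x) ⊕ scaled (ψ x) e₀
  MD≋ x a = trans (MD-*ᵥ x a) (+-cong (sym (trans (-1*x≈-x _) (trans (-‿cong (F-*ᵥ x a))
    (trans (-‿distribˡ-* _ _) (*-congʳ (sym ε≈-η)))))) (*-comm _ _))

  F+MD-*ᵥ : ∀ x a → ((F +ᴹ M *ᴹ D) *ᵥ x) a ≈ e₀ a * ψ x
  F+MD-*ᵥ x a = begin
    ((F +ᴹ M *ᴹ D) *ᵥ x) a                                     ≈⟨ +ᴹ-*ᵥ F (M *ᴹ D) x a ⟩
    (F *ᵥ x) a + ((M *ᴹ D) *ᵥ x) a                             ≈⟨ +-congˡ (MD≋ x a) ⟩
    (F *ᵥ x) a + (- 1# * (F *ᵥ x) a + ψ x * e₀ a)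
      ≈⟨ solve 3 (λ f p e → f :+ (:- con ℤ.1ℤ :* f :+ p :* e) := e :* p) refl ((F *ᵥ x) a) (ψ x) (e₀ a) ⟩
    e₀ a * ψ x                                                 ∎

  -- μ is t^k, because the first and last exponents add up to 2j + 2 + (n - 1)(q - 1).
  τ σ μ : Carrier
  τ = t ^ s zero
  σ = t ^ s last
  μ = τ * σ

  t^s-pair : ∀ a → t ^ s a * t ^ s (opposite a) ≈ μ
  t^s-pair a = trans (sym (^-homo-* t (s a) (s (opposite a))))
    (trans (^-congʳ t (exponent (toℕ a) (toℕ (opposite a)) (toℕ last)
              (≡.trans (toℕ+toℕ-opposite a) (≡.sym (toℕ-fromℕ (suc j))))))
           (^-homo-* t (s zero) (s last)))
    where
    exponent : ∀ x y z → x ℕ.+ y ≡ z →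
      suc (j ℕ.+ x ℕ.* q-1) ℕ.+ suc (j ℕ.+ y ℕ.* q-1) ≡ suc (j ℕ.+ 0 ℕ.* q-1) ℕ.+ suc (j ℕ.+ z ℕ.* q-1)
    exponent x y _ ≡.refl = solve′ 4 (λ j x y q →
      (con′ 1 :+′ (j :+′ x :*′ q)) :+′ (con′ 1 :+′ (j :+′ y :*′ q)) :=′
      (con′ 1 :+′ (j :+′ con′ 0 :*′ q)) :+′ (con′ 1 :+′ (j :+′ (x :+′ y) :*′ q))) ≡.refl j x y q-1
      where
      open +-*-Solver using () renaming (solve to solve′; _:+_ to _:+′_; _:*_ to _:*′_; _:=_ to _:=′_; con to con′)

  μ≉0 : μ ≉ 0#
  μ≉0 = *-≉0 (^-≉0 t≉0 (s zero)) (^-≉0 t≉0 (s last))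

  F-F : ∀ x → F *ᵥ (F *ᵥ x) ≋ scaled μ x
  F-F x a = begin
    (F *ᵥ (F *ᵥ x)) a                                          ≈⟨ F-*ᵥ (F *ᵥ x) a ⟩
    η * (t ^ s a′ * (F *ᵥ x) a′)                               ≈⟨ *-congˡ (*-congˡ (F-*ᵥ x a′)) ⟩
    η * (t ^ s a′ * (η * Dx x (opposite a′)))
      ≈⟨ *-congˡ (*-congˡ (*-congˡ (reflexive (≡.cong (Dx x) (opposite-involutive a))))) ⟩
    η * (t ^ s a′ * (η * (t ^ s a * x a)))
      ≈⟨ solve 4 (λ h u u′ x → h :* (u′ :* (h :* (u :* x))) := h :* h :* (u :* u′) :* x) refl η (t ^ s a) (t ^ s a′) (x a) ⟩
    η * η * (t ^ s a * t ^ s a′) * x a                         ≈⟨ *-congʳ (trans (*-cong η*η (t^s-pair a)) (*-identityˡ μ)) ⟩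
    μ * x a                                                    ∎
    where a′ = opposite a

  τ-σ≉0 : τ - σ ≉ 0#
  τ-σ≉0 = ≡.subst (λ k → t ^ s zero - t ^ k ≉ 0#) (≡.sym exponent) (t^-distinct (s zero) d)
    where
    -- `t^-distinct` expects the gap between the exponents as a successor; here the gap is (j + 1)(q
    -- - 1) > 0.
    d = ℕ.pred (suc j ℕ.* q-1)
    exponent : s last ≡ s zero ℕ.+ suc d
    exponent = ≡.trans (≡.cong (λ k → suc (j ℕ.+ k ℕ.* q-1)) (toℕ-fromℕ (suc j)))
      (≡.trans (≡.cong (λ k → suc (j ℕ.+ k)) (≡.sym (ℕ.suc-pred (suc j ℕ.* q-1) {{ℕ.m*n≢0 (suc j) q-1 {{_}} {{ℕ.>-nonZero (ℕ.≤-<-trans ℕ.z≤n j<q-1)}}}})))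
        (≡.cong (λ k → suc (k ℕ.+ suc d)) (≡.sym (ℕ.+-identityʳ j))))

  e₀-≡ : ∀ c → e₀ zero * c ≈ c
  e₀-≡ c = *-identityˡ c

  e₀-≢ : ∀ {a} c → a ≢ zero → e₀ a * c ≈ 0#
  e₀-≢ c a≢0 = trans (*-congʳ (unit-≢ a≢0)) (zeroˡ c)

  φ-e₀ : φ e₀ ≈ 1#
  φ-e₀ = trans (dot-unitʳ w zero) w-first

  -- The antidiagonal part contributes -ψ(x), and the first-row part contributes ψ(x) because φ(e₀)
  -- = 1.
  φ-MD : ∀ x → φ ((M *ᴹ D) *ᵥ x) ≈ 0#
  φ-MD x = begin
    φ ((M *ᴹ D) *ᵥ x)                                         ≈⟨ φ-cong ((M *ᴹ D) *ᵥ x) (y₁ ⊕ y₂) (MD≋ x) ⟩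
    φ (y₁ ⊕ y₂)                                               ≈⟨ dot-⊕ʳ w y₁ y₂ ⟩
    φ y₁ + φ y₂
      ≈⟨ +-cong (trans (dot-scaledʳ w (- 1#) (F *ᵥ x)) (*-congˡ (φ-F x))) (trans (dot-scaledʳ w (ψ x) e₀) (*-congˡ φ-e₀)) ⟩
    - 1# * ψ x + ψ x * 1#
      ≈⟨ solve 1 (λ y → :- con ℤ.1ℤ :* y :+ y :* con ℤ.1ℤ := con ℤ.0ℤ) refl (ψ x) ⟩
    0#                                                        ∎
    where
    y₁ = scaled (- 1#) (F *ᵥ x)
    y₂ = scaled (ψ x) e₀

  ψ-w : Vector
  ψ-w b = w b * t ^ s b

  ψ≈dot : ∀ x → ψ x ≈ dot ψ-w x
  ψ≈dot x = sym (sum-cong-≋ (λ b → *-assoc (w b) (t ^ s b) (x b)))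

  -- Here ψ(F x) = φ(F² x) = μ φ(x) and ψ(e₀) = τ. Since μ = τσ, subtracting σφ from ψ yields an
  -- eigenfunctional for τ.
  ψ-MD : ∀ x → ψ ((M *ᴹ D) *ᵥ x) ≈ τ * ψ x - μ * φ x
  ψ-MD x = begin
    ψ ((M *ᴹ D) *ᵥ x)
      ≈⟨ trans (φ-cong (Dx ((M *ᴹ D) *ᵥ x)) (Dx y) (Dx-cong ((M *ᴹ D) *ᵥ x) y (MD≋ x))) (ψ≈dot y) ⟩
    dot ψ-w y                                                 ≈⟨ dot-⊕ʳ ψ-w y₁ y₂ ⟩
    dot ψ-w y₁ + dot ψ-w y₂
      ≈⟨ +-cong (dot-scaledʳ ψ-w (- 1#) (F *ᵥ x)) (trans (dot-scaledʳ ψ-w (ψ x) e₀) (*-congˡ (trans (dot-unitʳ ψ-w zero) (trans (*-congʳ w-first) (*-identityˡ τ))))) ⟩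
    - 1# * dot ψ-w (F *ᵥ x) + ψ x * τ                         ≈⟨ +-congʳ (*-congˡ (begin
      dot ψ-w (F *ᵥ x)             ≈⟨ ψ≈dot (F *ᵥ x) ⟨
      ψ (F *ᵥ x)                   ≈⟨ φ-F (F *ᵥ x) ⟨
      φ (F *ᵥ (F *ᵥ x))            ≈⟨ φ-cong (F *ᵥ (F *ᵥ x)) (scaled μ x) (F-F x) ⟩
      φ (scaled μ x)               ≈⟨ dot-scaledʳ w μ x ⟩
      μ * φ x                      ∎)) ⟩
    - 1# * (μ * φ x) + ψ x * τ
      ≈⟨ solve 3 (λ mf p t → :- con ℤ.1ℤ :* mf :+ p :* t := t :* p :- mf) refl (μ * φ x) (ψ x) τ ⟩
    τ * ψ x - μ * φ x                                         ∎
    where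
    y₁ = scaled (- 1#) (F *ᵥ x)
    y₂ = scaled (ψ x) e₀
    y = y₁ ⊕ y₂

  -- The combination of φ and ψ not involving the last coordinate; it is an
  -- eigenfunctional of MD.
  χ-w : Vector
  χ-w = ψ-w ⊕ scaled (- σ) w

  χ : Vector → Carrier
  χ x = dot χ-w x

  χ≈ : ∀ x → χ x ≈ ψ x - σ * φ x
  χ≈ x = trans (dot-⊕ˡ ψ-w (scaled (- σ) w) x)
    (+-cong (sym (ψ≈dot x)) (trans (dot-scaledˡ w (- σ) x) (sym (-‿distribˡ-* σ (φ x)))))

  χ-MD : ∀ x → χ ((M *ᴹ D) *ᵥ x) ≈ τ * χ x
  χ-MD x = begin
    χ ((M *ᴹ D) *ᵥ x)                            ≈⟨ χ≈ ((M *ᴹ D) *ᵥ x) ⟩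
    ψ ((M *ᴹ D) *ᵥ x) - σ * φ ((M *ᴹ D) *ᵥ x)    ≈⟨ +-cong (ψ-MD x) (-‿cong (*-congˡ (φ-MD x))) ⟩
    τ * ψ x - τ * σ * φ x - σ * 0#
      ≈⟨ solve 4 (λ t s p f → t :* p :- t :* s :* f :- s :* con ℤ.0ℤ := t :* (p :- s :* f)) refl τ σ (ψ x) (φ x) ⟩
    τ * (ψ x - σ * φ x)                          ≈⟨ *-congˡ (χ≈ x) ⟨
    τ * χ x                                      ∎

  χ-w-first : χ-w zero ≉ 0#
  χ-w-first e = τ-σ≉0 (trans (sym (begin
    w zero * τ + - σ * w zero      ≈⟨ +-cong (*-congʳ w-first) (*-congˡ w-first) ⟩
    1# * τ + - σ * 1#              ≈⟨ +-cong (*-identityˡ τ) (*-identityʳ (- σ)) ⟩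
    τ - σ                          ∎)) e)

  χ-w-last : χ-w last ≈ 0#
  χ-w-last = solve 2 (λ w s → w :* s :+ :- s :* w := con ℤ.0ℤ) refl (w last) σ

  -- The coordinate change K

  -- `Paired` also leaves out the fixed point of `opposite`, which exists when n is odd and carries
  -- a 1 × 1 block.
  Middle Paired : Fin (suc (suc j)) → Set
  Middle a = a ≢ zero × a ≢ last
  Paired a = Middle a × a ≢ opposite a

  middle? : ∀ a → Dec (Middle a)
  middle? a = ¬? (a ≟ zero) ×-dec ¬? (a ≟ last)

  paired? : ∀ a → Dec (Paired a)
  paired? a = middle? a ×-dec ¬? (a ≟ opposite a)

  middle-opposite : ∀ {a} → Middle a → Middle (opposite a)
  middle-opposite {a} (a≢0 , a≢N) =
    (λ e → a≢N (opposite-flip {a = zero} {b = a} (≡.sym e))) ,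
    (λ e → a≢0 (≡.trans (opposite-flip {a = last} {b = a} (≡.sym e)) (opposite-involutive zero)))

  paired-opposite : ∀ {a} → Paired a → Paired (opposite a)
  paired-opposite {a} (m , a≢a′) = middle-opposite m , λ e → a≢a′ (≡.trans (≡.sym (opposite-involutive a)) (≡.sym e))

  ends-or-middle : ∀ a → a ≡ zero ⊎ a ≡ last ⊎ Middle a
  ends-or-middle a with a ≟ zero | a ≟ last
  ... | yes e | _     = inj₁ e
  ... | no _  | yes e = inj₂ (inj₁ e)
  ... | no h  | no h′ = inj₂ (inj₂ (h , h′))

  0≢last : zero ≢ last
  0≢last ()

  -- The last coordinate is replaced first. The functional χ does not see it, so χ keeps its meaning
  -- in the second replacement.
  Kₗ Kₑ K : Matrix (suc (suc j))
  Kₗ = replaceRow last w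
  Kₑ = replaceRow zero χ-w
  K = Kₑ *ᴹ Kₗ

  private
    w-last≉0 : w last ≉ 0#
    w-last≉0 e = η≉0 (trans (sym w-last) e)
    Kₗ-inverse = replaceRow-inverse last w w-last≉0
    Kₑ-inverse = replaceRow-inverse zero χ-w χ-w-first

  K⁻¹ : Matrix (suc (suc j))
  K⁻¹ = replaceRow last (proj₁ Kₗ-inverse) *ᴹ replaceRow zero (proj₁ Kₑ-inverse)

  K-inverse : K⁻¹ InverseOf K
  K-inverse = inverse-*ᴹ (proj₂ Kₑ-inverse) (proj₂ Kₗ-inverse)

  K-first : ∀ x → (K *ᵥ x) zero ≈ χ x
  K-first x = begin
    (K *ᵥ x) zero                                   ≈⟨ *ᴹ-*ᵥ Kₑ Kₗ x zero ⟩
    (Kₑ *ᵥ (Kₗ *ᵥ x)) zero                          ≈⟨ replaceRow-≡ zero χ-w (Kₗ *ᵥ x) ⟩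
    χ (Kₗ *ᵥ x)                                     ≈⟨ dot-update χ-w {x} {Kₗ *ᵥ x} last (replaceRow-≢ last w x) ⟩
    χ x + χ-w last * ((Kₗ *ᵥ x) last - x last)      ≈⟨ +-congˡ (trans (*-congʳ χ-w-last) (zeroˡ _)) ⟩
    χ x + 0#                                        ≈⟨ +-identityʳ _ ⟩
    χ x                                             ∎

  K-last : ∀ x → (K *ᵥ x) last ≈ φ x
  K-last x = begin
    (K *ᵥ x) last                                   ≈⟨ *ᴹ-*ᵥ Kₑ Kₗ x last ⟩
    (Kₑ *ᵥ (Kₗ *ᵥ x)) last                          ≈⟨ replaceRow-≢ zero χ-w (Kₗ *ᵥ x) last (0≢last ∘ ≡.sym) ⟩
    (Kₗ *ᵥ x) last                                  ≈⟨ replaceRow-≡ last w x ⟩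
    φ x                                             ∎

  K-middle : ∀ x a → Middle a → (K *ᵥ x) a ≈ x a
  K-middle x a (a≢0 , a≢N) = begin
    (K *ᵥ x) a                                      ≈⟨ *ᴹ-*ᵥ Kₑ Kₗ x a ⟩
    (Kₑ *ᵥ (Kₗ *ᵥ x)) a                             ≈⟨ replaceRow-≢ zero χ-w (Kₗ *ᵥ x) a a≢0 ⟩
    (Kₗ *ᵥ x) a                                     ≈⟨ replaceRow-≢ last w x a a≢N ⟩
    x a                                             ∎

  K⁻¹-middle : ∀ x a → Middle a → (K⁻¹ *ᵥ x) a ≈ x a
  K⁻¹-middle x a m = trans (sym (K-middle (K⁻¹ *ᵥ x) a m)) (inverseʳ K-inverse x a)

  χ-K⁻¹ : ∀ x → χ (K⁻¹ *ᵥ x) ≈ x zero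
  χ-K⁻¹ x = trans (sym (K-first (K⁻¹ *ᵥ x))) (inverseʳ K-inverse x zero)

  φ-K⁻¹ : ∀ x → φ (K⁻¹ *ᵥ x) ≈ x last
  φ-K⁻¹ x = trans (sym (K-last (K⁻¹ *ᵥ x))) (inverseʳ K-inverse x last)

  K-injective : ∀ x → χ x ≈ 0# → φ x ≈ 0# → (∀ a → Middle a → x a ≈ 0#) → x ≋ 0ᶠ
  K-injective x χ≈0 φ≈0 mid≈0 a = trans (sym (inverseˡ K-inverse x a)) (*ᵥ-zero K⁻¹ {K *ᵥ x} Kx≈0 a)
    where
    Kx≈0 : K *ᵥ x ≋ 0ᶠ
    Kx≈0 b with ends-or-middle b
    ... | inj₁ ≡.refl        = trans (K-first x) χ≈0
    ... | inj₂ (inj₁ ≡.refl) = trans (K-last x) φ≈0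
    ... | inj₂ (inj₂ m)      = trans (K-middle x b m) (mid≈0 b m)

  -- Old and new subspaces in coordinates

  NewCoordinates : Pred Vector _
  NewCoordinates x = φ x ≈ 0# × ψ x ≈ 0#

  χ≈0 : ∀ x → NewCoordinates x → χ x ≈ 0#
  χ≈0 x (φx , ψx) = trans (χ≈ x) (trans (+-cong ψx (trans (-‿cong (trans (*-congˡ φx) (zeroʳ σ))) -0#≈0#)) (+-identityˡ 0#))

  new-from-χ : ∀ x → χ x ≈ 0# → φ x ≈ 0# → NewCoordinates x
  new-from-χ x χx φx = φx , (begin
    ψ x                      ≈⟨ solve 3 (λ p s f → p := p :- s :* f :+ s :* f) refl (ψ x) σ (φ x) ⟩
    ψ x - σ * φ x + σ * φ x  ≈⟨ +-cong (trans (sym (χ≈ x)) χx) (trans (*-congˡ φx) (zeroʳ σ)) ⟩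
    0# + 0#                  ≈⟨ +-identityˡ 0# ⟩
    0#                       ∎)

  new-≋ : ∀ x y → x ≋ y → NewCoordinates x → NewCoordinates y
  new-≋ x y x≋y (φx , ψx) = trans (sym (φ-cong x y x≋y)) φx
                          , trans (sym (φ-cong (Dx x) (Dx y) (Dx-cong x y x≋y))) ψx

  Ker-T⇒ : ∀ x → Ker T x → φ x ≈ 0#
  Ker-T⇒ x h = trans (sym (e₀-≡ (φ x))) (trans (sym (T-*ᵥ x zero)) (h zero))

  ⇒Ker-T : ∀ x → φ x ≈ 0# → Ker T x
  ⇒Ker-T x h a = trans (T-*ᵥ x a) (trans (*-congˡ h) (zeroʳ (e₀ a)))

  Ker-F+MD⇒ : ∀ x → Ker (F +ᴹ M *ᴹ D) x → ψ x ≈ 0#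
  Ker-F+MD⇒ x h = trans (sym (e₀-≡ (ψ x))) (trans (sym (F+MD-*ᵥ x zero)) (h zero))

  ⇒Ker-F+MD : ∀ x → ψ x ≈ 0# → Ker (F +ᴹ M *ᴹ D) x
  ⇒Ker-F+MD x h a = trans (F+MD-*ᵥ x a) (trans (*-congˡ h) (zeroʳ (e₀ a)))

  Image-F⇒ : ∀ x → Image F (Ker T) x → ψ x ≈ 0#
  Image-F⇒ x (y , Ty , x≋Fy) = begin
    ψ x                        ≈⟨ φ-F x ⟨
    φ (F *ᵥ x)                 ≈⟨ φ-cong (F *ᵥ x) (F *ᵥ (F *ᵥ y)) (*ᵥ-cong F {x} x≋Fy) ⟩
    φ (F *ᵥ (F *ᵥ y))          ≈⟨ φ-cong (F *ᵥ (F *ᵥ y)) (scaled μ y) (F-F y) ⟩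
    φ (scaled μ y)             ≈⟨ dot-scaledʳ w μ y ⟩
    μ * φ y                    ≈⟨ trans (*-congˡ (Ker-T⇒ y Ty)) (zeroʳ μ) ⟩
    0#                         ∎

  ⇒Image-F : ∀ x → ψ x ≈ 0# → Image F (Ker T) x
  ⇒Image-F x h = y , ⇒Ker-T y φy , x≋Fy
    where
    -- From F² = μ, the inverse of F is μ⁻¹ F.
    y = scaled (μ ⁻¹) (F *ᵥ x)
    φy : φ y ≈ 0#
    φy = trans (dot-scaledʳ w (μ ⁻¹) (F *ᵥ x)) (trans (*-congˡ (trans (φ-F x) h)) (zeroʳ _))
    x≋Fy : x ≋ F *ᵥ y
    x≋Fy a = sym (begin
      (F *ᵥ y) a                  ≈⟨ *ᵥ-scaled F (μ ⁻¹) (F *ᵥ x) a ⟩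
      μ ⁻¹ * (F *ᵥ (F *ᵥ x)) a    ≈⟨ *-congˡ (F-F x a) ⟩
      μ ⁻¹ * (μ * x a)            ≈⟨ *-assoc _ _ _ ⟨
      μ ⁻¹ * μ * x a              ≈⟨ *-congʳ (trans (*-comm _ _) (*-inverseʳ μ≉0)) ⟩
      1# * x a                    ≈⟨ *-identityˡ (x a) ⟩
      x a                         ∎)

  new≐ : (Ker T ∩ Image F (Ker T)) ≐ NewCoordinates
  new≐ = (λ {x} (Tx , Fx) → Ker-T⇒ x Tx , Image-F⇒ x Fx) , (λ {x} (φx , ψx) → ⇒Ker-T x φx , ⇒Image-F x ψx)

  Ker-MA⇒ : ∀ x → Ker (M *ᴹ A) x → ∀ a → a ≢ zero → x a ≈ 0#
  Ker-MA⇒ x h a a≢0 = begin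
    x a                       ≈⟨ -‿involutive (x a) ⟨
    - - x a                   ≈⟨ -‿cong (+-identityʳ (- x a)) ⟨
    - (- x a + 0#)            ≈⟨ -‿cong (+-congˡ (e₀-≢ (φ x) a≢0)) ⟨
    - (- x a + e₀ a * φ x)    ≈⟨ -‿cong (trans (sym (MA-*ᵥ x a)) (h a)) ⟩
    - 0#                      ≈⟨ -0#≈0# ⟩
    0#                        ∎

  ⇒Ker-MA : ∀ x → (∀ a → a ≢ zero → x a ≈ 0#) → Ker (M *ᴹ A) x
  ⇒Ker-MA x h a = by (a ≟ zero)
    where
    by : Dec (a ≡ zero) → ((M *ᴹ A) *ᵥ x) a ≈ 0#
    by (no a≢0) = trans (MA-*ᵥ x a) (trans (+-cong (trans (-‿cong (h a a≢0)) -0#≈0#) (e₀-≢ (φ x) a≢0)) (+-identityˡ 0#))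
    by (yes ≡.refl) = begin
      ((M *ᴹ A) *ᵥ x) zero       ≈⟨ MA-*ᵥ x zero ⟩
      - x zero + e₀ zero * φ x   ≈⟨ +-congˡ (trans (e₀-≡ (φ x)) (dot-supported w {x} zero h)) ⟩
      - x zero + w zero * x zero ≈⟨ +-congˡ (trans (*-congʳ w-first) (*-identityˡ _)) ⟩
      - x zero + x zero          ≈⟨ -‿inverseˡ _ ⟩
      0#                         ∎

  ε≉0 : ε ≉ 0#
  ε≉0 e = η≉0 (trans η≈-ε (trans (-‿cong e) -0#≈0#))

  -- The row opposite to `a` is not the first one, so it contains the single term ε t^{s_a} xₐ.
  Ker-MD⇒ : ∀ x → Ker (M *ᴹ D) x → ∀ a → a ≢ last → x a ≈ 0#
  Ker-MD⇒ x h a a≢N = cancel-≉0 (^-≉0 t≉0 (s a)) (cancel-≉0 ε≉0 (begin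
    ε * Dx x a                               ≈⟨ *-congˡ (reflexive (≡.cong (Dx x) (opposite-involutive a))) ⟨
    ε * Dx x (opposite a′)                   ≈⟨ +-identityʳ _ ⟨
    ε * Dx x (opposite a′) + 0#              ≈⟨ +-congˡ (e₀-≢ (ψ x) a′≢0) ⟨
    ε * Dx x (opposite a′) + e₀ a′ * ψ x     ≈⟨ MD-*ᵥ x a′ ⟨
    ((M *ᴹ D) *ᵥ x) a′                       ≈⟨ h a′ ⟩
    0#                                       ∎))
    where
    a′ = opposite a
    a′≢0 : a′ ≢ zero
    a′≢0 e = a≢N (opposite-flip {a = zero} {b = a} (≡.sym e))

  ⇒Ker-MD : ∀ x → (∀ a → a ≢ last → x a ≈ 0#) → Ker (M *ᴹ D) x
  ⇒Ker-MD x h a = by (a ≟ zero)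
    where
    by : Dec (a ≡ zero) → ((M *ᴹ D) *ᵥ x) a ≈ 0#
    by (no a≢0) = trans (MD-*ᵥ x a) (trans (+-cong (trans (*-congˡ (trans (*-congˡ (h a′ a′≢N)) (zeroʳ _))) (zeroʳ ε)) (e₀-≢ (ψ x) a≢0)) (+-identityˡ 0#))
      where
      a′ = opposite a
      a′≢N : a′ ≢ last
      a′≢N e = a≢0 (≡.trans (opposite-flip {a = last} {b = a} (≡.sym e)) (opposite-involutive zero))
    by (yes ≡.refl) = begin
      ((M *ᴹ D) *ᵥ x) zero               ≈⟨ MD-*ᵥ x zero ⟩
      ε * Dx x last + e₀ zero * ψ x
        ≈⟨ +-congˡ (trans (e₀-≡ (ψ x)) (dot-supported w {Dx x} last (λ a a≢N → trans (*-congˡ (h a a≢N)) (zeroʳ _)))) ⟩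
      -- In the first row the antidiagonal entry ε is cancelled by the last coefficient η = -ε of
      -- `w`.
      ε * Dx x last + w last * Dx x last ≈⟨ +-congˡ (*-congʳ (trans w-last η≈-ε)) ⟩
      ε * Dx x last + - ε * Dx x last    ≈⟨ solve 2 (λ e d → e :* d :+ :- e :* d := con ℤ.0ℤ) refl ε (Dx x last) ⟩
      0#                                 ∎

  OldCoordinates : Pred Vector _
  OldCoordinates x = ∀ a → Middle a → x a ≈ 0#

  old≐ : (Ker (M *ᴹ A) +ˢ Ker (M *ᴹ D)) ≐ OldCoordinates
  old≐ = (λ {x} (f , g , f∈ , g∈ , x≋) a (a≢0 , a≢N) →
           trans (x≋ a) (trans (+-cong (Ker-MA⇒ f f∈ a a≢0) (Ker-MD⇒ g g∈ a a≢N)) (+-identityˡ 0#)))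
       , (λ {x} h → scaled (x zero) e₀ , scaled (x last) (unit last)
           , ⇒Ker-MA (scaled (x zero) e₀) (λ a a≢0 → trans (*-congˡ (unit-≢ a≢0)) (zeroʳ _))
           , ⇒Ker-MD (scaled (x last) (unit last)) (λ a a≢N → trans (*-congˡ (unit-≢ a≢N)) (zeroʳ _))
           , split x h)
    where
    split : ∀ x → OldCoordinates x → x ≋ scaled (x zero) e₀ ⊕ scaled (x last) (unit last)
    split x h a with ends-or-middle a
    ... | inj₁ ≡.refl        = sym (trans (+-cong (*-identityʳ _) (zeroʳ _)) (+-identityʳ _))
    ... | inj₂ (inj₁ ≡.refl) = sym (trans (+-cong (zeroʳ _) (trans (*-congˡ (unit-≡ last)) (*-identityʳ _))) (+-identityˡ _))
    ... | inj₂ (inj₂ m@(a≢0 , a≢N)) = trans (h a m) (sym (trans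
      (+-cong (trans (*-congˡ (unit-≢ a≢0)) (zeroʳ _)) (trans (*-congˡ (unit-≢ a≢N)) (zeroʳ _))) (+-identityˡ 0#)))

  old∩new : ∀ x → OldCoordinates x → NewCoordinates x → x ≋ 0ᶠ
  old∩new x h n = K-injective x (χ≈0 x n) (proj₁ n) h

  zero-old : ∀ x → x ≋ 0ᶠ → OldCoordinates x
  zero-old x h a _ = h a

  zero-new : ∀ x → x ≋ 0ᶠ → NewCoordinates x
  zero-new x h = dot-zeroʳ w {x} h , dot-zeroʳ w {Dx x} (λ a → trans (*-congˡ (h a)) (zeroʳ _))

  -- Split K x into its end and middle coordinates and pull both back. The first part stays zero in
  -- the middle, as K fixes the middle coordinates; on the second part χ and φ vanish.
  old+new : ∀ x → ∃₂ λ f g → OldCoordinates f × NewCoordinates g × x ≋ f ⊕ g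
  old+new x = K⁻¹ *ᵥ y₁ , K⁻¹ *ᵥ y₂
    , (λ a m → trans (K⁻¹-middle y₁ a m) (reflexive (if-yes (middle? a) m)))
    , new-from-χ (K⁻¹ *ᵥ y₂) (trans (χ-K⁻¹ y₂) (reflexive (if-no (middle? zero) {x = (K *ᵥ x) zero} (λ m → proj₁ m ≡.refl))))
                             (trans (φ-K⁻¹ y₂) (reflexive (if-no (middle? last) {x = (K *ᵥ x) last} (λ m → proj₂ m ≡.refl))))
    , λ a → begin
      x a                                  ≈⟨ inverseˡ K-inverse x a ⟨
      (K⁻¹ *ᵥ (K *ᵥ x)) a                  ≈⟨ *ᵥ-cong K⁻¹ {K *ᵥ x} {y₁ ⊕ y₂} Kx≋ a ⟩
      (K⁻¹ *ᵥ (y₁ ⊕ y₂)) a                 ≈⟨ *ᵥ-⊕ K⁻¹ y₁ y₂ a ⟩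
      (K⁻¹ *ᵥ y₁) a + (K⁻¹ *ᵥ y₂) a        ∎
    where
    y₁ y₂ : Vector
    y₁ a = if does (middle? a) then 0# else (K *ᵥ x) a
    y₂ a = if does (middle? a) then (K *ᵥ x) a else 0#
    Kx≋ : K *ᵥ x ≋ y₁ ⊕ y₂
    Kx≋ a with does (middle? a)
    ... | true  = sym (+-identityˡ _)
    ... | false = sym (+-identityʳ _)

  directSum : U isDirectSumOf (Ker (M *ᴹ A) +ˢ Ker (M *ᴹ D)) and (Ker T ∩ Image F (Ker T))
  directSum =
    ((λ {x} _ → let f , g , of , ng , e = old+new x in f , g , proj₂ old≐ of , proj₂ new≐ ng , e) , λ _ → tt)
    , (λ {x} (o , n) → old∩new x (proj₁ old≐ o) (proj₁ new≐ n))
    , (λ {x} h → proj₂ old≐ (zero-old x h) , proj₂ new≐ (zero-new x h))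

  Ker-MA∩Ker-MD : (Ker (M *ᴹ A) ∩ Ker (M *ᴹ D)) ≐ Zero
  Ker-MA∩Ker-MD = (λ {x} (f , g) a → vanish x f g a (a ≟ zero))
    , (λ {x} h → ⇒Ker-MA x (λ a _ → h a) , ⇒Ker-MD x (λ a _ → h a))
    where
    vanish : ∀ x → Ker (M *ᴹ A) x → Ker (M *ᴹ D) x → ∀ a → Dec (a ≡ zero) → x a ≈ 0#
    vanish x f g a (no a≢0)     = Ker-MA⇒ x f a a≢0
    vanish x f g a (yes ≡.refl) = Ker-MD⇒ x g zero 0≢last

  Ker-MA∩Ker-F+MD : (Ker (M *ᴹ A) ∩ Ker (F +ᴹ M *ᴹ D)) ≐ (Ker (M *ᴹ A) ∩ Image F (Ker T))
  Ker-MA∩Ker-F+MD = (λ {x} (f , g) → f , ⇒Image-F x (Ker-F+MD⇒ x g))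
                  , (λ {x} (f , g) → f , ⇒Ker-F+MD x (Image-F⇒ x g))

  Ker-MA∩Image-F : (Ker (M *ᴹ A) ∩ Image F (Ker T)) ≐ Zero
  Ker-MA∩Image-F = (λ {x} (f , g) a → vanish x f (Image-F⇒ x g) a (a ≟ zero))
    , (λ {x} h → ⇒Ker-MA x (λ a _ → h a) , ⇒Image-F x (proj₂ (zero-new x h)))
    where
    vanish : ∀ x → Ker (M *ᴹ A) x → ψ x ≈ 0# → ∀ a → Dec (a ≡ zero) → x a ≈ 0#
    vanish x f ψx a (no a≢0)     = Ker-MA⇒ x f a a≢0
    -- Since x is supported at the first index, ψ(x) is τ times its entry there.
    vanish x f ψx a (yes ≡.refl) = cancel-≉0 (^-≉0 t≉0 (s zero)) (begin
      Dx x zero            ≈⟨ trans (*-congʳ w-first) (*-identityˡ _) ⟨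
      w zero * Dx x zero   ≈⟨ dot-supported w {Dx x} zero (λ b b≢0 → trans (*-congˡ (Ker-MA⇒ x f b b≢0)) (zeroʳ _)) ⟨
      ψ x                  ≈⟨ ψx ⟩
      0#                   ∎)

  -- Diagonalizability of MD

  -- κ holds the antidiagonal entries of MD by row. ν holds the eigenvalue τ of χ, the eigenvalue 0
  -- of φ, and, at a fixed point of `opposite`, the antidiagonal entry that lies on the diagonal.
  κ ν : Vector
  κ a = ε * t ^ s (opposite a)
  ν a = if does (a ≟ zero) then τ else if does (a ≟ last) then 0# else ε * t ^ s a

  κκ : ∀ a → κ a * κ (opposite a) ≈ μ
  κκ a = begin
    ε * t ^ s a′ * (ε * t ^ s (opposite a′))
      ≈⟨ solve 3 (λ e x y → e :* x :* (e :* y) := e :* e :* (x :* y)) refl ε (t ^ s a′) (t ^ s (opposite a′)) ⟩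
    ε * ε * (t ^ s a′ * t ^ s (opposite a′))    ≈⟨ *-cong (sign*sign j) (t^s-pair a′) ⟩
    1# * μ                                      ≈⟨ *-identityˡ μ ⟩
    μ                                           ∎
    where a′ = opposite a

  N : Matrix (suc (suc j))
  N = blocks paired? paired-opposite 0ᶠ κ ν

  MD-middle : ∀ x a → Middle a → ((M *ᴹ D) *ᵥ x) a ≈ κ a * x (opposite a)
  MD-middle x a (a≢0 , _) = trans (MD-*ᵥ x a) (trans (+-congˡ (e₀-≢ (ψ x) a≢0)) (trans (+-identityʳ _) (sym (*-assoc _ _ _))))

  -- The end rows are the eigenfunctional properties of χ and φ. The middle rows of MD involve only
  -- middle coordinates, which K does not change.
  K-MD : ∀ x → K *ᵥ ((M *ᴹ D) *ᵥ x) ≋ N *ᵥ (K *ᵥ x)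
  K-MD x a with ends-or-middle a
  ... | inj₁ ≡.refl = begin
    (K *ᵥ ((M *ᴹ D) *ᵥ x)) zero     ≈⟨ K-first ((M *ᴹ D) *ᵥ x) ⟩
    χ ((M *ᴹ D) *ᵥ x)               ≈⟨ χ-MD x ⟩
    τ * χ x                         ≈⟨ *-congˡ (K-first x) ⟨
    τ * (K *ᵥ x) zero
      ≈⟨ blocks-unpaired paired? paired-opposite 0ᶠ κ ν (K *ᵥ x) zero (λ h → proj₁ (proj₁ h) ≡.refl) ⟨
    (N *ᵥ (K *ᵥ x)) zero            ∎
  ... | inj₂ (inj₁ ≡.refl) = begin
    (K *ᵥ ((M *ᴹ D) *ᵥ x)) last     ≈⟨ K-last ((M *ᴹ D) *ᵥ x) ⟩
    φ ((M *ᴹ D) *ᵥ x)               ≈⟨ φ-MD x ⟩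
    0#                              ≈⟨ zeroˡ _ ⟨
    0# * (K *ᵥ x) last              ≈⟨ *-congʳ (reflexive (if-yes (last ≟ last) ≡.refl)) ⟨
    ν last * (K *ᵥ x) last
      ≈⟨ blocks-unpaired paired? paired-opposite 0ᶠ κ ν (K *ᵥ x) last (λ h → proj₂ (proj₁ h) ≡.refl) ⟨
    (N *ᵥ (K *ᵥ x)) last            ∎
  ... | inj₂ (inj₂ m@(a≢0 , a≢N)) = trans (K-middle ((M *ᴹ D) *ᵥ x) a m) (trans (MD-middle x a m)
    (trans (*-congˡ (sym (K-middle x (opposite a) (middle-opposite m)))) (sym (row (a ≟ opposite a)))))
    where
    row : Dec (a ≡ opposite a) → (N *ᵥ (K *ᵥ x)) a ≈ κ a * (K *ᵥ x) (opposite a)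
    row (no a≢a′) = trans (blocks-paired paired? paired-opposite 0ᶠ κ ν (K *ᵥ x) a (m , a≢a′)) (trans (+-congʳ (zeroˡ _)) (+-identityˡ _))
    row (yes a≡a′) = trans (blocks-unpaired paired? paired-opposite 0ᶠ κ ν (K *ᵥ x) a (λ h → proj₂ h a≡a′))
      (*-cong (reflexive (≡.trans (if-no (a ≟ zero) a≢0) (≡.trans (if-no (a ≟ last) a≢N) (≡.cong (λ b → ε * t ^ s b) a≡a′))))
              (reflexive (≡.cong (K *ᵥ x) a≡a′)))

  square-root : ∀ x → ∃ λ y → y * y ≈ x
  -- The data are the lower coefficients -x and 0 of the monic polynomial Y² - x.
  square-root x with algebraicallyClosed (- x) (0# ∷ [])
  ... | y , root = y , (begin
    y * y
      ≈⟨ solve 2 (λ x y → y :* y := x :+ (:- x :+ y :* (con ℤ.0ℤ :+ y :* (con ℤ.1ℤ :+ y :* con ℤ.0ℤ)))) refl x y ⟩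
    x + (- x + y * (0# + y * (1# + y * 0#)))           ≈⟨ +-congˡ root ⟩
    x + 0#                                             ≈⟨ +-identityʳ x ⟩
    x                                                  ∎)

  -- The condition on 2 is required only in the presence of a pair, so that characteristic 2 without
  -- pairs is covered as well.
  N-eigenbasis : (∀ a → Paired a → 1# + 1# ≉ 0#) → Eigenbasis N
  N-eigenbasis 2≉0 = blocks-eigenbasis paired? paired-opposite ν κ μ (λ a _ → κκ a) ρ
    (λ a _ → ρρ a) (λ a h → ρ-opposite a (proj₂ h)) (λ a h e → *-≉0 (2≉0 a h) μ≉0
      (trans (distribʳ μ 1# 1#) (trans (+-cong (*-identityˡ μ) (*-identityˡ μ)) e)))
    where
    lam = proj₁ (square-root μ)
    -- One square root of μ at the smaller index of a pair and its negative at the larger one.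
    ρ : Vector
    ρ a = if does (toℕ a ℕ.<? toℕ (opposite a)) then lam else - lam
    ρρ : ∀ a → ρ a * ρ a ≈ μ
    ρρ a with does (toℕ a ℕ.<? toℕ (opposite a))
    ... | true  = proj₂ (square-root μ)
    ... | false = trans (solve 1 (λ l → :- l :* :- l := l :* l) refl lam) (proj₂ (square-root μ))
    ρ-opposite : ∀ a → a ≢ opposite a → ρ (opposite a) ≈ - ρ a
    ρ-opposite a a≢a′ with ℕ.<-cmp (toℕ a) (toℕ (opposite a))
    ... | tri< a<a′ _ a′≮a = trans (reflexive (if-no (toℕ a′ ℕ.<? toℕ (opposite a′)) (a′≮a ∘ ≡.subst (toℕ a′ ℕ.<_) (≡.cong toℕ (opposite-involutive a)))))
      (-‿cong (reflexive (≡.sym (if-yes (toℕ a ℕ.<? toℕ a′) a<a′))))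
      where a′ = opposite a
    ... | tri≈ _ e _ = contradiction (toℕ-injective e) a≢a′
    ... | tri> a≮a′ _ a′<a = trans (reflexive (if-yes (toℕ a′ ℕ.<? toℕ (opposite a′)) (≡.subst (toℕ a′ ℕ.<_) (≡.cong toℕ (≡.sym (opposite-involutive a))) a′<a)))
      (trans (sym (-‿involutive lam)) (-‿cong (reflexive (≡.sym (if-no (toℕ a ℕ.<? toℕ a′) a≮a′)))))
      where a′ = opposite a

  MD-diagonalizable : (∀ a → Paired a → 1# + 1# ≉ 0#) → Diagonalizable (M *ᴹ D)
  MD-diagonalizable 2≉0 = Equivalence.from (diagonalizable⇔eigenbasis {N = M *ᴹ D})
    (eigenbasis-similar {K = K⁻¹} {K} {N} {M *ᴹ D} (inverse-sym K-inverse) (intertwined {K = K} {K⁻¹} {M *ᴹ D} {N} K-inverse K-MD) (N-eigenbasis 2≉0))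

  MD-¬diagonalizable : 1# + 1# ≈ 0# → ∀ a → Paired a → ¬ Diagonalizable (M *ᴹ D)
  MD-¬diagonalizable 2≈0 a h diagonalizable =
    blocks-¬eigenbasis paired? paired-opposite ν κ μ (λ a _ → κκ a) 2≈0 μ≉0
      (proj₁ (square-root μ)) (proj₂ (square-root μ)) a h (proj₂ h)
      (eigenbasis-similar {K = K} {K⁻¹} {M *ᴹ D} {N} K-inverse K-MD (Equivalence.to (diagonalizable⇔eigenbasis {N = M *ᴹ D}) diagonalizable))

  2∣q⇒2≈0 : 2 ∣ suc q-1 → 1# + 1# ≈ 0#
  2∣q⇒2≈0 2∣q = trans (+-congˡ (sym (+-identityʳ 1#))) (trans (reflexive (≡.cong (_· 1#) (≡.sym p≡2))) p·1≈0)
    where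
    p≡2 : p ≡ 2
    p≡2 with prime⇒irreducible pp (2∣m^n⇒2∣m p r (≡.subst (2 ∣_) q≡p^r 2∣q))
    ... | inj₂ e = ≡.sym e

  -- As r > 0, an odd q has an odd p = 1 + 2⌊p/2⌋; with p = 0 and 2 = 0 in ℂ∞ this would give 1 = 0.
  2∤q⇒2≉0 : ¬ (2 ∣ suc q-1) → NonZero r → 1# + 1# ≉ 0#
  2∤q⇒2≉0 2∤q r≢0 2≈0 = by r q≡p^r r≢0
    where
    by : ∀ r → suc q-1 ≡ p ℕ.^ r → NonZero r → _
    by (suc r′) q≡ _ with p ℕ.% 2 in eq
    ... | 0 = 2∤q (≡.subst (2 ∣_) (≡.sym q≡) (∣-trans (m%n≡0⇒n∣m p 2 eq) (m∣m*n (p ℕ.^ r′))))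
    ... | suc (suc _) = contradiction (≡.subst (ℕ._< 2) eq (ℕ.m%n<n p 2)) λ { (s≤s (s≤s ())) }
    ... | 1 = 1≉0 (begin
      1#                                             ≈⟨ +-identityʳ 1# ⟨
      1# + 0#
        ≈⟨ +-congˡ (trans (*-congˡ (trans (+-congˡ (+-identityʳ 1#)) 2≈0)) (zeroʳ _)) ⟨
      1# + (p ℕ./ 2) · 1# * 2 · 1#                 ≈⟨ +-congˡ (×1-homo-* (p ℕ./ 2) 2) ⟨
      (1 ℕ.+ p ℕ./ 2 ℕ.* 2) · 1#
        ≡⟨ ≡.cong (_· 1#) (≡.trans (ℕ.m≡m%n+[m/n]*n p 2) (≡.cong (ℕ._+ p ℕ./ 2 ℕ.* 2) eq)) ⟨
      p · 1#                                         ≈⟨ p·1≈0 ⟩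
      0#                                             ∎)

  -- A basis of the new subspace

  mid : Fin j → Fin (suc (suc j))
  mid i = suc (inject₁ i)

  mid-injective : ∀ {i k} → mid i ≡ mid k → i ≡ k
  mid-injective e = inject₁-injective (suc-injective e)

  mid-middle : ∀ i → Middle (mid i)
  mid-middle i = (λ ()) , (λ e → fromℕ≢inject₁ (≡.sym (suc-injective e)))

  middle-mid : ∀ a → Middle a → ∃ λ i → a ≡ mid i
  middle-mid zero (a≢0 , _) = contradiction ≡.refl a≢0
  middle-mid (suc a) (_ , a≢N) with view a
  ... | ‵fromℕ     = contradiction ≡.refl a≢N
  ... | ‵inject₁ i = i , ≡.refl

  -- Preimages under K of the middle unit vectors. Their middle coordinates are again unit vectors,
  -- so coefficients can be read off there; χ and φ vanish on them.
  newBasis : Fin j → Vector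
  newBasis i = K⁻¹ *ᵥ unit (mid i)

  newBasis-middle : ∀ i a → Middle a → newBasis i a ≈ unit (mid i) a
  newBasis-middle i = K⁻¹-middle (unit (mid i))

  newBasis-new : ∀ i → NewCoordinates (newBasis i)
  newBasis-new i = new-from-χ (newBasis i) (trans (χ-K⁻¹ (unit (mid i))) (unit-≢ {a = mid i} {i = zero} λ ()))
    (trans (φ-K⁻¹ (unit (mid i))) (unit-≢ {a = mid i} {i = last} (λ e → proj₂ (mid-middle i) (≡.sym e))))

  lincomb-new : ∀ α → NewCoordinates (lincomb α newBasis)
  lincomb-new α = new-from-χ (lincomb α newBasis)
    (trans (dot-lincomb χ-w α newBasis) (sum-zero _ (λ i → trans (*-congˡ (χ≈0 (newBasis i) (newBasis-new i))) (zeroʳ _))))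
    (trans (dot-lincomb w α newBasis) (sum-zero _ (λ i → trans (*-congˡ (proj₁ (newBasis-new i))) (zeroʳ _))))

  lincomb-newBasis-mid : ∀ α i → lincomb α newBasis (mid i) ≈ α i
  lincomb-newBasis-mid α i = begin
    lincomb α newBasis (mid i)
      ≈⟨ sum-single _ i (λ k k≢i → trans (*-congˡ (trans (newBasis-middle k (mid i) (mid-middle i))
                                           (unit-≢ (λ e → k≢i (mid-injective (≡.sym e)))))) (zeroʳ (α k))) ⟩
    α i * newBasis i (mid i)         ≈⟨ *-congˡ (trans (newBasis-middle i (mid i) (mid-middle i)) (unit-≡ (mid i))) ⟩
    α i * 1#                         ≈⟨ *-identityʳ (α i) ⟩
    α i                               ∎

  new-dimension : HasDimension NewCoordinates j
  new-dimension = newBasis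
    , ( (λ {x} n → x ∘ mid , expansion x n)
      , (λ {x} (α , x≋) → new-≋ (lincomb α newBasis) x (λ a → sym (x≋ a)) (lincomb-new α)))
    , λ α h i → trans (sym (lincomb-newBasis-mid α i)) (h (mid i))
    where
    -- The difference x - y is new, and it is also old because x and y agree in the middle; hence it
    -- is zero.
    expansion : ∀ x → NewCoordinates x → x ≋ lincomb (x ∘ mid) newBasis
    expansion x n a = x∙y⁻¹≈ε⇒x≈y (x a) (y a) (trans (+-congˡ (sym (-1*x≈-x (y a))))
      (old∩new (x ⊕ scaled (- 1#) y) old new a))
      where
      y = lincomb (x ∘ mid) newBasis
      old : OldCoordinates (x ⊕ scaled (- 1#) y)
      old b m with middle-mid b m
      ... | i , ≡.refl = trans (+-congˡ (trans (-1*x≈-x _) (-‿cong (lincomb-newBasis-mid (x ∘ mid) i)))) (-‿inverseʳ (x (mid i)))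
      functional : ∀ u → dot u x ≈ 0# → dot u y ≈ 0# → dot u (x ⊕ scaled (- 1#) y) ≈ 0#
      functional u ux uy = trans (dot-⊕ʳ u x (scaled (- 1#) y))
        (trans (+-cong ux (trans (dot-scaledʳ u (- 1#) y) (trans (*-congˡ uy) (zeroʳ _)))) (+-identityˡ 0#))
      new : NewCoordinates (x ⊕ scaled (- 1#) y)
      new = new-from-χ (x ⊕ scaled (- 1#) y)
        (functional χ-w (χ≈0 x n) (χ≈0 y (lincomb-new (x ∘ mid))))
        (functional w (proj₁ n) (proj₁ (lincomb-new (x ∘ mid))))

  toℕ-positive : ∀ {n} (a : Fin (suc n)) → a ≢ zero → 1 ≤ toℕ a
  toℕ-positive zero    a≢0 = contradiction ≡.refl a≢0
  toℕ-positive (suc a) _   = s≤s z≤n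

  -- Middle opposite indices are both at least 1 and have sum j + 1 ≤ 2, so they coincide.
  j≤1⇒¬paired : j ≤ 1 → ∀ a → ¬ Paired a
  j≤1⇒¬paired j≤1 a ((a≢0 , a≢N) , a≢a′) = a≢a′ (toℕ-injective (≡.trans (one (toℕ a) (toℕ a′) 1≤a 1≤a′ a+a′≤2)
      (≡.sym (one (toℕ a′) (toℕ a) 1≤a′ 1≤a (≡.subst (_≤ 2) (ℕ.+-comm (toℕ a) (toℕ a′)) a+a′≤2)))))
    where
    a′ = opposite a
    1≤a = toℕ-positive a a≢0
    1≤a′ = toℕ-positive a′ (proj₁ (middle-opposite (a≢0 , a≢N)))
    a+a′≤2 : toℕ a ℕ.+ toℕ a′ ≤ 2
    a+a′≤2 = ≡.subst (_≤ 2) (≡.sym (toℕ+toℕ-opposite a)) (s≤s j≤1)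
    one : ∀ x y → 1 ≤ x → 1 ≤ y → x ℕ.+ y ≤ 2 → x ≡ 1
    one (suc zero)    y       _ _ _ = ≡.refl
    one (suc (suc x)) (suc y) _ _ (s≤s (s≤s h)) = contradiction (≡.subst (_≤ 0) (ℕ.+-suc x y) h) λ ()

  -- The index opposite to 1 is j, which differs from 1.
  paired-1 : ¬ (j ≤ 1) → Paired (suc zero)
  paired-1 j≰1 = ((λ ()) , λ e → j≰1 (ℕ.≤-trans (ℕ.≤-reflexive (≡.sym (ℕ.suc-injective (≡.trans (≡.cong toℕ e) (toℕ-fromℕ (suc j)))))) z≤n))
    , λ e → j≰1 (ℕ.≤-reflexive (≡.sym (≡.trans (≡.cong toℕ e) (≡.trans (opposite-suc {suc j} zero) (toℕ-fromℕ j)))))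

  -- Transfer to cusp forms

  module _ (k : ℕ) (m : ℤ) (c : Fin (suc (suc j)) → Ω → Carrier) (isBasis : IsCocycleBasis j (suc (suc j)) k m c) where
    open Operators k m
    open IsCocycleBasis isBasis

    independent : ∀ a → lincomb a c ≋ 0ᶠ → a ≋ 0ᶠ
    independent = proj₂ basis

    independent-difference : ∀ a b → lincomb a c ≋ lincomb b c → a ≋ b
    independent-difference a b e i = x∙y⁻¹≈ε⇒x≈y (a i) (b i) (trans (+-congˡ (sym (-1*x≈-x (b i))))
      (independent (a ⊕ scaled (- 1#) b) (λ z → trans (lincomb-⊕ a (scaled (- 1#) b) c z)
        (trans (+-cong (e z) (trans (lincomb-scaled (- 1#) b c z) (-1*x≈-x _))) (-‿inverseʳ _))) i))

    ⁻¹-≉0 : ∀ {x} → x ≉ 0# → x ⁻¹ ≉ 0#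
    ⁻¹-≉0 x≉0 e = 1≉0 (trans (sym (*-inverseʳ x≉0)) (trans (*-congˡ e) (zeroʳ _)))

    t^m-k≉0 : t^m-k ≉ 0#
    t^m-k≉0 with m -ᶻ (+ k)
    ... | + d      = ^-≉0 t≉0 d
    ... | -[1+ d ] = ⁻¹-≉0 (^-≉0 t≉0 (suc d))

    Tr-lincomb : ∀ a → Tr (lincomb a c) ≋ lincomb (T *ᵥ a) c
    Tr-lincomb = matrix-lincomb {L = Tr} c T (linear-Tr k m) matrix-Tr

    Tr′-lincomb : ∀ a → Tr′ (lincomb a c) ≋ scaled t^m-k (lincomb ((F +ᴹ M *ᴹ D) *ᵥ a) c)
    Tr′-lincomb a z = trans (matrix-lincomb {L = Tr′} c (t^m-k ·ᴹ (F +ᴹ M *ᴹ D)) (linear-Tr′ k m) matrix-Tr′ a z)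
      (trans (lincomb-congˡ ((t^m-k ·ᴹ (F +ᴹ M *ᴹ D)) *ᵥ a) (scaled t^m-k ((F +ᴹ M *ᴹ D) *ᵥ a)) c
               (λ i → dot-scaledˡ ((F +ᴹ M *ᴹ D) i) t^m-k a) z)
             (lincomb-scaled t^m-k ((F +ᴹ M *ᴹ D) *ᵥ a) c z))

    -- On coordinates Tr and Tr′ give φ e₀ and a nonzero multiple of ψ e₀. Independence of `c` turns
    -- the vanishing of these forms into φ = ψ = 0.
    New≐coordinates : New ≐ WithCoordinates c NewCoordinates
    New≐coordinates = (λ {f} → to f) , (λ {f} → from f)
      where
      to : ∀ f → New f → WithCoordinates c NewCoordinates f
      to f (S¹f , Trf , Tr′f) with proj₁ (proj₁ basis) S¹f
      ... | a , f≋ = a , (φa , ψa) , f≋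
        where
        φa : φ a ≈ 0#
        φa = Ker-T⇒ a (independent (T *ᵥ a) (λ z → trans (sym (Tr-lincomb a z))
          (trans (sym (L-cong (linear-Tr k m) f (lincomb a c) f≋ z)) (Trf z))))
        ψa : ψ a ≈ 0#
        ψa = Ker-F+MD⇒ a (independent ((F +ᴹ M *ᴹ D) *ᵥ a) (λ z → cancel-≉0 t^m-k≉0 (trans (sym (Tr′-lincomb a z))
          (trans (sym (L-cong (linear-Tr′ k m) f (lincomb a c) f≋ z)) (Tr′f z)))))
      from : ∀ f → WithCoordinates c NewCoordinates f → New f
      from f (a , (φa , ψa) , f≋) = proj₂ (proj₁ basis) (a , f≋)
        , (λ z → trans (L-cong (linear-Tr k m) f (lincomb a c) f≋ z) (trans (Tr-lincomb a z)
            (lincomb-zero (T *ᵥ a) c (⇒Ker-T a φa) z)))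
        , (λ z → trans (L-cong (linear-Tr′ k m) f (lincomb a c) f≋ z) (trans (Tr′-lincomb a z)
            (trans (*-congˡ (lincomb-zero ((F +ᴹ M *ᴹ D) *ᵥ a) c (⇒Ker-F+MD a ψa) z)) (zeroʳ _))))

    Old≐ : Old ≐ WithCoordinates c (Ker (M *ᴹ A) +ˢ Ker (M *ᴹ D))
    Old≐ = (λ {f} → to f) , (λ {f} → from f)
      where
      to : ∀ f → Old f → WithCoordinates c (Ker (M *ᴹ A) +ˢ Ker (M *ᴹ D)) f
      to f (g , h , Sg , Sh , f≋) with proj₁ image-δ₁ (g , Sg , λ _ → refl) | proj₁ image-δₜ (h , Sh , λ _ → refl)
      ... | a , Ka , g≋ | b , Kb , h≋ = a ⊕ b , (a , b , Ka , Kb , λ _ → refl)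
        , λ z → trans (f≋ z) (trans (+-cong (g≋ z) (h≋ z)) (sym (lincomb-⊕ a b c z)))
      from : ∀ f → WithCoordinates c (Ker (M *ᴹ A) +ˢ Ker (M *ᴹ D)) f → Old f
      from f (x , (a , b , Ka , Kb , x≋) , f≋)
        with proj₂ image-δ₁ (a , Ka , λ _ → refl) | proj₂ image-δₜ (b , Kb , λ _ → refl)
      ... | g , Sg , a≋ | h , Sh , b≋ = g , h , Sg , Sh
        , λ z → trans (f≋ z) (trans (lincomb-congˡ x (a ⊕ b) c x≋ z) (trans (lincomb-⊕ a b c z) (+-cong (a≋ z) (b≋ z))))

    Old≐coordinates : Old ≐ WithCoordinates c OldCoordinates
    Old≐coordinates = (λ o → withCoordinates-mono c {V = Ker (M *ᴹ A) +ˢ Ker (M *ᴹ D)} (proj₁ old≐) (proj₁ Old≐ o))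
                    , (λ o → proj₂ Old≐ (withCoordinates-mono c {V = OldCoordinates} (proj₂ old≐) o))

    New≐ : New ≐ WithCoordinates c (Ker T ∩ Image F (Ker T))
    New≐ = (λ n → withCoordinates-mono c {V = NewCoordinates} (proj₂ new≐) (proj₁ New≐coordinates n))
         , (λ n → proj₂ New≐coordinates (withCoordinates-mono c {V = Ker T ∩ Image F (Ker T)} (proj₁ new≐) n))

    S¹-directSum : S¹ k m Γ₀t isDirectSumOf Old and New
    S¹-directSum = ((λ {f} → to f) , (λ {f} → from f)) , (λ {f} → meet f) , (λ {f} → trivial f)
      where
      split : ∀ f x → f ≋ lincomb x c → (∃₂ λ a b → OldCoordinates a × NewCoordinates b × x ≋ a ⊕ b) → (Old +ˢ New) f
      split f x f≋ (a , b , oa , nb , x≋) = lincomb a c , lincomb b c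
        , proj₂ Old≐coordinates (a , oa , λ _ → refl) , proj₂ New≐coordinates (b , nb , λ _ → refl)
        , λ z → trans (f≋ z) (trans (lincomb-congˡ x (a ⊕ b) c x≋ z) (lincomb-⊕ a b c z))
      to : ∀ f → S¹ k m Γ₀t f → (Old +ˢ New) f
      to f Sf = let x , f≋ = proj₁ (proj₁ basis) Sf in split f x f≋ (old+new x)
      combine : ∀ f g h → f ≋ g ⊕ h → WithCoordinates c OldCoordinates g → WithCoordinates c NewCoordinates h → S¹ k m Γ₀t f
      combine f g h f≋ (a , _ , g≋) (b , _ , h≋) = proj₂ (proj₁ basis)
        (a ⊕ b , λ z → trans (f≋ z) (trans (+-cong (g≋ z) (h≋ z)) (sym (lincomb-⊕ a b c z))))
      from : ∀ f → (Old +ˢ New) f → S¹ k m Γ₀t f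
      from f (g , h , og , nh , f≋) = combine f g h f≋ (proj₁ Old≐coordinates og) (proj₁ New≐coordinates nh)
      vanish : ∀ f → WithCoordinates c OldCoordinates f → WithCoordinates c NewCoordinates f → f ≋ 0ᶠ
      vanish f (a , oa , f≋a) (b , nb , f≋b) z = trans (f≋a z) (lincomb-zero a c (old∩new a oa (new-≋ b a b≋a nb)) z)
        where
        b≋a : b ≋ a
        b≋a = independent-difference b a (λ z → trans (sym (f≋b z)) (f≋a z))
      meet : ∀ f → (Old ∩ New) f → f ≋ 0ᶠ
      meet f (o , n) = vanish f (proj₁ Old≐coordinates o) (proj₁ New≐coordinates n)
      trivial : ∀ f → f ≋ 0ᶠ → (Old ∩ New) f
      trivial f f≋0 = proj₂ Old≐coordinates (0ᶠ , zero-old 0ᶠ (λ _ → refl) , f≋)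
                 , proj₂ New≐coordinates (0ᶠ , zero-new 0ᶠ (λ _ → refl) , f≋)
        where
        f≋ : f ≋ lincomb 0ᶠ c
        f≋ z = trans (f≋0 z) (sym (lincomb-zero 0ᶠ c (λ _ → refl) z))

    New-dimension : HasDimension New j
    New-dimension = hasDimension-≐ {V = WithCoordinates c NewCoordinates} {W = New} (proj₂ New≐coordinates , proj₁ New≐coordinates)
      (hasDimension-withCoordinates c independent NewCoordinates j new-dimension)

    -- A pair supplies two elements x and y of `newBasis`. In a relation βx = αy, the middle
    -- coordinate belonging to y forces α = 0, and then x = 0, although x has a coordinate equal to
    -- 1.
    paired⇒dimension≰1 : ∀ a → Paired a → ∀ d → HasDimension New d → ¬ (d ≤ 1)
    paired⇒dimension≰1 a pa d dim d≤1
      with middle-mid a (proj₁ pa) | middle-mid (opposite a) (middle-opposite (proj₁ pa))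
    ... | i , a≡ | i′ , a′≡ = 1≉0 (trans (sym (unit-≡ (mid i))) (trans (sym (newBasis-middle i (mid i) (mid-middle i))) (x≋0 (mid i))))
      where
      x = newBasis i
      y = newBasis i′
      i≢i′ : i ≢ i′
      i≢i′ e = proj₂ pa (≡.trans a≡ (≡.trans (≡.cong mid e) (≡.sym a′≡)))
      member : ∀ i → New (lincomb (newBasis i) c)
      member i = proj₂ New≐coordinates (newBasis i , newBasis-new i , λ _ → refl)
      dependence = dimension≤1-dependent {V = New} d dim d≤1 (lincomb x c) (lincomb y c) (member i) (member i′)
      α = proj₁ dependence
      β = proj₁ (proj₂ dependence)
      βx≋αy : scaled β x ≋ scaled α y
      βx≋αy = independent-difference (scaled β x) (scaled α y) (λ z → trans (lincomb-scaled β x c z)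
        (trans (proj₁ (proj₂ (proj₂ dependence)) z) (sym (lincomb-scaled α y c z))))
      α≈0 : α ≈ 0#
      α≈0 = begin
        α                     ≈⟨ *-identityʳ α ⟨
        α * 1#               ≈⟨ *-congˡ (trans (newBasis-middle i′ (mid i′) (mid-middle i′)) (unit-≡ (mid i′))) ⟨
        α * y (mid i′)       ≈⟨ βx≋αy (mid i′) ⟨
        β * x (mid i′)
          ≈⟨ *-congˡ (trans (newBasis-middle i (mid i′) (mid-middle i′)) (unit-≢ (λ e → i≢i′ (mid-injective (≡.sym e))))) ⟩
        β * 0#               ≈⟨ zeroʳ β ⟩
        0#                    ∎
      x≋0 : x ≋ 0ᶠ
      x≋0 = independent x (proj₂ (proj₂ (proj₂ dependence)) α≈0)

    -- Both sides are decided by whether j ≤ 1, that is, by whether a pair exists.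
    diagonalizable⇔dimension≤1 : 2 ∣ suc q-1 → Diagonalizable (M *ᴹ D) ⇔ (∃ λ d → HasDimension New d × d ≤ 1)
    diagonalizable⇔dimension≤1 2∣q with j ℕ.≤? 1
    ... | yes j≤1 = mk⇔ (λ _ → j , New-dimension , j≤1)
                        (λ _ → MD-diagonalizable (λ a h → contradiction h (j≤1⇒¬paired j≤1 a)))
    ... | no j≰1  = mk⇔ (λ diagonalizable → contradiction diagonalizable (MD-¬diagonalizable (2∣q⇒2≈0 2∣q) (suc zero) (paired-1 j≰1)))
                        (λ (d , dim , d≤1) → contradiction d≤1 (paired⇒dimension≰1 (suc zero) (paired-1 j≰1) d dim))

open import Data.Nat.Base using (_+_; _*_; _∸_; _^_)

corollary5p13 :
    (p r q : ℕ) → Prime p → NonZero r → q ≡ p ^ r →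
    (C : ℂ∞ q) →
    (j n k : ℕ) (m : ℤ) →
    j ≤ q ∸ 2 →
    n ≡ j + 2 →
    k ≡ 2 * j + 2 + (n ∸ 1) * (q ∸ 1) →
    (+ (q ∸ 1)) ∣ᶻ (m -ᶻ (+ (j + 1))) →
    let open Drinfeld C
        open Matrices j n
        open Operators k m
    in
      ( (Ker (M *ᴹ A) ∩ Ker (F +ᴹ M *ᴹ D)) ≐ (Ker (M *ᴹ A) ∩ Image F (Ker (1ᴹ +ᴹ M *ᴹ A)))
      × (Ker (M *ᴹ A) ∩ Image F (Ker (1ᴹ +ᴹ M *ᴹ A))) ≐ Zero )
    × (¬ (2 ∣ q) → Diagonalizable (M *ᴹ D))
    × U isDirectSumOf (Ker (M *ᴹ A) +ˢ Ker (M *ᴹ D)) and (Ker T ∩ Image F (Ker T))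
    × (Ker (M *ᴹ A) ∩ Ker (M *ᴹ D)) ≐ Zero
    × ( (c : Fin n → Ω → Carrier) → IsCocycleBasis j n k m c →
        ( 2 ∣ q → (Diagonalizable (M *ᴹ D) ⇔ (∃ λ d → HasDimension New d × d ≤ 1)) )
      × S¹ k m Γ₀t isDirectSumOf Old and New
      × Old ≐ WithCoordinates c (Ker (M *ᴹ A) +ˢ Ker (M *ᴹ D))
      × New ≐ WithCoordinates c (Ker T ∩ Image F (Ker T)) )
-- The values q = 0 and q = 1 are not prime powers with positive exponent: they would force p = 0,
-- or r = 0 or p = 1.
corollary5p13 p r zero pp _ q≡p^r = contradiction pp (≡.subst (λ x → ¬ Prime x) (≡.sym (ℕ.m^n≡0⇒m≡0 p r (≡.sym q≡p^r))) ¬prime[0])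
corollary5p13 p r (suc zero) pp r≢0 q≡p^r with ℕ.m^n≡1⇒n≡0∨m≡1 p r (≡.sym q≡p^r)
... | inj₁ r≡0 = contradiction r≡0 (ℕ.≢-nonZero⁻¹ r {{r≢0}})
... | inj₂ ≡.refl = contradiction pp ¬prime[1]
-- With q - 2 exposed, j ≤ q - 2 becomes the bound j < q - 1 behind the digit expansions, and n = j
-- + 2 is brought to the successor form.
corollary5p13 p r (suc (suc q-2)) pp r≢0 q≡p^r C j n k m j≤q-2 n≡j+2 _ _ with ≡.trans n≡j+2 (ℕ.+-comm j 2)
... | ≡.refl =
    (Ker-MA∩Ker-F+MD , Ker-MA∩Image-F)
  , (λ 2∤q → MD-diagonalizable (λ _ _ → 2∤q⇒2≉0 2∤q r≢0))
  , directSum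
  , Ker-MA∩Ker-MD
  , (λ c isBasis → diagonalizable⇔dimension≤1 k m c isBasis , S¹-directSum k m c isBasis , Old≐ k m c isBasis , New≐ k m c isBasis)
  where
  open OverPrimePower p r pp (suc q-2) q≡p^r C j (s≤s j≤q-2)
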